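{- Let $c\in(0,1/5)$ and set $\delta=10^{ -10}$. Then there is $\varepsilon_0=\varepsilon_0(c)>0$ such that for every $0<\varepsilon<\varepsilon_0$ there exists $n_0\in\mathbb{N}$ such that the following holds for all integers $n,s$ with $n\ge n_0$ and $cn\le s\le (n-3)/(5-\delta)$. If $G$ is a stable $4$-graph on $[n]$ with fractional matching number $\nu^*(G)\le s$ and $e(G)\ge\binom{n}{4}-\binom{n-s}{4}-\varepsilon n^4$, then $G$ is $100\varepsilon^{1/4}$-close to $H_1$.
   Context: A $4$-graph on $[n]$ is a family of $4$-element subsets (edges) of $[n]$; $e(G)$ is the number of edges. A fractional matching of a hypergraph $G=(V,E)$ is a function $\phi:E\to[0,1]$ with $\sum_{e\ni v}\phi(e)\le 1$ for every $v\in V$; its size is $\sum_{e\in E}\phi(e)$, and $\nu^*(G)$ is the maximum size of a fractional matching. A $k$-graph $G$ on $[n]$ is stable if for every edge $\{a_1,\dots,a_k\}$ and every $\{b_1,\dots,b_k\}\in\binom{[n]}{k}$ with $b_i\le a_i$ for all $i$, $\{b_1,\dots,b_k\}$ is also an edge. For $k$-graphs $G,H$ on the same $n$-element vertex set, $G$ is $\varepsilon$-close to $H$ if $|E(H)\setminus E(G)|<\varepsilon n^k$. $H_1$ is the $4$-graph on $[n]$ whose edges are all $e\in\binom{[n]}{4}$ with $e\cap[s]\ne\emptyset$.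
   Formalization: The formal theorem takes c and ε to be rational numbers (and fractional matchings with rational weights, which does not change the condition ν*(G) ≤ s), instead of arbitrary reals. -}

module Defs where

open import Data.Nat using (ℕ; zero; suc; _∸_; _^_) renaming (_<_ to _<ℕ_; _≤_ to _≤ℕ_; _<ᵇ_ to _<ᵇ_)
open import Data.Nat.Combinatorics using (_C_)
open import Data.Integer using (+_)
open import Data.Rational using (ℚ; _/_; _+_; _*_; _-_; _≤_; _<_; 0ℚ; 1ℚ)
open import Data.Fin using (Fin; toℕ)
open import Data.Fin.Base renaming (_≤_ to _≤ᶠ_) using ()
open import Data.Bool using (Bool; true; false; _∧_; _∨_; not; if_then_else_)
open import Data.List using (List; []; _∷_; concatMap; filterᵇ; length; foldr; map; allFin)
open import Data.Product using (_×_; _,_)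
open import Relation.Binary.PropositionalEquality using (_≡_)

ℕ→ℚ : ℕ → ℚ
ℕ→ℚ n = (+ n) / 1

-- A 4-set {a1<a2<a3<a4} of [n] (vertices [n] are encoded as Fin n, i.e. i ↦ i+1),
-- written as an ordered quadruple; only strictly increasing quadruples are used.
Quad : ℕ → Set
Quad n = Fin n × Fin n × Fin n × Fin n

increasing : ∀ {n} → Quad n → Bool
increasing (a , b , c , d) = (toℕ a <ᵇ toℕ b) ∧ ((toℕ b <ᵇ toℕ c) ∧ (toℕ c <ᵇ toℕ d))

allQuads : (n : ℕ) → List (Quad n)
allQuads n = filterᵇ increasing
  (concatMap (λ a → concatMap (λ b → concatMap (λ c → map (λ d → (a , b , c , d)) (allFin n)) (allFin n)) (allFin n)) (allFin n))

-- a 4-graph on [n]: membership predicate on 4-sets (consulted only on increasing quadruples)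
Graph4 : ℕ → Set
Graph4 n = Quad n → Bool

edges : ∀ {n} → Graph4 n → List (Quad n)
edges {n} G = filterᵇ G (allQuads n)

e : ∀ {n} → Graph4 n → ℕ
e G = length (edges G)

Stable : ∀ {n} → Graph4 n → Set
Stable {n} G = ∀ (a1 a2 a3 a4 b1 b2 b3 b4 : Fin n) →
  increasing (a1 , a2 , a3 , a4) ≡ true → increasing (b1 , b2 , b3 , b4) ≡ true →
  G (a1 , a2 , a3 , a4) ≡ true →
  b1 ≤ᶠ a1 → b2 ≤ᶠ a2 → b3 ≤ᶠ a3 → b4 ≤ᶠ a4 →
  G (b1 , b2 , b3 , b4) ≡ true

_∈ᵇ_ : ∀ {n} → Fin n → Quad n → Bool
v ∈ᵇ (a , b , c , d) = (toℕ v ≡ᵇ toℕ a) ∨ ((toℕ v ≡ᵇ toℕ b) ∨ ((toℕ v ≡ᵇ toℕ c) ∨ (toℕ v ≡ᵇ toℕ d)))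
  where open import Data.Nat using (_≡ᵇ_)

sumℚ : List ℚ → ℚ
sumℚ = foldr _+_ 0ℚ

IsFracMatching : ∀ {n} → Graph4 n → (Quad n → ℚ) → Set
IsFracMatching {n} G φ =
  (∀ (q : Quad n) → q ∈ edges G → (0ℚ ≤ φ q) × (φ q ≤ 1ℚ)) ×
  (∀ (v : Fin n) → sumℚ (map φ (filterᵇ (v ∈ᵇ_) (edges G))) ≤ 1ℚ)
  where open import Data.List.Membership.Propositional using (_∈_)

size : ∀ {n} → Graph4 n → (Quad n → ℚ) → ℚ
size G φ = sumℚ (map φ (edges G))

FracMatchingNumber≤ : ∀ {n} → Graph4 n → ℚ → Set
FracMatchingNumber≤ {n} G s = ∀ (φ : Quad n → ℚ) → IsFracMatching G φ → size G φ ≤ s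

-- H_1 : all 4-sets meeting [s] = {1,..,s}, i.e. (0-based) smallest element < s
H₁ : (n s : ℕ) → Graph4 n
H₁ n s (a , b , c , d) = toℕ a <ᵇ s

missing : ∀ {n} → Graph4 n → Graph4 n → ℕ
missing {n} G H = length (filterᵇ (λ q → H q ∧ not (G q)) (allQuads n))

-- G is (100 ε^{1/4})-close to H :  |E(H)∖E(G)| < 100 ε^{1/4} n^4,
-- written equivalently (both sides nonnegative) as |E(H)∖E(G)|^4 < 100^4 ε n^16
Close100Root4 : ∀ {n} → ℚ → Graph4 n → Graph4 n → Set
Close100Root4 {n} ε G H = ℕ→ℚ (missing G H ^ 4) < (ℕ→ℚ (100 ^ 4) * ε) * ℕ→ℚ (n ^ 16)

δ : ℚ
δ = (+ 1) / (10 ^ 10)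

{-# OPTIONS --safe #-}
module Submission where

-- By linear programming duality and stability, the bound on ν* yields nonincreasing vertex weights w with values in
-- [0 , 1] and total at most s such that every edge has weight at least 1. For x = 50/249, slightly above 1/(5 - δ),
-- there is a symmetric function r of three weights such that for all a, b, c, d in [0 , 1]
--   slack(a , b , c , d) = [a + b + c + d < 1] - (1 - a)(1 - b)(1 - c)(1 - d) + ¼ ((a - x) r(b , c , d) + ... )
-- is nonnegative, and at least a constant times 1 - max if a + b + c + d ≥ 1. When the mean weight is x (adding vertices
-- of weight 1 lowers the general case to this one) the terms with r cancel in the sum over all quadruples, so the
-- number of light quadruples exceeds (n - s)⁴ by at least the total slack. Many edges leave few light quadruples, hence
-- little slack; but an edge avoiding [s] has slack bounded below unless its first vertex has weight close to 1, and few
-- vertices outside [s] do. So few edges avoid [s], which is closeness to H₁.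

-- In probabilistic terms: for independent copies of a [0 , 1]-valued variable with mean y ≤ x, four
-- of them sum to less than 1 with probability at least (1 - y)⁴, with a quantitative surplus.
-- Minimising this probability over distributions is a problem of degree four. The mean condition
-- may be applied to one coordinate while the other three are fixed, so its multiplier may depend on
-- those three: this is r, the solution of a linear dual problem. Taking r piecewise quadratic in
-- the sum and the maximum leaves finitely many quartic inequalities, one for each pattern of
-- regions. The weights of H₁ (1 on [s], 0 elsewhere) attain equality when s = xn. This forces zero
-- slack on 0/1 quadruples, so r must vanish on 0/1 triples, and the slack of an edge can at best be
-- a multiple of 1 - max. Vertices of weight near 1 must therefore be counted separately. A cutoff
-- at distance about √ε from weight 1 balances the two counts and leaves O(√ε) n⁴ missing edges,
-- which for small ε is below 100 ε^{1/4} n⁴.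

open import Data.Bool using (Bool; true; false; _∧_; _∨_; not; if_then_else_; T)
open import Data.Empty using (⊥; ⊥-elim)
open import Data.Fin using (Fin; zero; suc; toℕ)
open import Data.Nat using (ℕ; zero; suc; z≤n)
open import Data.Product using (∃; _×_; _,_; proj₁; proj₂)
open import Data.Sum using (_⊎_; inj₁; inj₂)
open import Relation.Nullary using (¬_; Dec; yes; no)
open import Relation.Binary.PropositionalEquality hiding ([_])

-- Integer polynomials and a coefficientwise test for nonnegativity

module Polynomials where
  open import Data.Integer hiding (suc; _⊖_)
  open import Data.Integer.Properties
  open import Data.Integer.Tactic.RingSolver using (solve-∀)
  open import Data.Nat using (s≤s)
  open import Data.Vec using (Vec; []; _∷_; lookup; map)
  open import Data.Vec.Relation.Unary.All using (All; []; _∷_)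
  open import Data.Vec.Properties using (lookup-map)

  -- Dense polynomials: a polynomial in n + 1 variables is the list of its coefficients in the first one.
  data Poly : ℕ → Set where
    const : ℤ → Poly zero
    []    : ∀ {n} → Poly (suc n)
    _∷_   : ∀ {n} → Poly n → Poly (suc n) → Poly (suc n)

  eval : ∀ {n} → Poly n → Vec ℤ n → ℤ
  eval (const c) ρ       = c
  eval []        ρ       = 0ℤ
  eval (p ∷ ps)  (x ∷ ρ) = eval p ρ + x * eval ps (x ∷ ρ)

  constant : ∀ {n} → ℤ → Poly n
  constant {zero}  c = const c
  constant {suc n} c = constant c ∷ []

  variable′ : ∀ {n} → Fin n → Poly n
  variable′ zero    = constant 0ℤ ∷ constant 1ℤ ∷ []
  variable′ (suc i) = variable′ i ∷ []

  infixl 6 _⊞_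
  infixl 7 _⊠_

  _⊞_ : ∀ {n} → Poly n → Poly n → Poly n
  const a  ⊞ const b  = const (a + b)
  []       ⊞ q        = q
  (p ∷ ps) ⊞ []       = p ∷ ps
  (p ∷ ps) ⊞ (q ∷ qs) = (p ⊞ q) ∷ (ps ⊞ qs)

  mutual
    _⊠_ : ∀ {n} → Poly n → Poly n → Poly n
    const a  ⊠ const b = const (a * b)
    []       ⊠ q       = []
    (p ∷ ps) ⊠ q       = scale p q ⊞ (constant 0ℤ ∷ ps ⊠ q)

    scale : ∀ {n} → Poly n → Poly (suc n) → Poly (suc n)
    scale p []       = []
    scale p (q ∷ qs) = p ⊠ q ∷ scale p qs

  isNonNeg : ∀ {n} → Poly n → Bool
  isNonNeg (const (+ _))    = true
  isNonNeg (const -[1+ _ ]) = false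
  isNonNeg []               = true
  isNonNeg (p ∷ ps)         = isNonNeg p ∧ isNonNeg ps

  eval-constant : ∀ {n} c (ρ : Vec ℤ n) → eval (constant c) ρ ≡ c
  eval-constant c []      = refl
  eval-constant c (x ∷ ρ) = trans (cong₂ _+_ (eval-constant c ρ) (*-zeroʳ x)) (+-identityʳ c)

  eval-variable : ∀ {n} (i : Fin n) ρ → eval (variable′ i) ρ ≡ lookup ρ i
  eval-variable zero (x ∷ ρ) rewrite eval-constant 0ℤ ρ | eval-constant 1ℤ ρ = lemma x
    where
    lemma : ∀ x → 0ℤ + x * (1ℤ + x * 0ℤ) ≡ x
    lemma = solve-∀
  eval-variable (suc i) (x ∷ ρ) rewrite eval-variable i ρ = lemma x (lookup ρ i)
    where
    lemma : ∀ x y → y + x * 0ℤ ≡ y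
    lemma = solve-∀

  eval-⊞ : ∀ {n} (p q : Poly n) ρ → eval (p ⊞ q) ρ ≡ eval p ρ + eval q ρ
  eval-⊞ (const a) (const b) ρ       = refl
  eval-⊞ []        q         ρ       = sym (+-identityˡ _)
  eval-⊞ (p ∷ ps)  []        ρ       = sym (+-identityʳ _)
  eval-⊞ (p ∷ ps)  (q ∷ qs)  (x ∷ ρ)
    rewrite eval-⊞ p q ρ | eval-⊞ ps qs (x ∷ ρ) = lemma x (eval p ρ) (eval q ρ) _ _
    where
    lemma : ∀ x a b c d → (a + b) + x * (c + d) ≡ (a + x * c) + (b + x * d)
    lemma = solve-∀

  mutual
    eval-⊠ : ∀ {n} (p q : Poly n) ρ → eval (p ⊠ q) ρ ≡ eval p ρ * eval q ρ
    eval-⊠ (const a) (const b) ρ       = refl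
    eval-⊠ []        q         ρ       = sym (*-zeroˡ (eval q ρ))
    eval-⊠ (p ∷ ps)  q         (x ∷ ρ)
      rewrite eval-⊞ (scale p q) (constant 0ℤ ∷ ps ⊠ q) (x ∷ ρ)
            | eval-scale p q x ρ | eval-constant 0ℤ ρ | eval-⊠ ps q (x ∷ ρ)
      = lemma x (eval p ρ) (eval q (x ∷ ρ)) (eval ps (x ∷ ρ))
      where
      lemma : ∀ x a b c → a * b + (0ℤ + x * (c * b)) ≡ (a + x * c) * b
      lemma = solve-∀

    eval-scale : ∀ {n} (p : Poly n) q x ρ → eval (scale p q) (x ∷ ρ) ≡ eval p ρ * eval q (x ∷ ρ)
    eval-scale p []       x ρ = sym (*-zeroʳ (eval p ρ))
    eval-scale p (q ∷ qs) x ρ rewrite eval-⊠ p q ρ | eval-scale p qs x ρ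
      = lemma x (eval p ρ) (eval q ρ) _
      where
      lemma : ∀ x a b c → a * b + x * (a * c) ≡ a * (b + x * c)
      lemma = solve-∀

  +-nonNeg : ∀ {a b} → 0ℤ ≤ a → 0ℤ ≤ b → 0ℤ ≤ a + b
  +-nonNeg = +-mono-≤

  *-nonNeg : ∀ {a b} → 0ℤ ≤ a → 0ℤ ≤ b → 0ℤ ≤ a * b
  *-nonNeg {+ m} {+ n} _ _ = subst (0ℤ ≤_) (pos-* m n) (+≤+ z≤n)

  *-pos : ∀ {a b} → 0ℤ < a → 0ℤ < b → 0ℤ < a * b
  *-pos {+[1+ m ]} {+[1+ n ]} _ _ = +<+ (s≤s z≤n)
  *-pos {+0}       {_}        (+<+ ())
  *-pos {+[1+ m ]} {+0}       _ (+<+ ())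

  0≤+ : ∀ {n} → 0ℤ ≤ + n
  0≤+ = +≤+ z≤n

  isNonNeg-sound : ∀ {n} (p : Poly n) {ρ} → isNonNeg p ≡ true → All (0ℤ ≤_) ρ → 0ℤ ≤ eval p ρ
  isNonNeg-sound (const (+ _)) _ _ = 0≤+
  isNonNeg-sound []            _ _ = 0≤+
  isNonNeg-sound (p ∷ ps) ok (0≤x ∷ 0≤ρ) with isNonNeg p in eq
  ... | true = +-nonNeg (isNonNeg-sound p eq 0≤ρ) (*-nonNeg 0≤x (isNonNeg-sound ps ok (0≤x ∷ 0≤ρ)))

  infixl 6 _⊕_ _⊖_
  infixl 7 _⊗_

  data Expr (n : ℕ) : Set where
    con         : ℤ → Expr n
    var         : Fin n → Expr n
    _⊕_ _⊖_ _⊗_ : Expr n → Expr n → Expr n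

  ⟦_⟧ : ∀ {n} → Expr n → Vec ℤ n → ℤ
  ⟦ con c ⟧ ρ = c
  ⟦ var i ⟧ ρ = lookup ρ i
  ⟦ f ⊕ g ⟧ ρ = ⟦ f ⟧ ρ + ⟦ g ⟧ ρ
  ⟦ f ⊖ g ⟧ ρ = ⟦ f ⟧ ρ - ⟦ g ⟧ ρ
  ⟦ f ⊗ g ⟧ ρ = ⟦ f ⟧ ρ * ⟦ g ⟧ ρ

  expand : ∀ {n} → Expr n → Poly n
  expand (con c) = constant c
  expand (var i) = variable′ i
  expand (f ⊕ g) = expand f ⊞ expand g
  expand (f ⊖ g) = expand f ⊞ constant -1ℤ ⊠ expand g
  expand (f ⊗ g) = expand f ⊠ expand g

  eval-expand : ∀ {n} (f : Expr n) ρ → eval (expand f) ρ ≡ ⟦ f ⟧ ρ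
  eval-expand (con c) ρ = eval-constant c ρ
  eval-expand (var i) ρ = eval-variable i ρ
  eval-expand (f ⊕ g) ρ = trans (eval-⊞ (expand f) _ ρ) (cong₂ _+_ (eval-expand f ρ) (eval-expand g ρ))
  eval-expand (f ⊖ g) ρ
    rewrite eval-⊞ (expand f) (constant -1ℤ ⊠ expand g) ρ | eval-⊠ (constant -1ℤ) (expand g) ρ
          | eval-constant -1ℤ ρ | eval-expand f ρ | eval-expand g ρ = cong (λ z → ⟦ f ⟧ ρ + z) (-1*i≡-i (⟦ g ⟧ ρ))
  eval-expand (f ⊗ g) ρ = trans (eval-⊠ (expand f) _ ρ) (cong₂ _*_ (eval-expand f ρ) (eval-expand g ρ))

  -- The premise about `expand f` does not mention the point `ρ`. For a closed `f` it is proved by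
  -- `refl`, with the type checker expanding the polynomial; every certificate below is verified in
  -- this way.
  expand-nonNeg : ∀ {n} (f : Expr n) {ρ} → isNonNeg (expand f) ≡ true → All (0ℤ ≤_) ρ → 0ℤ ≤ ⟦ f ⟧ ρ
  expand-nonNeg f {ρ} ok 0≤ρ = subst (0ℤ ≤_) (eval-expand f ρ) (isNonNeg-sound (expand f) ok 0≤ρ)

  infix 8 _[_]

  _[_] : ∀ {m n} → Expr m → Vec (Expr n) m → Expr n
  con c   [ σ ] = con c
  var i   [ σ ] = lookup σ i
  (f ⊕ g) [ σ ] = f [ σ ] ⊕ g [ σ ]
  (f ⊖ g) [ σ ] = f [ σ ] ⊖ g [ σ ]
  (f ⊗ g) [ σ ] = f [ σ ] ⊗ g [ σ ]

  ⟦[]⟧ : ∀ {m n} (f : Expr m) (σ : Vec (Expr n) m) ρ → ⟦ f [ σ ] ⟧ ρ ≡ ⟦ f ⟧ (map (λ g → ⟦ g ⟧ ρ) σ)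
  ⟦[]⟧ (con c) σ ρ = refl
  ⟦[]⟧ (var i) σ ρ = sym (lookup-map i (λ g → ⟦ g ⟧ ρ) σ)
  ⟦[]⟧ (f ⊕ g) σ ρ = cong₂ _+_ (⟦[]⟧ f σ ρ) (⟦[]⟧ g σ ρ)
  ⟦[]⟧ (f ⊖ g) σ ρ = cong₂ _-_ (⟦[]⟧ f σ ρ) (⟦[]⟧ g σ ρ)
  ⟦[]⟧ (f ⊗ g) σ ρ = cong₂ _*_ (⟦[]⟧ f σ ρ) (⟦[]⟧ g σ ρ)

  -- Sealed, so that type checking never compares unfolded integer arithmetic.
  opaque
    value : ∀ {n} → Expr n → Vec ℤ n → ℤ
    value f ρ = ⟦ f ⟧ ρ

    value-⟦⟧ : ∀ {n} (f : Expr n) ρ → value f ρ ≡ ⟦ f ⟧ ρ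
    value-⟦⟧ f ρ = refl

    value-nonNeg : ∀ {n} (f : Expr n) ρ → 0ℤ ≤ ⟦ f ⟧ ρ → 0ℤ ≤ value f ρ
    value-nonNeg f ρ p = p

  value-[] : ∀ {m n} (f : Expr m) (σ : Vec (Expr n) m) ρ {ρ′} → map (λ g → ⟦ g ⟧ ρ) σ ≡ ρ′ →
             value (f [ σ ]) ρ ≡ value f ρ′
  value-[] f σ ρ refl = trans (value-⟦⟧ (f [ σ ]) ρ) (trans (⟦[]⟧ f σ ρ) (sym (value-⟦⟧ f (map (λ g → ⟦ g ⟧ ρ) σ))))

  -- Symmetry under a substitution is decided by comparing expansions, again by `refl`. This gives
  -- the permutation invariance of the slack without a hand-made ring proof.
  value-invariant : ∀ {n} (f : Expr n) σ ρ {ρ′} → expand f ≡ expand (f [ σ ]) → map (λ g → ⟦ g ⟧ ρ) σ ≡ ρ′ →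
                    value f ρ ≡ value f ρ′
  value-invariant f σ ρ eq eq′ = trans (value-⟦⟧ f ρ) (trans (sym (eval-expand f ρ))
    (trans (cong (λ p → eval p ρ) eq) (trans (eval-expand (f [ σ ]) ρ)
      (trans (sym (value-⟦⟧ (f [ σ ]) ρ)) (value-[] f σ ρ eq′)))))

-- The prices and the certificates of the slack inequality

module PriceCertificate where
  open import Data.Fin.Patterns using (0F; 1F; 2F; 3F; 4F; 5F; 6F; 7F; 8F; 9F)
  open import Data.Integer hiding (suc; _⊖_; _⊔_; _≤ᵇ_)
  open import Data.Integer.Properties using (≤-trans; 0≤i-j⇒j≤i; i≤j⇒0≤j-i; pos-*)
  open import Data.List using (List; []; _∷_; _++_)
  open import Data.List.Relation.Unary.All using (All; []; _∷_)
  open import Data.Nat as ℕ using (ℕ; zero; suc; z≤n; _⊔_; _≤ᵇ_)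
  open import Data.Nat.Properties using (≤ᵇ⇒≤; ≤⇒≤ᵇ)
  import Data.Nat.Properties as ℕ
  open import Data.Vec using (Vec; []; _∷_)
  import Data.Vec.Relation.Unary.All as Vecᴬ
  open Polynomials

  data Level : Set where
    low mid top : Level

  -- Four times r, homogenised by h, in the sum s and the maximum m of three weights;
  -- the levels are 5 s < 4 h, then s < h, then h ≤ s.
  priceᶠ : Level → Expr 3
  priceᶠ low = var 1F ⊗ (con (+ 26) ⊗ var 0F ⊕ con (+ 46) ⊗ (var 1F ⊖ var 2F))
  priceᶠ mid = (var 0F ⊖ var 2F) ⊗ (con (+ 19) ⊗ var 0F ⊖ con (+ 18) ⊗ var 2F)
               ⊕ con (+ 80) ⊗ ((var 0F ⊖ var 1F) ⊗ (var 1F ⊖ var 2F))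
  priceᶠ top = (var 0F ⊖ var 2F) ⊗ (con (+ 19) ⊗ var 0F ⊖ con (+ 18) ⊗ var 2F)

  -- For h = 1: the slack times 16 · 249 less ε (1 - m), where rᵃ is the price at (b , c , d), and so on.
  gapᶜ : (α β γ δ ε : ℤ) → Expr 10
  gapᶜ α β γ δ ε =
    con α ⊗ (con δ ⊗ (h ⊗ h ⊗ h ⊗ h) ⊖ (h ⊖ a) ⊗ (h ⊖ b) ⊗ (h ⊖ c) ⊗ (h ⊖ d))
    ⊕ ((con β ⊗ a ⊖ con γ ⊗ h) ⊗ (h ⊗ rᵃ) ⊕ (con β ⊗ b ⊖ con γ ⊗ h) ⊗ (h ⊗ rᵇ)
       ⊕ (con β ⊗ c ⊖ con γ ⊗ h) ⊗ (h ⊗ rᶜ) ⊕ (con β ⊗ d ⊖ con γ ⊗ h) ⊗ (h ⊗ rᵈ))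
    ⊖ con ε ⊗ ((h ⊖ m) ⊗ (h ⊗ h ⊗ h))
    where
    h m a b c d rᵃ rᵇ rᶜ rᵈ : Expr 10
    h  = var 0F
    m  = var 1F
    a  = var 2F
    b  = var 3F
    c  = var 4F
    d  = var 5F
    rᵃ = var 6F
    rᵇ = var 7F
    rᶜ = var 8F
    rᵈ = var 9F

  -- 3984 = 16 · 249 clears the denominator of x = 50/249, the quarter in front of the price terms
  -- and the quarter in r = `priceᶠ` / 4. On an edge, 48 (1 - m) is kept in reserve; 48/3984 = 1/83
  -- is the constant in front of 1 - max.
  gapᶠ : Bool → Expr 10
  gapᶠ edge = gapᶜ (+ 3984) (+ 249) (+ 50) (if edge then 0ℤ else 1ℤ) (if edge then + 48 else 0ℤ)

  Form : Set
  Form = Expr 5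

  -- Sorted weights a ≤ b ≤ c ≤ d ≤ h, parametrised by their increments.
  a b c d h : Form
  a = var 0F
  b = a ⊕ var 1F
  c = b ⊕ var 2F
  d = c ⊕ var 3F
  h = d ⊕ var 4F

  -- Strict inequalities between regions are relaxed to weak ones: each polynomial is certified on
  -- the closure of its region.
  levelᶠ : Level → Form → List Form
  levelᶠ low s = con (+ 4) ⊗ h ⊖ con (+ 5) ⊗ s ∷ []
  levelᶠ mid s = con (+ 5) ⊗ s ⊖ con (+ 4) ⊗ h ∷ h ⊖ s ∷ []
  levelᶠ top s = s ⊖ h ∷ []

  edgeᶠ : Bool → Form
  edgeᶠ true  = a ⊕ b ⊕ c ⊕ d ⊖ h
  edgeᶠ false = h ⊖ (a ⊕ b ⊕ c ⊕ d)

  -- The order matters, since a `Term` names these forms by position. The increments are 0 to 4;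
  -- after them the positions shift with the levels, because `mid` contributes two forms. There are
  -- at most fourteen, so one hexadecimal digit suffices.
  generators : (l₀ l₁ l₂ l₃ : Level) → Bool → List Form
  generators l₀ l₁ l₂ l₃ edge =
    (var 0F ∷ var 1F ∷ var 2F ∷ var 3F ∷ var 4F ∷ [])
    ++ levelᶠ l₀ (a ⊕ b ⊕ c) ++ levelᶠ l₁ (a ⊕ b ⊕ d) ++ levelᶠ l₂ (a ⊕ c ⊕ d) ++ levelᶠ l₃ (b ⊕ c ⊕ d)
    ++ edgeᶠ edge ∷ []

  -- For sorted weights the maximum of a triple is d, or c when d is left out, so the maxima inside
  -- the prices need no further case distinction.
  target : (l₀ l₁ l₂ l₃ : Level) → Bool → Form
  target l₀ l₁ l₂ l₃ edge = gapᶠ edge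
    [ h ∷ d ∷ a ∷ b ∷ c ∷ d
    ∷ priceᶠ l₃ [ h ∷ b ⊕ c ⊕ d ∷ d ∷ [] ] ∷ priceᶠ l₂ [ h ∷ a ⊕ c ⊕ d ∷ d ∷ [] ]
    ∷ priceᶠ l₁ [ h ∷ a ⊕ b ⊕ d ∷ d ∷ [] ] ∷ priceᶠ l₀ [ h ∷ a ⊕ b ⊕ c ∷ c ∷ [] ] ∷ [] ]

  -- (k , c) stands for k times the product of four generators, whose indices are the hexadecimal digits of c.
  Term : Set
  Term = ℕ × ℕ

  -- Found by linear programming: what remains of the slack has nonnegative coefficients in the increments.
  certificate : (l₀ l₁ l₂ l₃ : Level) → Bool → List Term
  certificate top top top top true  =
    (9621 , 0x4445) ∷ (8029 , 0x3445) ∷ (2962 , 0x2445) ∷ (219 , 0x1449) ∷ (1785 , 0x4499) ∷ (632 , 0x3499) ∷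
    (79 , 0x2499) ∷ (83 , 0x0499) ∷ []
  certificate mid top top top true  =
    (695 , 0x4445) ∷ (489 , 0x0445) ∷ (3124 , 0x2446) ∷ (4909 , 0x4447) ∷ (68 , 0x4455) ∷ (1233 , 0x3356) ∷
    (3147 , 0x2456) ∷ (4876 , 0x2356) ∷ (179 , 0x2256) ∷ (2467 , 0x1456) ∷ (5656 , 0x1356) ∷ (2155 , 0x1256) ∷
    (2657 , 0x1156) ∷ (3204 , 0x0456) ∷ (6429 , 0x0356) ∷ (5263 , 0x0156) ∷ (2896 , 0x0056) ∷ (6298 , 0x3466) ∷
    (924 , 0x2367) ∷ (4808 , 0x2267) ∷ (1251 , 0x446a) ∷ (23943 , 0x346a) ∷ (13959 , 0x336a) ∷ (1808 , 0x246a) ∷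
    (3668 , 0x146a) ∷ (4185 , 0x136a) ∷ (8194 , 0x126a) ∷ (1489 , 0x036a) ∷ (20265 , 0x026a) ∷ (1444 , 0x016a) ∷ []
  certificate mid mid top top true  =
    (479 , 0x4445) ∷ (26 , 0x1125) ∷ (25096 , 0x1248) ∷ (12776 , 0x1228) ∷ (22399 , 0x0248) ∷ (20809 , 0x0228) ∷
    (326 , 0x4449) ∷ (1405 , 0x4458) ∷ (2377 , 0x3458) ∷ (2259 , 0x3358) ∷ (2482 , 0x2458) ∷ (4284 , 0x2358) ∷
    (220 , 0x2258) ∷ (2875 , 0x1458) ∷ (8300 , 0x1358) ∷ (5690 , 0x1258) ∷ (5515 , 0x1158) ∷ (8731 , 0x0358) ∷
    (11123 , 0x0158) ∷ (6132 , 0x0058) ∷ (37666 , 0x0489) ∷ (14715 , 0x148b) ∷ (12110 , 0x128b) ∷ (40465 , 0x028b) ∷ []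
  certificate mid mid mid top true  =
    (4068 , 0x2445) ∷ (2035 , 0x2345) ∷ (977 , 0x2335) ∷ (2274 , 0x2245) ∷ (3229 , 0x2235) ∷ (543 , 0x0445) ∷
    (1600 , 0x144a) ∷ (24 , 0x444b) ∷ (45 , 0x4455) ∷ (15 , 0x1155) ∷ (155 , 0x0455) ∷ (5211 , 0x345a) ∷
    (2896 , 0x335a) ∷ (2791 , 0x245a) ∷ (4343 , 0x235a) ∷ (936 , 0x225a) ∷ (5292 , 0x145a) ∷ (11287 , 0x135a) ∷
    (10142 , 0x125a) ∷ (8150 , 0x115a) ∷ (10984 , 0x045a) ∷ (12106 , 0x035a) ∷ (11168 , 0x025a) ∷ (16865 , 0x015a) ∷
    (9267 , 0x005a) ∷ (8619 , 0x44ab) ∷ (18303 , 0x14ac) ∷ (1898 , 0x13ac) ∷ []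
  certificate mid mid mid mid true  =
    (4850 , 0x2445) ∷ (1077 , 0x2345) ∷ (598 , 0x2335) ∷ (3095 , 0x2245) ∷ (1018 , 0x2235) ∷ (9986 , 0x1445) ∷
    (3117 , 0x1345) ∷ (1280 , 0x0455) ∷ (393 , 0x0355) ∷ (2001 , 0x445c) ∷ (3464 , 0x345c) ∷ (2316 , 0x335c) ∷
    (1273 , 0x245c) ∷ (4196 , 0x235c) ∷ (810 , 0x225c) ∷ (1460 , 0x145c) ∷ (5410 , 0x135c) ∷ (5821 , 0x125c) ∷
    (3114 , 0x115c) ∷ (19887 , 0x045c) ∷ (17208 , 0x035c) ∷ (14861 , 0x025c) ∷ (16368 , 0x015c) ∷ (11580 , 0x005c) ∷ []
  certificate low top top top true  =
    (10521 , 0x4446) ∷ (6839 , 0x3446) ∷ (111 , 0x1455) ∷ (134 , 0x0455) ∷ (2312 , 0x4456) ∷ (2613 , 0x3456) ∷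
    (1208 , 0x3356) ∷ (402 , 0x1356) ∷ (4688 , 0x0356) ∷ (128 , 0x2359) ∷ (2360 , 0x1359) ∷ (127 , 0x0059) ∷
    (12814 , 0x4469) ∷ (35 , 0x4499) ∷ (8555 , 0x3499) ∷ (1417 , 0x0499) ∷ []
  certificate low mid top top true  =
    (2986 , 0x4446) ∷ (1493 , 0x2226) ∷ (1115 , 0x2456) ∷ (680 , 0x1356) ∷ (1740 , 0x1256) ∷ (958 , 0x0356) ∷
    (2887 , 0x0256) ∷ (4668 , 0x4458) ∷ (2335 , 0x3458) ∷ (988 , 0x3358) ∷ (1743 , 0x2458) ∷ (1601 , 0x2358) ∷
    (3659 , 0x2258) ∷ (2199 , 0x235a) ∷ (1090 , 0x4466) ∷ (852 , 0x3466) ∷ (274 , 0x2466) ∷ (89 , 0x2266) ∷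
    (145 , 0x1466) ∷ (400 , 0x0466) ∷ (260 , 0x0366) ∷ (1557 , 0x446a) ∷ (914 , 0x346a) ∷ (1154 , 0x336a) ∷ []
  certificate low mid mid top true  =
    (2545 , 0x4446) ∷ (4108 , 0x224a) ∷ (1332 , 0x2256) ∷ (415 , 0x1456) ∷ (17 , 0x1356) ∷ (2798 , 0x1256) ∷
    (2078 , 0x1156) ∷ (36 , 0x0456) ∷ (401 , 0x0256) ∷ (1177 , 0x0156) ∷ (471 , 0x0056) ∷ (6296 , 0x445a) ∷
    (4421 , 0x345a) ∷ (11187 , 0x245a) ∷ (1963 , 0x235a) ∷ (3488 , 0x225a) ∷ (6342 , 0x145a) ∷ (1157 , 0x135a) ∷
    (2814 , 0x125a) ∷ (364 , 0x335b) ∷ (367 , 0x4466) ∷ (852 , 0x3466) ∷ (137 , 0x2466) ∷ (86 , 0x2266) ∷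
    (869 , 0x1466) ∷ (773 , 0x446a) ∷ (4862 , 0x446b) ∷ (4310 , 0x346b) ∷ (3647 , 0x336b) ∷ (6260 , 0x246b) ∷
    (2906 , 0x236b) ∷ (2740 , 0x226b) ∷ []
  certificate low mid mid mid true  =
    (1840 , 0x4446) ∷ (1616 , 0x2226) ∷ (135 , 0x1446) ∷ (1842 , 0x1226) ∷ (6960 , 0x444c) ∷ (16857 , 0x224c) ∷
    (127 , 0x4456) ∷ (1179 , 0x2256) ∷ (687 , 0x1456) ∷ (2228 , 0x1256) ∷ (1498 , 0x1156) ∷ (1200 , 0x0456) ∷
    (289 , 0x0356) ∷ (1186 , 0x0256) ∷ (1712 , 0x0156) ∷ (1213 , 0x0056) ∷ (9703 , 0x445c) ∷ (4707 , 0x345c) ∷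
    (139 , 0x335c) ∷ (12635 , 0x245c) ∷ (2230 , 0x235c) ∷ (4167 , 0x225c) ∷ (6234 , 0x145c) ∷ (1116 , 0x135c) ∷
    (5037 , 0x125c) ∷ (1057 , 0x115c) ∷ (499 , 0x3466) ∷ (778 , 0x2466) ∷ (364 , 0x2366) ∷ (663 , 0x1466) ∷
    (793 , 0x1366) ∷ (262 , 0x1166) ∷ (493 , 0x0466) ∷ (65 , 0x0366) ∷ (5405 , 0x446c) ∷ (9184 , 0x346c) ∷
    (4187 , 0x336c) ∷ (9564 , 0x246c) ∷ (5040 , 0x236c) ∷ (4895 , 0x226c) ∷ (5466 , 0x146c) ∷ (3403 , 0x126c) ∷
    (26605 , 0x44cc) ∷ (3139 , 0x24cc) ∷ []
  certificate low low top top true  =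
    (1825 , 0x3346) ∷ (1672 , 0x3336) ∷ (2633 , 0x2336) ∷ (5725 , 0x2236) ∷ (13116 , 0x4447) ∷ (24296 , 0x3447) ∷
    (31181 , 0x3347) ∷ (10021 , 0x3337) ∷ (24836 , 0x2447) ∷ (19819 , 0x2347) ∷ (51 , 0x2247) ∷ (37552 , 0x2339) ∷
    (36506 , 0x2239) ∷ (6263 , 0x2229) ∷ (361 , 0x3366) ∷ (442 , 0x1466) ∷ (901 , 0x0466) ∷ (2422 , 0x2367) ∷
    (2541 , 0x2267) ∷ (669 , 0x1367) ∷ (918 , 0x1169) ∷ (7172 , 0x4499) ∷ (6988 , 0x3499) ∷ (11441 , 0x2499) ∷ []
  certificate low low mid top true  =
    (4305 , 0x3446) ∷ (5483 , 0x3346) ∷ (1451 , 0x3336) ∷ (15830 , 0x4449) ∷ (6884 , 0x1349) ∷ (1015 , 0x1339) ∷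
    (14082 , 0x444a) ∷ (85973 , 0x344a) ∷ (39734 , 0x334a) ∷ (3702 , 0x333a) ∷ (114 , 0x3366) ∷ (419 , 0x2366) ∷
    (323 , 0x1466) ∷ (823 , 0x1366) ∷ (735 , 0x0466) ∷ (495 , 0x0366) ∷ (972 , 0x4467) ∷ (457 , 0x3467) ∷
    (66 , 0x3367) ∷ (1469 , 0x2368) ∷ (1401 , 0x446a) ∷ (82 , 0x2277) ∷ (336 , 0x1277) ∷ (1161 , 0x0377) ∷
    (11259 , 0x4479) ∷ (15186 , 0x3479) ∷ (3909 , 0x3379) ∷ (3995 , 0x2479) ∷ (1674 , 0x2379) ∷ (3440 , 0x247a) ∷
    (3808 , 0x237a) ∷ (1885 , 0x227a) ∷ (3438 , 0x147a) ∷ (4576 , 0x137a) ∷ (1053 , 0x127a) ∷ []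
  certificate low low mid mid true  =
    (5370 , 0x3446) ∷ (5514 , 0x3346) ∷ (1121 , 0x3336) ∷ (558 , 0x1346) ∷ (2199 , 0x0446) ∷ (1641 , 0x1147) ∷
    (3536 , 0x1137) ∷ (27147 , 0x444b) ∷ (72005 , 0x344b) ∷ (40754 , 0x334b) ∷ (4363 , 0x333b) ∷ (19594 , 0x144b) ∷
    (54483 , 0x134b) ∷ (10113 , 0x133b) ∷ (9 , 0x3366) ∷ (384 , 0x2366) ∷ (223 , 0x2266) ∷ (68 , 0x1266) ∷
    (946 , 0x0466) ∷ (597 , 0x0366) ∷ (633 , 0x4467) ∷ (257 , 0x3467) ∷ (291 , 0x3367) ∷ (176 , 0x1367) ∷
    (69 , 0x1167) ∷ (468 , 0x236a) ∷ (433 , 0x136a) ∷ (18 , 0x046a) ∷ (5450 , 0x446b) ∷ (7669 , 0x346b) ∷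
    (80 , 0x2277) ∷ (122 , 0x0377) ∷ (507 , 0x0277) ∷ (172 , 0x0177) ∷ (111 , 0x0077) ∷ (13261 , 0x447b) ∷
    (17665 , 0x347b) ∷ (4738 , 0x337b) ∷ (9442 , 0x247b) ∷ (6810 , 0x237b) ∷ (2516 , 0x227b) ∷ (5915 , 0x147b) ∷
    (8273 , 0x137b) ∷ (3331 , 0x127b) ∷ (1623 , 0x037b) ∷ []
  certificate low low low top true  =
    (13674 , 0x3447) ∷ (14952 , 0x3347) ∷ (3318 , 0x3337) ∷ (18698 , 0x2447) ∷ (14284 , 0x2347) ∷ (3202 , 0x2337) ∷
    (17658 , 0x0447) ∷ (21210 , 0x4448) ∷ (7769 , 0x3338) ∷ (2040 , 0x1338) ∷ (51191 , 0x4449) ∷ (96407 , 0x3449) ∷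
    (59081 , 0x3349) ∷ (36663 , 0x1349) ∷ (12059 , 0x1339) ∷ (1881 , 0x4477) ∷ (2502 , 0x3477) ∷ (628 , 0x3377) ∷
    (138 , 0x2477) ∷ (223 , 0x2377) ∷ (85 , 0x2277) ∷ (4497 , 0x1477) ∷ (2439 , 0x1377) ∷ (1933 , 0x1277) ∷
    (2096 , 0x1177) ∷ (2418 , 0x0477) ∷ (2627 , 0x0377) ∷ (4147 , 0x0177) ∷ (997 , 0x0077) ∷ (37226 , 0x4488) ∷
    (8485 , 0x1488) ∷ []
  certificate low low low mid true  =
    (2280 , 0x4447) ∷ (12793 , 0x3447) ∷ (11418 , 0x3347) ∷ (2710 , 0x3337) ∷ (9880 , 0x2447) ∷ (5963 , 0x2347) ∷
    (2218 , 0x2337) ∷ (2711 , 0x2247) ∷ (967 , 0x2227) ∷ (40135 , 0x444a) ∷ (98640 , 0x344a) ∷ (60666 , 0x334a) ∷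
    (7352 , 0x333a) ∷ (41328 , 0x244a) ∷ (135 , 0x3377) ∷ (1036 , 0x1477) ∷ (983 , 0x1377) ∷ (1567 , 0x0477) ∷
    (1286 , 0x0377) ∷ (682 , 0x4478) ∷ (1028 , 0x3478) ∷ (152 , 0x3378) ∷ (955 , 0x2488) ∷ (381 , 0x2388) ∷
    (356 , 0x2288) ∷ (835 , 0x1488) ∷ (733 , 0x1388) ∷ (1110 , 0x1288) ∷ (842 , 0x1188) ∷ (882 , 0x0488) ∷
    (826 , 0x0388) ∷ (778 , 0x0288) ∷ (1797 , 0x0188) ∷ (1219 , 0x0088) ∷ (9205 , 0x448a) ∷ (13294 , 0x348a) ∷
    (3184 , 0x338a) ∷ (2497 , 0x148a) ∷ (2238 , 0x138a) ∷ []
  certificate low low low low true  =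
    (3097 , 0x4448) ∷ (22511 , 0x3448) ∷ (21383 , 0x3348) ∷ (4665 , 0x3338) ∷ (27460 , 0x2448) ∷ (23802 , 0x2348) ∷
    (6253 , 0x2338) ∷ (6752 , 0x2248) ∷ (1808 , 0x2238) ∷ (689 , 0x2228) ∷ (24462 , 0x1448) ∷ (21808 , 0x1348) ∷
    (5691 , 0x1338) ∷ (54286 , 0x4449) ∷ (127059 , 0x3449) ∷ (78730 , 0x3349) ∷ (10312 , 0x3339) ∷ (57850 , 0x2449) ∷
    (2361 , 0x4488) ∷ (2682 , 0x3488) ∷ (683 , 0x3388) ∷ (603 , 0x2488) ∷ (462 , 0x1488) ∷ (855 , 0x1388) ∷
    (535 , 0x1288) ∷ (3948 , 0x0488) ∷ (3021 , 0x0388) ∷ (1574 , 0x0288) ∷ (2559 , 0x0188) ∷ (2328 , 0x0088) ∷ []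
  certificate mid mid mid mid false =
    (960 , 0x4445) ∷ (863 , 0x345d) ∷ (1152 , 0x335d) ∷ (1023 , 0x245d) ∷ (3662 , 0x235d) ∷ (1225 , 0x225d) ∷
    (1864 , 0x145d) ∷ (6581 , 0x135d) ∷ (6605 , 0x125d) ∷ (3931 , 0x115d) ∷ (8711 , 0x045d) ∷ (9505 , 0x035d) ∷
    (10762 , 0x025d) ∷ (12979 , 0x015d) ∷ (7599 , 0x005d) ∷ []
  certificate low mid mid mid false =
    (723 , 0x4446) ∷ (164 , 0x3456) ∷ (201 , 0x2456) ∷ (463 , 0x1456) ∷ (726 , 0x0456) ∷ (21 , 0x0356) ∷
    (1247 , 0x0256) ∷ (1662 , 0x0156) ∷ (964 , 0x0056) ∷ []
  certificate low low mid mid false =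
    (1182 , 0x4447) ∷ (65 , 0x3467) ∷ (330 , 0x2467) ∷ (38 , 0x2267) ∷ (198 , 0x1467) ∷ (174 , 0x4477) ∷ []
  certificate low low low mid false =
    (973 , 0x4448) ∷ (8 , 0x3478) ∷ (22 , 0x2478) ∷ (36 , 0x1478) ∷ (181 , 0x4488) ∷ []
  certificate low low low low false =
    (3 , 0x2248) ∷ (12 , 0x2228) ∷ (5 , 0x0488) ∷ []
  certificate _ _ _ _ _ = []

  infix 4 _⊑_

  -- The sums of the four triples of sorted weights increase, hence so do their levels. This leaves
  -- 15 patterns for edges. For light quadruples no triple reaches h, so `top` is excluded and 5
  -- patterns remain. The default clause of `certificate` stands for all other patterns.
  data _⊑_ : Level → Level → Set where
    low⊑    : ∀ {l} → low ⊑ l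
    mid⊑mid : mid ⊑ mid
    mid⊑top : mid ⊑ top
    top⊑top : top ⊑ top

  -- The default 0 is itself a nonnegative form, so an index out of range could not make a
  -- certificate unsound.
  _!_ : List Form → ℕ → Form
  []       ! _     = con 0ℤ
  (g ∷ gs) ! zero  = g
  (g ∷ gs) ! suc i = gs ! i

  combination : List Form → List Term → Form
  combination gs []                        = con 0ℤ
  combination gs ((k , c) ∷ ts) =
    con (+ k) ⊗ ((gs ! (c ℕ./ 4096)) ⊗ (gs ! (c ℕ./ 256 ℕ.% 16)) ⊗ (gs ! (c ℕ./ 16 ℕ.% 16)) ⊗ (gs ! (c ℕ.% 16))) ⊕ combination gs ts

  module _ {ρ : Vec ℤ 5} where
    Holds : Form → Set
    Holds f = 0ℤ ≤ ⟦ f ⟧ ρ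

    !-holds : ∀ {gs} → All Holds gs → ∀ i → Holds (gs ! i)
    !-holds []       i       = +≤+ z≤n
    !-holds (p ∷ ps) zero    = p
    !-holds (p ∷ ps) (suc i) = !-holds ps i

    combination-holds : ∀ {gs} → All Holds gs → ∀ ts → Holds (combination gs ts)
    combination-holds ps []                        = +≤+ z≤n
    combination-holds ps ((k , c) ∷ ts) =
      +-nonNeg (*-nonNeg {+ k} (+≤+ z≤n)
                 (*-nonNeg (*-nonNeg (*-nonNeg (!-holds ps (c ℕ./ 4096)) (!-holds ps (c ℕ./ 256 ℕ.% 16)))
                     (!-holds ps (c ℕ./ 16 ℕ.% 16))) (!-holds ps (c ℕ.% 16))))
               (combination-holds ps ts)

    -- A Handelman-style argument: products of nonnegative forms with nonnegative coefficients are
    -- nonnegative, and what `f` has beyond them has nonnegative coefficients in the nonnegative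
    -- increments.
    certify : ∀ f {gs} ts → isNonNeg (expand (f ⊖ combination gs ts)) ≡ true →
              Vecᴬ.All (0ℤ ≤_) ρ → All Holds gs → Holds f
    certify f {gs} ts ok 0≤ρ ps =
      ≤-trans (combination-holds ps ts) (0≤i-j⇒j≤i (expand-nonNeg (f ⊖ combination gs ts) ok 0≤ρ))

    certified : ∀ l₀ l₁ l₂ l₃ e →
      isNonNeg (expand (target l₀ l₁ l₂ l₃ e ⊖ combination (generators l₀ l₁ l₂ l₃ e) (certificate l₀ l₁ l₂ l₃ e))) ≡ true →
      Vecᴬ.All (0ℤ ≤_) ρ → All Holds (generators l₀ l₁ l₂ l₃ e) → Holds (target l₀ l₁ l₂ l₃ e)
    certified l₀ l₁ l₂ l₃ e = certify (target l₀ l₁ l₂ l₃ e) (certificate l₀ l₁ l₂ l₃ e)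

    edge-holds : ∀ {l₀ l₁ l₂ l₃} → l₀ ⊑ l₁ → l₁ ⊑ l₂ → l₂ ⊑ l₃ → Vecᴬ.All (0ℤ ≤_) ρ →
      All Holds (generators l₀ l₁ l₂ l₃ true) → Holds (target l₀ l₁ l₂ l₃ true)
    edge-holds top⊑top top⊑top top⊑top = certified top top top top true refl
    edge-holds mid⊑top top⊑top top⊑top = certified mid top top top true refl
    edge-holds mid⊑mid mid⊑top top⊑top = certified mid mid top top true refl
    edge-holds mid⊑mid mid⊑mid mid⊑top = certified mid mid mid top true refl
    edge-holds mid⊑mid mid⊑mid mid⊑mid = certified mid mid mid mid true refl
    edge-holds (low⊑ {top}) top⊑top top⊑top = certified low top top top true refl
    edge-holds (low⊑ {mid}) mid⊑top top⊑top = certified low mid top top true refl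
    edge-holds (low⊑ {mid}) mid⊑mid mid⊑top = certified low mid mid top true refl
    edge-holds (low⊑ {mid}) mid⊑mid mid⊑mid = certified low mid mid mid true refl
    edge-holds (low⊑ {low}) (low⊑ {top}) top⊑top = certified low low top top true refl
    edge-holds (low⊑ {low}) (low⊑ {mid}) mid⊑top = certified low low mid top true refl
    edge-holds (low⊑ {low}) (low⊑ {mid}) mid⊑mid = certified low low mid mid true refl
    edge-holds (low⊑ {low}) (low⊑ {low}) (low⊑ {top}) = certified low low low top true refl
    edge-holds (low⊑ {low}) (low⊑ {low}) (low⊑ {mid}) = certified low low low mid true refl
    edge-holds (low⊑ {low}) (low⊑ {low}) (low⊑ {low}) = certified low low low low true refl
    nonedge-holds : ∀ {l₀ l₁ l₂ l₃} → l₀ ⊑ l₁ → l₁ ⊑ l₂ → l₂ ⊑ l₃ → l₃ ⊑ mid → Vecᴬ.All (0ℤ ≤_) ρ →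
      All Holds (generators l₀ l₁ l₂ l₃ false) → Holds (target l₀ l₁ l₂ l₃ false)
    nonedge-holds mid⊑mid mid⊑mid mid⊑mid _ = certified mid mid mid mid false refl
    nonedge-holds (low⊑ {mid}) mid⊑mid mid⊑mid _ = certified low mid mid mid false refl
    nonedge-holds (low⊑ {low}) (low⊑ {mid}) mid⊑mid _ = certified low low mid mid false refl
    nonedge-holds (low⊑ {low}) (low⊑ {low}) (low⊑ {mid}) _ = certified low low low mid false refl
    nonedge-holds (low⊑ {low}) (low⊑ {low}) (low⊑ {low}) _ = certified low low low low false refl


  level : ℕ → ℕ → Level
  level h s = if h ≤ᵇ s then top else if 4 ℕ.* h ≤ᵇ 5 ℕ.* s then mid else low

  rate′ : (h s m : ℕ) → ℤ
  rate′ h s m = value (priceᶠ (level h s)) (+ h ∷ + s ∷ + m ∷ [])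

  rate : (h a b c : ℕ) → ℤ
  rate h a b c = rate′ h (a ℕ.+ b ℕ.+ c) (a ⊔ b ⊔ c)

  core : Bool → (h m a b c d : ℕ) (rᵃ rᵇ rᶜ rᵈ : ℤ) → ℤ
  core e h m a b c d rᵃ rᵇ rᶜ rᵈ = value (gapᶠ e) (+ h ∷ + m ∷ + a ∷ + b ∷ + c ∷ + d ∷ rᵃ ∷ rᵇ ∷ rᶜ ∷ rᵈ ∷ [])

  gap : (h a b c d : ℕ) → ℤ
  gap h a b c d =
    core (h ≤ᵇ a ℕ.+ b ℕ.+ c ℕ.+ d) h (a ⊔ b ⊔ c ⊔ d) a b c d
      (rate h b c d) (rate h a c d) (rate h a b d) (rate h a b c)

  level-sound : ∀ {ρ} sᶠ s H → ⟦ sᶠ ⟧ ρ ≡ + s → ⟦ h ⟧ ρ ≡ + H → All (Holds {ρ}) (levelᶠ (level H s) sᶠ)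
  level-sound {ρ} sᶠ s H eqs eqh with H ≤ᵇ s in p
  ... | true  = subst₂ (λ s h → 0ℤ ≤ s - h) (sym eqs) (sym eqh) (i≤j⇒0≤j-i {+ H} {+ s} (+≤+ (≤ᵇ⇒≤ H s (subst T (sym p) _)))) ∷ []
  ... | false with 4 ℕ.* H ≤ᵇ 5 ℕ.* s in q
  ...   | true  = subst₂ (λ s h → 0ℤ ≤ + 5 * s - + 4 * h) (sym eqs) (sym eqh)
                    (i≤j⇒0≤j-i (subst₂ _≤_ (pos-* 4 H) (pos-* 5 s) (+≤+ (≤ᵇ⇒≤ (4 ℕ.* H) (5 ℕ.* s) (subst T (sym q) _)))))
                ∷ subst₂ (λ s h → 0ℤ ≤ h - s) (sym eqs) (sym eqh)
                    (i≤j⇒0≤j-i {+ s} {+ H} (+≤+ (ℕ.<⇒≤ (ℕ.≰⇒> λ H≤s → subst T p (≤⇒≤ᵇ H≤s)))))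
                ∷ []
  ...   | false = subst₂ (λ s h → 0ℤ ≤ + 4 * h - + 5 * s) (sym eqs) (sym eqh)
                    (i≤j⇒0≤j-i (subst₂ _≤_ (pos-* 5 s) (pos-* 4 H)
                      (+≤+ (ℕ.<⇒≤ (ℕ.≰⇒> λ le → subst T q (≤⇒≤ᵇ le)))))) ∷ []

  level-mono : ∀ H {s t} → s ℕ.≤ t → level H s ⊑ level H t
  level-mono H {s} {t} s≤t with H ≤ᵇ s in p | H ≤ᵇ t in p′
  ... | true  | true  = top⊑top
  ... | true  | false = ⊥-elim (subst T p′ (≤⇒≤ᵇ (ℕ.≤-trans (≤ᵇ⇒≤ H s (subst T (sym p) _)) s≤t)))
  ... | false | true  with 4 ℕ.* H ≤ᵇ 5 ℕ.* s
  ...   | true  = mid⊑top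
  ...   | false = low⊑
  level-mono H {s} {t} s≤t | false | false with 4 ℕ.* H ≤ᵇ 5 ℕ.* s in q | 4 ℕ.* H ≤ᵇ 5 ℕ.* t in q′
  ... | true  | true  = mid⊑mid
  ... | true  | false =
    ⊥-elim (subst T q′ (≤⇒≤ᵇ (ℕ.≤-trans (≤ᵇ⇒≤ (4 ℕ.* H) (5 ℕ.* s) (subst T (sym q) _)) (ℕ.*-monoʳ-≤ 5 s≤t))))
  ... | false | _     = low⊑

  level-<top : ∀ H {s} → s ℕ.< H → level H s ⊑ mid
  level-<top H {s} s<H with H ≤ᵇ s in p
  ... | true  = ⊥-elim (ℕ.<⇒≱ s<H (≤ᵇ⇒≤ H s (subst T (sym p) _)))
  ... | false with 4 ℕ.* H ≤ᵇ 5 ℕ.* s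
  ...   | true  = mid⊑mid
  ...   | false = low⊑

-- The slack inequality for arbitrary weights, by symmetry

module SlackBound where
  open import Data.Fin.Patterns using (0F; 1F; 2F; 3F; 4F; 5F; 6F; 7F; 8F; 9F)
  open import Data.Integer hiding (suc; _⊖_; _⊔_; _≤ᵇ_)
  open import Data.Integer.Properties using (i≤j⇒0≤j-i)
  import Data.Integer.Properties as ℤ
  open import Data.List.Relation.Unary.All using (All; []; _∷_)
  open import Data.List.Relation.Unary.All.Properties using (++⁺)
  open import Data.Nat as ℕ using (ℕ; _⊔_; _≤ᵇ_)
  open import Data.Nat.Properties using (≤ᵇ⇒≤; ≤⇒≤ᵇ)
  import Data.Nat.Properties as ℕ
  open import Data.Vec using (Vec; []; _∷_)
  import Data.Vec.Relation.Unary.All as Vecᴬ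
  import Algebra.Properties.CommutativeSemigroup ℕ.+-commutativeSemigroup as +ℕ
  import Algebra.Properties.CommutativeSemigroup ℤ.+-commutativeSemigroup as +ℤ
  import Algebra.Properties.CommutativeSemigroup ℤ.*-commutativeSemigroup as *ℤ
  open Polynomials
  open PriceCertificate

  xy⊔z≡xz⊔y : ∀ x y z → x ⊔ y ⊔ z ≡ x ⊔ z ⊔ y
  xy⊔z≡xz⊔y x y z = trans (ℕ.⊔-assoc x y z) (trans (cong (x ⊔_) (ℕ.⊔-comm y z)) (sym (ℕ.⊔-assoc x z y)))

  rate-swap₁₂ : ∀ h a b c → rate h a b c ≡ rate h b a c
  rate-swap₁₂ h a b c = cong₂ (rate′ h) (cong (ℕ._+ c) (ℕ.+-comm a b)) (cong (_⊔ c) (ℕ.⊔-comm a b))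

  rate-swap₂₃ : ∀ h a b c → rate h a b c ≡ rate h a c b
  rate-swap₂₃ h a b c = cong₂ (rate′ h) (+ℕ.xy∙z≈xz∙y a b c) (xy⊔z≡xz⊔y a b c)

  core-cong : ∀ {e e′} h {m m′} a b c d {p p′ q q′ r r′ s s′} → e ≡ e′ → m ≡ m′ →
              p ≡ p′ → q ≡ q′ → r ≡ r′ → s ≡ s′ → core e h m a b c d p q r s ≡ core e′ h m′ a b c d p′ q′ r′ s′
  core-cong h a b c d refl refl refl refl refl refl = refl

  -- The split on `e` makes `gapᶠ e` closed, so that the first `refl` can compare the two
  -- expansions. Each price moves together with the weight that it multiplies.
  core-swap₁₂ : ∀ e h m a b c d p q r s → core e h m a b c d p q r s ≡ core e h m b a c d q p r s
  core-swap₁₂ true  h m a b c d p q r s = value-invariant (gapᶠ true)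
    (var 0F ∷ var 1F ∷ var 3F ∷ var 2F ∷ var 4F ∷ var 5F ∷ var 7F ∷ var 6F ∷ var 8F ∷ var 9F ∷ [])
    (+ h ∷ + m ∷ + a ∷ + b ∷ + c ∷ + d ∷ p ∷ q ∷ r ∷ s ∷ []) refl refl
  core-swap₁₂ false h m a b c d p q r s = value-invariant (gapᶠ false)
    (var 0F ∷ var 1F ∷ var 3F ∷ var 2F ∷ var 4F ∷ var 5F ∷ var 7F ∷ var 6F ∷ var 8F ∷ var 9F ∷ [])
    (+ h ∷ + m ∷ + a ∷ + b ∷ + c ∷ + d ∷ p ∷ q ∷ r ∷ s ∷ []) refl refl

  core-swap₂₃ : ∀ e h m a b c d p q r s → core e h m a b c d p q r s ≡ core e h m a c b d p r q s
  core-swap₂₃ true  h m a b c d p q r s = value-invariant (gapᶠ true)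
    (var 0F ∷ var 1F ∷ var 2F ∷ var 4F ∷ var 3F ∷ var 5F ∷ var 6F ∷ var 8F ∷ var 7F ∷ var 9F ∷ [])
    (+ h ∷ + m ∷ + a ∷ + b ∷ + c ∷ + d ∷ p ∷ q ∷ r ∷ s ∷ []) refl refl
  core-swap₂₃ false h m a b c d p q r s = value-invariant (gapᶠ false)
    (var 0F ∷ var 1F ∷ var 2F ∷ var 4F ∷ var 3F ∷ var 5F ∷ var 6F ∷ var 8F ∷ var 7F ∷ var 9F ∷ [])
    (+ h ∷ + m ∷ + a ∷ + b ∷ + c ∷ + d ∷ p ∷ q ∷ r ∷ s ∷ []) refl refl

  core-swap₃₄ : ∀ e h m a b c d p q r s → core e h m a b c d p q r s ≡ core e h m a b d c p q s r
  core-swap₃₄ true  h m a b c d p q r s = value-invariant (gapᶠ true)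
    (var 0F ∷ var 1F ∷ var 2F ∷ var 3F ∷ var 5F ∷ var 4F ∷ var 6F ∷ var 7F ∷ var 9F ∷ var 8F ∷ [])
    (+ h ∷ + m ∷ + a ∷ + b ∷ + c ∷ + d ∷ p ∷ q ∷ r ∷ s ∷ []) refl refl
  core-swap₃₄ false h m a b c d p q r s = value-invariant (gapᶠ false)
    (var 0F ∷ var 1F ∷ var 2F ∷ var 3F ∷ var 5F ∷ var 4F ∷ var 6F ∷ var 7F ∷ var 9F ∷ var 8F ∷ [])
    (+ h ∷ + m ∷ + a ∷ + b ∷ + c ∷ + d ∷ p ∷ q ∷ r ∷ s ∷ []) refl refl

  gap-swap₁₂ : ∀ h a b c d → gap h a b c d ≡ gap h b a c d
  gap-swap₁₂ h a b c d = trans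
    (core-swap₁₂ (h ≤ᵇ a ℕ.+ b ℕ.+ c ℕ.+ d) h (a ⊔ b ⊔ c ⊔ d) a b c d
      (rate h b c d) (rate h a c d) (rate h a b d) (rate h a b c))
    (core-cong h b a c d (cong (λ x → h ≤ᵇ x ℕ.+ c ℕ.+ d) (ℕ.+-comm a b)) (cong (λ x → x ⊔ c ⊔ d) (ℕ.⊔-comm a b))
      refl refl (rate-swap₁₂ h a b d) (rate-swap₁₂ h a b c))

  gap-swap₂₃ : ∀ h a b c d → gap h a b c d ≡ gap h a c b d
  gap-swap₂₃ h a b c d = trans
    (core-swap₂₃ (h ≤ᵇ a ℕ.+ b ℕ.+ c ℕ.+ d) h (a ⊔ b ⊔ c ⊔ d) a b c d
      (rate h b c d) (rate h a c d) (rate h a b d) (rate h a b c))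
    (core-cong h a c b d (cong (λ x → h ≤ᵇ x ℕ.+ d) (+ℕ.xy∙z≈xz∙y a b c)) (cong (_⊔ d) (xy⊔z≡xz⊔y a b c))
      (rate-swap₁₂ h b c d) refl refl (rate-swap₂₃ h a b c))

  gap-swap₃₄ : ∀ h a b c d → gap h a b c d ≡ gap h a b d c
  gap-swap₃₄ h a b c d = trans
    (core-swap₃₄ (h ≤ᵇ a ℕ.+ b ℕ.+ c ℕ.+ d) h (a ⊔ b ⊔ c ⊔ d) a b c d
      (rate h b c d) (rate h a c d) (rate h a b d) (rate h a b c))
    (core-cong h a b d c (cong (h ≤ᵇ_) (+ℕ.xy∙z≈xz∙y (a ℕ.+ b) c d)) (xy⊔z≡xz⊔y (a ⊔ b) c d)
      (rate-swap₂₃ h b c d) (rate-swap₂₃ h a c d) refl refl)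

  module _ {P : ℕ → ℕ → ℕ → ℕ → Set}
           (swap₁₂ : ∀ {a b c d} → P a b c d → P b a c d)
           (swap₂₃ : ∀ {a b c d} → P a b c d → P a c b d)
           (swap₃₄ : ∀ {a b c d} → P a b c d → P a b d c)
           (sorted : ∀ {a b c d} → a ℕ.≤ b → b ℕ.≤ c → c ℕ.≤ d → P a b c d) where

    sorted₃ : ∀ a {b c d} → b ℕ.≤ c → c ℕ.≤ d → P a b c d
    sorted₃ a {b} {c} {d} b≤c c≤d with ℕ.≤-total a b | ℕ.≤-total a c | ℕ.≤-total a d
    ... | inj₁ a≤b | _        | _        = sorted a≤b b≤c c≤d
    ... | inj₂ b≤a | inj₁ a≤c | _        = swap₁₂ (sorted b≤a a≤c c≤d)
    ... | inj₂ _   | inj₂ c≤a | inj₁ a≤d = swap₁₂ (swap₂₃ (sorted b≤c c≤a a≤d))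
    ... | inj₂ _   | inj₂ _   | inj₂ d≤a = swap₁₂ (swap₂₃ (swap₃₄ (sorted b≤c c≤d d≤a)))

    sorted₂ : ∀ a b {c d} → c ℕ.≤ d → P a b c d
    sorted₂ a b {c} {d} c≤d with ℕ.≤-total b c | ℕ.≤-total b d
    ... | inj₁ b≤c | _        = sorted₃ a b≤c c≤d
    ... | inj₂ c≤b | inj₁ b≤d = swap₂₃ (sorted₃ a c≤b b≤d)
    ... | inj₂ _   | inj₂ d≤b = swap₂₃ (swap₃₄ (sorted₃ a c≤d d≤b))

    -- Insertion sort from the right with adjacent swaps: `sorted₂` and `sorted₃` insert the second
    -- and the first argument into a sorted tail.
    wlog-sorted : ∀ a b c d → P a b c d
    wlog-sorted a b c d with ℕ.≤-total c d
    ... | inj₁ c≤d = sorted₂ a b c≤d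
    ... | inj₂ d≤c = swap₃₄ (sorted₂ a b d≤c)

  -- Weights written as partial sums turn the chamber a ≤ b ≤ c ≤ d ≤ h into the nonnegative
  -- orthant, where the coefficientwise test applies. Addition of nonnegative integers computes, so
  -- the forms evaluate to the intended sums by `refl`.
  gap-increments : ∀ x₀ x₁ x₂ x₃ x₄ →
    let a = x₀ ; b = a ℕ.+ x₁ ; c = b ℕ.+ x₂ ; d = c ℕ.+ x₃ ; h = d ℕ.+ x₄ in 0ℤ ≤ gap h a b c d
  gap-increments x₀ x₁ x₂ x₃ x₄ = subst (0ℤ ≤_) (same edge) (value-nonNeg (target l₀ l₁ l₂ l₃ edge) ρ (holds edge refl))
    where
    a′ = x₀
    b′ = a′ ℕ.+ x₁
    c′ = b′ ℕ.+ x₂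
    d′ = c′ ℕ.+ x₃
    h′ = d′ ℕ.+ x₄

    ρ : Vec ℤ 5
    ρ = + x₀ ∷ + x₁ ∷ + x₂ ∷ + x₃ ∷ + x₄ ∷ []

    0≤ρ : Vecᴬ.All (0ℤ ≤_) ρ
    0≤ρ = 0≤+ Vecᴬ.∷ 0≤+ Vecᴬ.∷ 0≤+ Vecᴬ.∷ 0≤+ Vecᴬ.∷ 0≤+ Vecᴬ.∷ Vecᴬ.[]

    a≤b : a′ ℕ.≤ b′
    a≤b = ℕ.m≤m+n a′ x₁
    b≤c : b′ ℕ.≤ c′
    b≤c = ℕ.m≤m+n b′ x₂
    c≤d : c′ ℕ.≤ d′
    c≤d = ℕ.m≤m+n c′ x₃

    s₀ = a′ ℕ.+ b′ ℕ.+ c′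
    s₁ = a′ ℕ.+ b′ ℕ.+ d′
    s₂ = a′ ℕ.+ c′ ℕ.+ d′
    s₃ = b′ ℕ.+ c′ ℕ.+ d′
    S = a′ ℕ.+ b′ ℕ.+ c′ ℕ.+ d′
    l₀ = level h′ s₀
    l₁ = level h′ s₁
    l₂ = level h′ s₂
    l₃ = level h′ s₃
    edge = h′ ≤ᵇ S

    gens : ∀ e → 0ℤ ≤ ⟦ edgeᶠ e ⟧ ρ → All (Holds {ρ}) (generators l₀ l₁ l₂ l₃ e)
    gens e p = 0≤+ ∷ 0≤+ ∷ 0≤+ ∷ 0≤+ ∷ 0≤+ ∷
      ++⁺ (level-sound (a ⊕ b ⊕ c) s₀ h′ refl refl)
        (++⁺ (level-sound (a ⊕ b ⊕ d) s₁ h′ refl refl)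
          (++⁺ (level-sound (a ⊕ c ⊕ d) s₂ h′ refl refl)
            (++⁺ (level-sound (b ⊕ c ⊕ d) s₃ h′ refl refl) (p ∷ []))))

    l₀⊑l₁ : l₀ ⊑ l₁
    l₀⊑l₁ = level-mono h′ (ℕ.+-monoʳ-≤ (a′ ℕ.+ b′) c≤d)
    l₁⊑l₂ : l₁ ⊑ l₂
    l₁⊑l₂ = level-mono h′ (ℕ.+-monoˡ-≤ d′ (ℕ.+-monoʳ-≤ a′ b≤c))
    l₂⊑l₃ : l₂ ⊑ l₃
    l₂⊑l₃ = level-mono h′ (ℕ.+-monoˡ-≤ d′ (ℕ.+-monoˡ-≤ c′ a≤b))

    s₃≤S : s₃ ℕ.≤ S
    s₃≤S = ℕ.+-monoˡ-≤ d′ (ℕ.+-monoˡ-≤ c′ (ℕ.m≤n+m b′ a′))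

    holds : ∀ e → (h′ ≤ᵇ S) ≡ e → Holds {ρ} (target l₀ l₁ l₂ l₃ e)
    holds true  p = edge-holds {ρ} {l₀} {l₁} {l₂} {l₃} l₀⊑l₁ l₁⊑l₂ l₂⊑l₃ 0≤ρ
      (gens true (i≤j⇒0≤j-i {+ h′} {+ S} (+≤+ (≤ᵇ⇒≤ h′ S (subst T (sym p) _)))))
    holds false p = nonedge-holds {ρ} {l₀} {l₁} {l₂} {l₃} l₀⊑l₁ l₁⊑l₂ l₂⊑l₃ (level-<top h′ (ℕ.≤-<-trans s₃≤S S<h)) 0≤ρ
      (gens false (i≤j⇒0≤j-i {+ S} {+ h′} (+≤+ (ℕ.<⇒≤ S<h))))
      where
      S<h : S ℕ.< h′
      S<h = ℕ.≰⇒> λ h≤S → subst T p (≤⇒≤ᵇ h≤S)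

    max₃ : ∀ {x y z} → x ℕ.≤ y → y ℕ.≤ z → z ≡ x ⊔ y ⊔ z
    max₃ x≤y y≤z = sym (trans (cong (_⊔ _) (ℕ.m≤n⇒m⊔n≡n x≤y)) (ℕ.m≤n⇒m⊔n≡n y≤z))

    rate-⟦⟧ : ∀ l s m {s′ m′ m″} → ⟦ s ⟧ ρ ≡ + s′ → ⟦ m ⟧ ρ ≡ + m′ → m′ ≡ m″ →
              ⟦ priceᶠ l [ h ∷ s ∷ m ∷ [] ] ⟧ ρ ≡ value (priceᶠ l) (+ h′ ∷ + s′ ∷ + m″ ∷ [])
    rate-⟦⟧ l s m p q refl = trans (sym (value-⟦⟧ (priceᶠ l [ h ∷ s ∷ m ∷ [] ]) ρ))
      (value-[] (priceᶠ l) (h ∷ s ∷ m ∷ []) ρ (cong₂ (λ s m → + h′ ∷ s ∷ m ∷ []) p q))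

    same : ∀ e → value (target l₀ l₁ l₂ l₃ e) ρ ≡
      core e h′ (a′ ⊔ b′ ⊔ c′ ⊔ d′) a′ b′ c′ d′
        (rate h′ b′ c′ d′) (rate h′ a′ c′ d′) (rate h′ a′ b′ d′) (rate h′ a′ b′ c′)
    same e = trans (value-[] (gapᶠ e) _ ρ refl)
      (core-cong {e} h′ a′ b′ c′ d′ refl
        (trans (max₃ b≤c c≤d) (cong (λ x → x ⊔ c′ ⊔ d′) (sym (ℕ.m≤n⇒m⊔n≡n a≤b))))
        (rate-⟦⟧ l₃ (b ⊕ c ⊕ d) d refl refl (max₃ b≤c c≤d))
        (rate-⟦⟧ l₂ (a ⊕ c ⊕ d) d refl refl (max₃ (ℕ.≤-trans a≤b b≤c) c≤d))
        (rate-⟦⟧ l₁ (a ⊕ b ⊕ d) d refl refl (max₃ a≤b (ℕ.≤-trans b≤c c≤d)))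
        (rate-⟦⟧ l₀ (a ⊕ b ⊕ c) c refl refl (max₃ a≤b b≤c)))

  gap-nonNeg : ∀ h a b c d → a ℕ.≤ h → b ℕ.≤ h → c ℕ.≤ h → d ℕ.≤ h → 0ℤ ≤ gap h a b c d
  gap-nonNeg h = wlog-sorted {P = λ a b c d → a ℕ.≤ h → b ℕ.≤ h → c ℕ.≤ h → d ℕ.≤ h → 0ℤ ≤ gap h a b c d}
    (λ {a} {b} {c} {d} f pa pb pc pd → subst (0ℤ ≤_) (gap-swap₁₂ h a b c d) (f pb pa pc pd))
    (λ {a} {b} {c} {d} f pa pb pc pd → subst (0ℤ ≤_) (gap-swap₂₃ h a b c d) (f pa pc pb pd))
    (λ {a} {b} {c} {d} f pa pb pc pd → subst (0ℤ ≤_) (gap-swap₃₄ h a b c d) (f pa pb pd pc))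
    (λ {a} {b} {c} {d} a≤b b≤c c≤d _ _ _ d≤h → increasing {a} {b} {c} {d} a≤b b≤c c≤d d≤h)
    where
    from-increments : ∀ {a b c d} → ∃ (λ x → a ℕ.+ x ≡ b) → ∃ (λ x → b ℕ.+ x ≡ c) →
                      ∃ (λ x → c ℕ.+ x ≡ d) → ∃ (λ x → d ℕ.+ x ≡ h) → 0ℤ ≤ gap h a b c d
    from-increments {a} (x₁ , refl) (x₂ , refl) (x₃ , refl) (x₄ , refl) = gap-increments a x₁ x₂ x₃ x₄

    increasing : ∀ {a b c d} → a ℕ.≤ b → b ℕ.≤ c → c ℕ.≤ d → d ℕ.≤ h → 0ℤ ≤ gap h a b c d
    increasing {a} {b} {c} {d} a≤b b≤c c≤d d≤h = from-increments {a} {b} {c} {d} (ℕ.m≤n⇒∃[o]m+o≡n a≤b)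
      (ℕ.m≤n⇒∃[o]m+o≡n b≤c) (ℕ.m≤n⇒∃[o]m+o≡n c≤d) (ℕ.m≤n⇒∃[o]m+o≡n d≤h)

-- Sums over ordered quadruples

module TupleSums where
  open import Data.Integer hiding (suc)
  open import Data.Integer.Properties
  open import Data.Integer.Tactic.RingSolver using (solve-∀)
  open import Algebra.Properties.Semiring.Sum +-*-semiring public
    using (sum; sum-cong-≗; ∑-distrib-+; ∑-comm; *-distribˡ-sum; *-distribʳ-sum)

  Tuple : ℕ → Set → Set
  Tuple n A = Fin n → Fin n → Fin n → Fin n → A

  ∑₄ : ∀ {n} → Tuple n ℤ → ℤ
  ∑₄ f = sum λ a → sum λ b → sum λ c → sum λ d → f a b c d

  sum-mono : ∀ {n} {f g : Fin n → ℤ} → (∀ i → f i ≤ g i) → sum f ≤ sum g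
  sum-mono {zero}  f≤g = ≤-refl
  sum-mono {suc n} f≤g = +-mono-≤ (f≤g zero) (sum-mono λ i → f≤g (suc i))

  sum-zero : ∀ {n} {f : Fin n → ℤ} → (∀ i → f i ≡ 0ℤ) → sum f ≡ 0ℤ
  sum-zero {zero}  f≡0 = refl
  sum-zero {suc n} f≡0 = cong₂ _+_ (f≡0 zero) (sum-zero λ i → f≡0 (suc i))

  sum-nonNeg : ∀ {n} {f : Fin n → ℤ} → (∀ i → 0ℤ ≤ f i) → 0ℤ ≤ sum f
  sum-nonNeg {zero}  0≤f = ≤-refl
  sum-nonNeg {suc n} 0≤f = +-mono-≤ (0≤f zero) (sum-nonNeg λ i → 0≤f (suc i))

  sum-constant : ∀ n c → sum {n} (λ _ → c) ≡ + n * c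
  sum-constant zero    c = sym (*-zeroˡ c)
  sum-constant (suc n) c = trans (cong (λ x → c + x) (sum-constant n c)) (sym (suc-* (+ n) c))

  ∑₄-cong : ∀ {n} {f g : Tuple n ℤ} → (∀ a b c d → f a b c d ≡ g a b c d) → ∑₄ f ≡ ∑₄ g
  ∑₄-cong eq = sum-cong-≗ λ a → sum-cong-≗ λ b → sum-cong-≗ λ c → sum-cong-≗ λ d → eq a b c d

  ∑₄-mono : ∀ {n} {f g : Tuple n ℤ} → (∀ a b c d → f a b c d ≤ g a b c d) → ∑₄ f ≤ ∑₄ g
  ∑₄-mono le = sum-mono λ a → sum-mono λ b → sum-mono λ c → sum-mono λ d → le a b c d

  ∑₄-nonNeg : ∀ {n} {f : Tuple n ℤ} → (∀ a b c d → 0ℤ ≤ f a b c d) → 0ℤ ≤ ∑₄ f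
  ∑₄-nonNeg le = sum-nonNeg λ a → sum-nonNeg λ b → sum-nonNeg λ c → sum-nonNeg λ d → le a b c d

  ∑₄-+ : ∀ {n} (f g : Tuple n ℤ) → ∑₄ (λ a b c d → f a b c d + g a b c d) ≡ ∑₄ f + ∑₄ g
  ∑₄-+ f g =
    trans (sum-cong-≗ λ a → trans (sum-cong-≗ λ b → trans (sum-cong-≗ λ c → ∑-distrib-+ (f a b c) (g a b c))
      (∑-distrib-+ (λ c → sum (f a b c)) (λ c → sum (g a b c))))
      (∑-distrib-+ (λ b → sum λ c → sum (f a b c)) (λ b → sum λ c → sum (g a b c))))
      (∑-distrib-+ (λ a → sum λ b → sum λ c → sum (f a b c)) (λ a → sum λ b → sum λ c → sum (g a b c)))

  ∑₄-* : ∀ {n} k (f : Tuple n ℤ) → ∑₄ (λ a b c d → k * f a b c d) ≡ k * ∑₄ f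
  ∑₄-* k f = sym
    (trans (*-distribˡ-sum k (λ a → sum λ b → sum λ c → sum (f a b c))) (sum-cong-≗ λ a →
      trans (*-distribˡ-sum k (λ b → sum λ c → sum (f a b c))) (sum-cong-≗ λ b →
        trans (*-distribˡ-sum k (λ c → sum (f a b c))) (sum-cong-≗ λ c → *-distribˡ-sum k (f a b c)))))

  sum-*-sum : ∀ {m n} (f : Fin m → ℤ) (g : Fin n → ℤ) → sum (λ i → sum λ j → f i * g j) ≡ sum f * sum g
  sum-*-sum f g = trans (sum-cong-≗ λ i → sym (*-distribˡ-sum (f i) g)) (sym (*-distribʳ-sum (sum g) f))

  ∑₄-product : ∀ {n} (f : Fin n → ℤ) →
               ∑₄ (λ a b c d → f a * f b * f c * f d) ≡ sum f * sum f * sum f * sum f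
  ∑₄-product f =
    trans (sum-cong-≗ λ a → trans (sum-cong-≗ λ b → trans (sum-*-sum (λ c → f a * f b * f c) f)
      (cong (_* sum f) (sym (*-distribˡ-sum (f a * f b) f))))
      (trans (sym (*-distribʳ-sum (sum f) (λ b → f a * f b * sum f)))
        (cong (_* sum f) (trans (sym (*-distribʳ-sum (sum f) (λ b → f a * f b)))
          (cong (_* sum f) (sym (*-distribˡ-sum (f a) f)))))))
    (trans (sym (*-distribʳ-sum (sum f) (λ a → f a * sum f * sum f)))
      (cong (_* sum f) (trans (sym (*-distribʳ-sum (sum f) (λ a → f a * sum f)))
        (cong (_* sum f) (sym (*-distribʳ-sum (sum f) f))))))

  ∑₄-swap₁₂ : ∀ {n} (f : Tuple n ℤ) → ∑₄ (λ a b c d → f b a c d) ≡ ∑₄ f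
  ∑₄-swap₁₂ f = ∑-comm (λ a b → sum λ c → sum λ d → f b a c d)

  ∑₄-swap₂₃ : ∀ {n} (f : Tuple n ℤ) → ∑₄ (λ a b c d → f a c b d) ≡ ∑₄ f
  ∑₄-swap₂₃ f = sum-cong-≗ λ a → ∑-comm (λ b c → sum λ d → f a c b d)

  ∑₄-swap₃₄ : ∀ {n} (f : Tuple n ℤ) → ∑₄ (λ a b c d → f a b d c) ≡ ∑₄ f
  ∑₄-swap₃₄ f = sum-cong-≗ λ a → sum-cong-≗ λ b → ∑-comm (λ c d → f a b d c)

  module _ {n : ℕ} (f : Tuple (suc n) ℤ) where
    restrict : Tuple n ℤ
    restrict a b c d = f (suc a) (suc b) (suc c) (suc d)

    private
      head-zero : ∀ {n} (g : Fin (suc n) → ℤ) → g zero ≡ 0ℤ → sum g ≡ sum (λ i → g (suc i))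
      head-zero g eq = trans (cong (_+ sum (λ i → g (suc i))) eq) (+-identityˡ _)

      tail-≤ : ∀ {n} (g : Fin (suc n) → ℤ) → 0ℤ ≤ g zero → sum (λ i → g (suc i)) ≤ sum g
      tail-≤ g 0≤ = ≤-trans (≤-reflexive (sym (+-identityˡ _))) (+-monoˡ-≤ (sum λ i → g (suc i)) 0≤)

    -- Index 0 will be the balancing vertex. It can be removed without loss from a sum over light
    -- tuples, and with a loss in the right direction from a sum of slacks, by `∑₄-restrict-≤`.
    ∑₄-restrict : (∀ b c d → f zero b c d ≡ 0ℤ) → (∀ a c d → f a zero c d ≡ 0ℤ) →
                  (∀ a b d → f a b zero d ≡ 0ℤ) → (∀ a b c → f a b c zero ≡ 0ℤ) → ∑₄ f ≡ ∑₄ restrict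
    ∑₄-restrict fa fb fc fd =
      trans (head-zero (λ a → sum λ b → sum λ c → sum λ d → f a b c d)
               (sum-zero λ b → sum-zero λ c → sum-zero λ d → fa b c d)) (sum-cong-≗ λ a →
      trans (head-zero (λ b → sum λ c → sum λ d → f (suc a) b c d)
               (sum-zero λ c → sum-zero λ d → fb (suc a) c d)) (sum-cong-≗ λ b →
      trans (head-zero (λ c → sum λ d → f (suc a) (suc b) c d)
               (sum-zero λ d → fc (suc a) (suc b) d)) (sum-cong-≗ λ c →
      head-zero (f (suc a) (suc b) (suc c)) (fd (suc a) (suc b) (suc c)))))

    ∑₄-restrict-≤ : (∀ a b c d → 0ℤ ≤ f a b c d) → ∑₄ restrict ≤ ∑₄ f
    ∑₄-restrict-≤ 0≤f =
      ≤-trans (sum-mono λ a → ≤-trans (sum-mono λ b → ≤-trans (sum-mono λ c →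
        tail-≤ (f (suc a) (suc b) (suc c)) (0≤f (suc a) (suc b) (suc c) zero))
        (tail-≤ (λ c → sum λ d → f (suc a) (suc b) c d) (sum-nonNeg λ d → 0≤f (suc a) (suc b) zero d)))
        (tail-≤ (λ b → sum λ c → sum λ d → f (suc a) b c d) (sum-nonNeg λ c → sum-nonNeg λ d → 0≤f (suc a) zero c d)))
        (tail-≤ (λ a → sum λ b → sum λ c → sum λ d → f a b c d)
          (sum-nonNeg λ b → sum-nonNeg λ c → sum-nonNeg λ d → 0≤f zero b c d))

  module _ {n : ℕ} (μ z : Fin n → ℤ) (mean-zero : sum (λ i → μ i * z i) ≡ 0ℤ) (r : Fin n → Fin n → Fin n → ℤ) where
    private
      t : Tuple n ℤ
      t a b c d = μ a * μ b * μ c * μ d * (z d * r a b c)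

      regroup : ∀ a b c d z r → a * b * c * d * (z * r) ≡ a * b * c * r * (d * z)
      regroup = solve-∀

      -- The price does not involve d. Summation over d alone therefore produces the factor ∑ μ z =
      -- 0. The other three positions reduce to this one by permuting the summation variables.
      ∑₄-t : ∑₄ t ≡ 0ℤ
      ∑₄-t = sum-zero λ a → sum-zero λ b → sum-zero λ c →
        trans (sum-cong-≗ λ d → regroup (μ a) (μ b) (μ c) (μ d) (z d) (r a b c))
          (trans (sym (*-distribˡ-sum (μ a * μ b * μ c * r a b c) (λ d → μ d * z d)))
            (trans (cong (μ a * μ b * μ c * r a b c *_) mean-zero) (*-zeroʳ (μ a * μ b * μ c * r a b c))))

      rotate₃ : ∀ a b c d x → a * b * c * d * x ≡ a * b * d * c * x
      rotate₃ = solve-∀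
      rotate₂ : ∀ a b c d x → a * b * c * d * x ≡ a * c * d * b * x
      rotate₂ = solve-∀
      rotate₁ : ∀ a b c d x → a * b * c * d * x ≡ b * c * d * a * x
      rotate₁ = solve-∀

    ∑₄-mean-zero₄ : ∑₄ (λ a b c d → μ a * μ b * μ c * μ d * (z d * r a b c)) ≡ 0ℤ
    ∑₄-mean-zero₄ = ∑₄-t

    ∑₄-mean-zero₃ : ∑₄ (λ a b c d → μ a * μ b * μ c * μ d * (z c * r a b d)) ≡ 0ℤ
    ∑₄-mean-zero₃ = trans (∑₄-cong λ a b c d → rotate₃ (μ a) (μ b) (μ c) (μ d) (z c * r a b d))
      (trans (∑₄-swap₃₄ t) ∑₄-t)

    ∑₄-mean-zero₂ : ∑₄ (λ a b c d → μ a * μ b * μ c * μ d * (z b * r a c d)) ≡ 0ℤ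
    ∑₄-mean-zero₂ = trans (∑₄-cong λ a b c d → rotate₂ (μ a) (μ b) (μ c) (μ d) (z b * r a c d))
      (trans (∑₄-swap₂₃ (λ a b c d → t a b d c)) (trans (∑₄-swap₃₄ t) ∑₄-t))

    ∑₄-mean-zero₁ : ∑₄ (λ a b c d → μ a * μ b * μ c * μ d * (z a * r b c d)) ≡ 0ℤ
    ∑₄-mean-zero₁ = trans (∑₄-cong λ a b c d → rotate₁ (μ a) (μ b) (μ c) (μ d) (z a * r b c d))
      (trans (∑₄-swap₁₂ (λ a b c d → t a c d b)) (trans (∑₄-swap₂₃ (λ a b c d → t a b d c)) (trans (∑₄-swap₃₄ t) ∑₄-t)))

  module _ {n : ℕ} (μ z g : Fin n → ℤ) (mean-zero : sum (λ i → μ i * z i) ≡ 0ℤ)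
           (i₄ : Tuple n ℤ) (r : Fin n → Fin n → Fin n → ℤ) (K q : ℤ) where
    private
      m₄ r₁ r₂ r₃ r₄ : Tuple n ℤ
      m₄ a b c d = μ a * μ b * μ c * μ d
      r₁ a b c d = z a * r b c d
      r₂ a b c d = z b * r a c d
      r₃ a b c d = z c * r a b d
      r₄ a b c d = z d * r a b c

      distribute : ∀ m K i q p r₁ r₂ r₃ r₄ → m * (K * (i * q - p) + (r₁ + r₂ + r₃ + r₄)) ≡
                   (((((K * q) * (m * i) + (- K) * (m * p)) + m * r₁) + m * r₂) + m * r₃) + m * r₄
      distribute = solve-∀

      interleave : ∀ a b c d x y u v → (a * b * c * d) * (x * y * u * v) ≡ (a * x) * (b * y) * (c * u) * (d * v)
      interleave = solve-∀

      drop-zeros : ∀ x → x + 0ℤ + 0ℤ + 0ℤ + 0ℤ ≡ x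
      drop-zeros = solve-∀

      G : ℤ
      G = sum λ i → μ i * g i

      products : ∑₄ (λ a b c d → m₄ a b c d * (g a * g b * g c * g d)) ≡ G * G * G * G
      products = trans (∑₄-cong λ a b c d → interleave (μ a) (μ b) (μ c) (μ d) (g a) (g b) (g c) (g d))
        (∑₄-product (λ i → μ i * g i))

    -- Under a product measure of the right mean all price terms vanish and the product term factors
    -- into a fourth power, so only the light mass and that power survive.
    weighted-total :
      ∑₄ (λ a b c d → μ a * μ b * μ c * μ d * (K * (i₄ a b c d * q - g a * g b * g c * g d)
            + (z a * r b c d + z b * r a c d + z c * r a b d + z d * r a b c)))
      ≡ K * q * ∑₄ (λ a b c d → μ a * μ b * μ c * μ d * i₄ a b c d)
        + (- K) * (sum (λ i → μ i * g i) * sum (λ i → μ i * g i) * sum (λ i → μ i * g i) * sum (λ i → μ i * g i))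
    weighted-total =
      trans (∑₄-cong λ a b c d → distribute (m₄ a b c d) K (i₄ a b c d) q (g a * g b * g c * g d)
                                   (r₁ a b c d) (r₂ a b c d) (r₃ a b c d) (r₄ a b c d))
      (trans (∑₄-+ s₃ (λ a b c d → m₄ a b c d * r₄ a b c d)) (trans (cong₂ _+_
      (trans (∑₄-+ s₂ (λ a b c d → m₄ a b c d * r₃ a b c d)) (cong₂ _+_
      (trans (∑₄-+ s₁ (λ a b c d → m₄ a b c d * r₂ a b c d)) (cong₂ _+_
      (trans (∑₄-+ s₀ (λ a b c d → m₄ a b c d * r₁ a b c d)) (cong₂ _+_
      (trans (∑₄-+ (λ a b c d → (K * q) * (m₄ a b c d * i₄ a b c d))
                   (λ a b c d → (- K) * (m₄ a b c d * (g a * g b * g c * g d)))) (cong₂ _+_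
        (∑₄-* (K * q) (λ a b c d → m₄ a b c d * i₄ a b c d))
        (trans (∑₄-* (- K) (λ a b c d → m₄ a b c d * (g a * g b * g c * g d))) (cong ((- K) *_) products))))
      (∑₄-mean-zero₁ μ z mean-zero r)))
      (∑₄-mean-zero₂ μ z mean-zero r)))
      (∑₄-mean-zero₃ μ z mean-zero r)))
      (∑₄-mean-zero₄ μ z mean-zero r))
      (drop-zeros _)))
      where
      s₀ s₁ s₂ s₃ : Tuple n ℤ
      s₀ a b c d = (K * q) * (m₄ a b c d * i₄ a b c d) + (- K) * (m₄ a b c d * (g a * g b * g c * g d))
      s₁ a b c d = s₀ a b c d + m₄ a b c d * r₁ a b c d
      s₂ a b c d = s₁ a b c d + m₄ a b c d * r₂ a b c d
      s₃ a b c d = s₂ a b c d + m₄ a b c d * r₃ a b c d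

-- The slack inequality summed over all quadruples

module WeightedCertificate where
  open import Data.Integer hiding (suc; _⊔_; _≤ᵇ_; _⊖_)
  open import Data.Integer.Properties
  open import Data.Integer.Tactic.RingSolver using (solve-∀)
  open import Data.Nat as ℕ using (ℕ; suc; z≤n; _⊔_; _≤ᵇ_)
  import Data.Nat.Properties as ℕ
  open import Data.Vec using ([]; _∷_)
  open Polynomials
  open PriceCertificate
  open SlackBound
  open TupleSums

  isLight : (h a b c d : ℕ) → ℤ
  isLight h a b c d = if h ≤ᵇ a ℕ.+ b ℕ.+ c ℕ.+ d then 0ℤ else 1ℤ

  -- The slack that the certificates guarantee, homogenised by h; it is kept for heavy quadruples
  -- only.
  bonus : (h a b c d : ℕ) → ℤ
  bonus h a b c d =
    (if h ≤ᵇ a ℕ.+ b ℕ.+ c ℕ.+ d then + 48 else 0ℤ) * ((+ h - + (a ⊔ b ⊔ c ⊔ d)) * (+ h * + h * + h))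

  private
    gapᶜ-⟦⟧ : ∀ α β γ δ ε h m a b c d p q r s → ⟦ gapᶜ α β γ δ ε ⟧ (h ∷ m ∷ a ∷ b ∷ c ∷ d ∷ p ∷ q ∷ r ∷ s ∷ []) ≡
      α * (δ * (h * h * h * h) - (h - a) * (h - b) * (h - c) * (h - d))
      + ((β * a - γ * h) * (h * p) + (β * b - γ * h) * (h * q)
         + (β * c - γ * h) * (h * r) + (β * d - γ * h) * (h * s))
      - ε * ((h - m) * (h * h * h))
    gapᶜ-⟦⟧ α β γ δ ε h m a b c d p q r s = refl

    -- The equations keep the statement literally the summand it is used for, again to avoid unfolding.
    spend : ∀ α β γ δ ε h m a b c d p q r s {e h⁴ ga gb gc gd za zb zc zd rᵃ rᵇ rᶜ rᵈ} →
      e ≡ ε * ((h - m) * (h * h * h)) → h⁴ ≡ h * h * h * h →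
      ga ≡ h - a → gb ≡ h - b → gc ≡ h - c → gd ≡ h - d →
      za ≡ β * a - γ * h → zb ≡ β * b - γ * h → zc ≡ β * c - γ * h → zd ≡ β * d - γ * h →
      rᵃ ≡ h * p → rᵇ ≡ h * q → rᶜ ≡ h * r → rᵈ ≡ h * s →
      0ℤ ≤ value (gapᶜ α β γ δ ε) (h ∷ m ∷ a ∷ b ∷ c ∷ d ∷ p ∷ q ∷ r ∷ s ∷ []) →
      e ≤ α * (δ * h⁴ - ga * gb * gc * gd) + (za * rᵃ + zb * rᵇ + zc * rᶜ + zd * rᵈ)
    spend α β γ δ ε h m a b c d p q r s refl refl refl refl refl refl refl refl refl refl refl refl refl refl 0≤ =
      0≤i-j⇒j≤i (subst (0ℤ ≤_) (trans (value-⟦⟧ (gapᶜ α β γ δ ε) (h ∷ m ∷ a ∷ b ∷ c ∷ d ∷ p ∷ q ∷ r ∷ s ∷ []))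
        (gapᶜ-⟦⟧ α β γ δ ε h m a b c d p q r s)) 0≤)

  bonus-nonNeg : ∀ h a b c d → a ℕ.≤ h → b ℕ.≤ h → c ℕ.≤ h → d ℕ.≤ h → 0ℤ ≤ bonus h a b c d
  bonus-nonNeg h a b c d pa pb pc pd with h ≤ᵇ a ℕ.+ b ℕ.+ c ℕ.+ d
  ... | false = ≤-reflexive (sym (*-zeroˡ ((+ h - + (a ⊔ b ⊔ c ⊔ d)) * (+ h * + h * + h))))
  ... | true  = *-nonNeg {+ 48} (+≤+ z≤n) (*-nonNeg
    (i≤j⇒0≤j-i {+ (a ⊔ b ⊔ c ⊔ d)} {+ h} (+≤+ (ℕ.⊔-lub (ℕ.⊔-lub (ℕ.⊔-lub pa pb) pc) pd)))
    (*-nonNeg (*-nonNeg {+ h} {+ h} (+≤+ z≤n) (+≤+ z≤n)) (+≤+ z≤n)))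

  isLight-full : ∀ h a b c d → h ℕ.≤ a ℕ.+ b ℕ.+ c ℕ.+ d → isLight h a b c d ≡ 0ℤ
  isLight-full h a b c d le with h ≤ᵇ a ℕ.+ b ℕ.+ c ℕ.+ d | ℕ.≤⇒≤ᵇ le
  ... | true | _ = refl

  module _ {n : ℕ} (h : ℕ) (w : Fin n → ℕ) (w≤h : ∀ v → w v ℕ.≤ h) (0<h : 0 ℕ.< h)
           (light : + 249 * sum (λ v → + w v) ≤ + 50 * (+ n * + h)) where
    private
      H Σw k M Q : ℤ
      H = + h
      Σw = sum λ v → + w v
      -- 199 = 249 - 50: a vertex of weight h exceeds the target mean by 199h/249. Giving it mass M,
      -- the deficit of the others, against mass 199h for each of them balances exactly.
      k = + 199 * H
      M = + 50 * (+ n * H) - + 249 * Σw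
      Q = + n * H - Σw

      -- An extra vertex of weight h and mass M brings the mean weight to 50h/249; it lies in no light tuple.
      μ : Fin (suc n) → ℤ
      μ zero    = M
      μ (suc _) = k

      W : Fin (suc n) → ℕ
      W zero    = h
      W (suc v) = w v

      W≤h : ∀ i → W i ℕ.≤ h
      W≤h zero    = ℕ.≤-refl
      W≤h (suc v) = w≤h v

      0≤k : 0ℤ ≤ k
      0≤k = *-nonNeg {+ 199} {H} (+≤+ z≤n) (+≤+ z≤n)

      0≤μ : ∀ i → 0ℤ ≤ μ i
      0≤μ zero    = i≤j⇒0≤j-i light
      0≤μ (suc v) = 0≤k

      z g : Fin (suc n) → ℤ
      z i = + 249 * + W i - + 50 * H
      g i = H - + W i

      sum-affine : ∀ α β → sum (λ v → α * + w v + β) ≡ α * Σw + + n * β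
      sum-affine α β = trans (∑-distrib-+ (λ v → α * + w v) (λ _ → β))
        (cong₂ _+_ (sym (*-distribˡ-sum α (λ v → + w v))) (sum-constant n β))

      mean-zero : sum (λ i → μ i * z i) ≡ 0ℤ
      mean-zero = trans (cong (λ x → M * (+ 249 * H - + 50 * H) + x)
          (trans (sym (*-distribˡ-sum k (λ v → + 249 * + w v - + 50 * H)))
            (cong (k *_) (sum-affine (+ 249) (- (+ 50 * H))))))
        (cancels (+ n) H Σw)
        where
        cancels : ∀ n h t → (+ 50 * (n * h) - + 249 * t) * (+ 249 * h - + 50 * h)
                            + + 199 * h * (+ 249 * t + n * - (+ 50 * h)) ≡ 0ℤ
        cancels = solve-∀

      -- The balancing vertex has full weight, hence g = 0: it corrects the mean without changing
      -- the product term.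
      sum-g : sum (λ i → μ i * g i) ≡ k * Q
      sum-g = trans (cong (λ x → M * (H - H) + x) (trans (sym (*-distribˡ-sum k (λ v → H - + w v)))
          (cong (k *_) (trans (sum-cong-≗ λ v → flip H (+ w v)) (sum-affine -1ℤ H)))))
        (simplify M H k (+ n) Σw)
        where
        flip : ∀ h x → h - x ≡ -1ℤ * x + h
        flip = solve-∀
        simplify : ∀ m h k n t → m * (h - h) + k * (-1ℤ * t + n * h) ≡ k * (n * h - t)
        simplify = solve-∀

      m₄ i₄ b₄ : Tuple (suc n) ℤ
      m₄ a b c d = μ a * μ b * μ c * μ d
      i₄ a b c d = isLight h (W a) (W b) (W c) (W d)
      b₄ a b c d = bonus h (W a) (W b) (W c) (W d)

      r : Fin (suc n) → Fin (suc n) → Fin (suc n) → ℤ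
      r a b c = H * rate h (W a) (W b) (W c)

      0≤m₄ : ∀ a b c d → 0ℤ ≤ m₄ a b c d
      0≤m₄ a b c d = *-nonNeg (*-nonNeg (*-nonNeg (0≤μ a) (0≤μ b)) (0≤μ c)) (0≤μ d)

      H⁴ : ℤ
      H⁴ = H * H * H * H

      lights : ∑₄ (λ a b c d → m₄ a b c d * i₄ a b c d) ≡
               k * k * k * k * ∑₄ (λ a b c d → isLight h (w a) (w b) (w c) (w d))
      lights = trans
        (∑₄-restrict (λ a b c d → m₄ a b c d * i₄ a b c d)
          (λ b c d → vanish zero b c d (heavy₁ (W b) (W c) (W d)))
          (λ a c d → vanish a zero c d (heavy₂ (W a) (W c) (W d)))
          (λ a b d → vanish a b zero d (heavy₃ (W a) (W b) (W d)))
          (λ a b c → vanish a b c zero (ℕ.m≤n+m h (W a ℕ.+ W b ℕ.+ W c))))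
        (∑₄-* (k * k * k * k) (λ a b c d → isLight h (w a) (w b) (w c) (w d)))
        where
        vanish : ∀ a b c d → h ℕ.≤ W a ℕ.+ W b ℕ.+ W c ℕ.+ W d → m₄ a b c d * i₄ a b c d ≡ 0ℤ
        vanish a b c d le =
          trans (cong (m₄ a b c d *_) (isLight-full h (W a) (W b) (W c) (W d) le)) (*-zeroʳ (m₄ a b c d))
        heavy₃ : ∀ x y z → h ℕ.≤ x ℕ.+ y ℕ.+ h ℕ.+ z
        heavy₃ x y z = ℕ.≤-trans (ℕ.m≤n+m h (x ℕ.+ y)) (ℕ.m≤m+n _ z)
        heavy₂ : ∀ x y z → h ℕ.≤ x ℕ.+ h ℕ.+ y ℕ.+ z
        heavy₂ x y z = ℕ.≤-trans (ℕ.m≤n+m h x) (ℕ.≤-trans (ℕ.m≤m+n _ y) (ℕ.m≤m+n _ z))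
        heavy₁ : ∀ x y z → h ℕ.≤ h ℕ.+ x ℕ.+ y ℕ.+ z
        heavy₁ x y z = ℕ.≤-trans (ℕ.m≤m+n h x) (ℕ.≤-trans (ℕ.m≤m+n _ y) (ℕ.m≤m+n _ z))

      N : ℤ
      N = ∑₄ (λ a b c d → isLight h (w a) (w b) (w c) (w d))

      bound : ∀ a b c d → b₄ a b c d ≤ + 3984 * (i₄ a b c d * H⁴ - g a * g b * g c * g d)
                + (z a * r b c d + z b * r a c d + z c * r a b d + z d * r a b c)
      bound a b c d = spend (+ 3984) (+ 249) (+ 50) (i₄ a b c d)
        (if h ≤ᵇ W a ℕ.+ W b ℕ.+ W c ℕ.+ W d then + 48 else 0ℤ)
        H (+ (W a ⊔ W b ⊔ W c ⊔ W d)) (+ W a) (+ W b) (+ W c) (+ W d)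
        (rate h (W b) (W c) (W d)) (rate h (W a) (W c) (W d)) (rate h (W a) (W b) (W d)) (rate h (W a) (W b) (W c))
        {b₄ a b c d} {H⁴} {g a} {g b} {g c} {g d} {z a} {z b} {z c} {z d} {r b c d} {r a c d} {r a b d} {r a b c}
        refl refl refl refl refl refl refl refl refl refl refl refl refl refl
        (gap-nonNeg h (W a) (W b) (W c) (W d) (W≤h a) (W≤h b) (W≤h c) (W≤h d))

      weighted : k * k * k * k * ∑₄ (λ a b c d → bonus h (w a) (w b) (w c) (w d)) ≤
                 ∑₄ (λ a b c d → m₄ a b c d * (+ 3984 * (i₄ a b c d * H⁴ - g a * g b * g c * g d)
                   + (z a * r b c d + z b * r a c d + z c * r a b d + z d * r a b c)))
      weighted = ≤-trans (≤-reflexive (sym (∑₄-* (k * k * k * k) (λ a b c d → bonus h (w a) (w b) (w c) (w d)))))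
        (≤-trans (∑₄-restrict-≤ (λ a b c d → m₄ a b c d * b₄ a b c d) λ a b c d →
            *-nonNeg (0≤m₄ a b c d) (bonus-nonNeg h (W a) (W b) (W c) (W d) (W≤h a) (W≤h b) (W≤h c) (W≤h d)))
          (∑₄-mono λ a b c d → *-monoˡ-≤-nonNeg (m₄ a b c d) {{nonNegative (0≤m₄ a b c d)}}
            (bound a b c d)))

      total : ∀ c → ∑₄ (λ a b c′ d → m₄ a b c′ d * (c * (i₄ a b c′ d * H⁴ - g a * g b * g c′ * g d)
                + (z a * r b c′ d + z b * r a c′ d + z c′ * r a b d + z d * r a b c′)))
              ≡ k * k * k * k * (c * (H⁴ * N - Q * Q * Q * Q))
      total c = trans (weighted-total μ z g mean-zero i₄ r c H⁴)
        (trans (cong₂ (λ x y → c * H⁴ * x + (- c) * (y * y * y * y)) lights sum-g) (factor c k Q H⁴ N))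
        where
        factor : ∀ c k q x n → c * x * (k * k * k * k * n) + (- c) * (k * q * (k * q) * (k * q) * (k * q))
                 ≡ k * k * k * k * (c * (x * n - q * q * q * q))
        factor = solve-∀

      0<k : 0ℤ < k
      0<k = *-pos {+ 199} {H} (+<+ (ℕ.s≤s z≤n)) (+<+ 0<h)

      0<k⁴ : 0ℤ < k * k * k * k
      0<k⁴ = *-pos (*-pos (*-pos 0<k 0<k) 0<k) 0<k

    -- Cancelling k⁴, which is positive as h is, returns from the weighted vertices to counting. The
    -- fourth power is that of n h minus the total weight, which for a cover of total at most s h is
    -- at least (n - s) h.
    ∑-bonus≤ : ∑₄ (λ a b c d → bonus h (w a) (w b) (w c) (w d)) ≤
               + 3984 * (+ h * + h * + h * + h * ∑₄ (λ a b c d → isLight h (w a) (w b) (w c) (w d))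
                 - (+ n * + h - sum (λ v → + w v)) * (+ n * + h - sum (λ v → + w v))
                   * (+ n * + h - sum (λ v → + w v)) * (+ n * + h - sum (λ v → + w v)))
    ∑-bonus≤ = restate {+ h * + h * + h * + h} {∑₄ (λ a b c d → isLight h (w a) (w b) (w c) (w d))}
        {+ n * + h - sum (λ v → + w v)} {+ 3984} {B} refl refl refl (weighted-bound (+ 3984) weighted)
      where
      cancel : ∀ {x y} → k * k * k * k * x ≤ k * k * k * k * y → x ≤ y
      cancel {x} {y} = *-cancelˡ-≤-pos x y (k * k * k * k) {{positive 0<k⁴}}
      B : ℤ
      B = ∑₄ (λ a b c d → bonus h (w a) (w b) (w c) (w d))
      weighted-bound : ∀ c → k * k * k * k * B ≤
                 ∑₄ (λ a b c′ d → m₄ a b c′ d * (c * (i₄ a b c′ d * H⁴ - g a * g b * g c′ * g d)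
                   + (z a * r b c′ d + z b * r a c′ d + z c′ * r a b d + z d * r a b c′))) →
                 B ≤ c * (H⁴ * N - Q * Q * Q * Q)
      weighted-bound c le = cancel {B} {c * (H⁴ * N - Q * Q * Q * Q)} (≤-trans le (≤-reflexive (total c)))
      restate : ∀ {x y u c b} → H⁴ ≡ x → N ≡ y → Q ≡ u → b ≤ c * (H⁴ * N - Q * Q * Q * Q) → b ≤ c * (x * y - u * u * u * u)
      restate refl refl refl p = p

-- Increasing quadruples against all quadruples

module IncreasingTuples where
  open import Data.Integer hiding (suc; _<_)
  open import Data.Integer.Properties hiding (<-trans; <-asym)
  open import Data.Integer.Tactic.RingSolver using (solve-∀)
  open import Data.Nat using (_<ᵇ_; _<_)
  open import Data.Nat.Properties using (<ᵇ⇒<; <⇒<ᵇ; <-trans; <-asym)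
  open import Data.Unit using (tt)
  open TupleSums

  ⟪_⟫ : Bool → ℤ
  ⟪ b ⟫ = if b then 1ℤ else 0ℤ

  ⟪⟫-nonNeg : ∀ b → 0ℤ ≤ ⟪ b ⟫
  ⟪⟫-nonNeg true  = +≤+ z≤n
  ⟪⟫-nonNeg false = +≤+ z≤n

  ⟪⟫-mono : ∀ {p q} → (T p → T q) → ⟪ p ⟫ ≤ ⟪ q ⟫
  ⟪⟫-mono {false} {q}     _   = ⟪⟫-nonNeg q
  ⟪⟫-mono {true}  {true}  _   = ≤-refl
  ⟪⟫-mono {true}  {false} p⇒q = ⊥-elim (p⇒q tt)

  ∧-elim : ∀ {p q} → T (p ∧ q) → T p × T q
  ∧-elim {true} {true} _ = tt , tt

  ∧-intro : ∀ {p q} → T p → T q → T (p ∧ q)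
  ∧-intro {true} {true} _ _ = tt

  ∨-elim : ∀ {p q} → T (p ∨ q) → T p ⊎ T q
  ∨-elim {true}          _ = inj₁ tt
  ∨-elim {false} {true}  _ = inj₂ tt

  ⟪⟫-disjoint : ∀ p q → (T p → T q → ⊥) → ⟪ p ⟫ + ⟪ q ⟫ ≡ ⟪ p ∨ q ⟫
  ⟪⟫-disjoint true  true  disj = ⊥-elim (disj tt tt)
  ⟪⟫-disjoint true  false disj = refl
  ⟪⟫-disjoint false q     disj = +-identityˡ ⟪ q ⟫

  _≺_ : ∀ {n} → Fin n → Fin n → Bool
  i ≺ j = toℕ i <ᵇ toℕ j

  module _ {n : ℕ} where
    private
      lt : ∀ {i j : Fin n} → T (i ≺ j) → toℕ i < toℕ j
      lt {i} {j} = <ᵇ⇒< (toℕ i) (toℕ j)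

      gt : ∀ {i j : Fin n} → toℕ i < toℕ j → T (i ≺ j)
      gt = <⇒<ᵇ

    chain₃ : (a b c : Fin n) → Bool
    chain₃ a b c = a ≺ b ∧ b ≺ c

    chain₄ : (a b c d : Fin n) → Bool
    chain₄ a b c d = a ≺ b ∧ (b ≺ c ∧ c ≺ d)

    chain₃-elim : ∀ {a b c} → T (chain₃ a b c) → toℕ a < toℕ b × toℕ b < toℕ c
    chain₃-elim {a} {b} {c} p with ∧-elim {a ≺ b} p
    ... | p , q = lt {a} {b} p , lt {b} {c} q

    chain₄-elim : ∀ {a b c d} → T (chain₄ a b c d) → toℕ a < toℕ b × toℕ b < toℕ c × toℕ c < toℕ d
    chain₄-elim {a} {b} {c} {d} p with ∧-elim {a ≺ b} p
    ... | p , q = lt {a} {b} p , chain₃-elim {b} {c} {d} q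

    insert₂ : ∀ a b → ⟪ a ≺ b ⟫ + ⟪ b ≺ a ⟫ ≤ 1ℤ
    insert₂ a b = ≤-trans
      (≤-reflexive (⟪⟫-disjoint (a ≺ b) (b ≺ a) λ p q → <-asym (lt {a} {b} p) (lt {b} {a} q)))
      (⟪⟫-mono {_} {true} _)

    insert₃ : ∀ a b x → ⟪ chain₃ x a b ⟫ + ⟪ chain₃ a x b ⟫ + ⟪ chain₃ a b x ⟫ ≤ ⟪ a ≺ b ⟫
    insert₃ a b x = ≤-trans (≤-reflexive (trans
        (cong (_+ ⟪ chain₃ a b x ⟫) (⟪⟫-disjoint p q p#q))
        (⟪⟫-disjoint (p ∨ q) r pq#r)))
      (⟪⟫-mono {(p ∨ q) ∨ r} bound)
      where
      p q r : Bool
      p = chain₃ x a b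
      q = chain₃ a x b
      r = chain₃ a b x
      p#q : T p → T q → ⊥
      p#q P Q with chain₃-elim {x} {a} {b} P | chain₃-elim {a} {x} {b} Q
      ... | x<a , _ | a<x , _ = <-asym x<a a<x
      pq#r : T (p ∨ q) → T r → ⊥
      pq#r PQ R with ∨-elim {p} PQ | chain₃-elim {a} {b} {x} R
      ... | inj₁ P | a<b , b<x with chain₃-elim {x} {a} {b} P
      ...   | x<a , _ = <-asym x<a (<-trans a<b b<x)
      pq#r PQ R | inj₂ Q | a<b , b<x with chain₃-elim {a} {x} {b} Q
      ...   | _ , x<b = <-asym x<b b<x
      bound : T ((p ∨ q) ∨ r) → T (a ≺ b)
      bound PQR with ∨-elim {p ∨ q} PQR
      ... | inj₂ R with chain₃-elim {a} {b} {x} R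
      ...   | a<b , _ = gt {a} {b} a<b
      bound PQR | inj₁ PQ with ∨-elim {p} PQ
      ... | inj₁ P with chain₃-elim {x} {a} {b} P
      ...   | _ , a<b = gt {a} {b} a<b
      bound PQR | inj₁ PQ | inj₂ Q with chain₃-elim {a} {x} {b} Q
      ...   | a<x , x<b = gt {a} {b} (<-trans a<x x<b)

    -- The four positions of x in the chain exclude each other and each implies the chain itself, so
    -- at most one indicator on the left is 1, and none is unless the right side is.
    insert₄ : ∀ a b c x →
      ⟪ chain₄ x a b c ⟫ + ⟪ chain₄ a x b c ⟫ + ⟪ chain₄ a b x c ⟫ + ⟪ chain₄ a b c x ⟫ ≤ ⟪ chain₃ a b c ⟫
    insert₄ a b c x = ≤-trans (≤-reflexive (trans
        (cong (λ z → z + ⟪ r ⟫ + ⟪ s ⟫) (⟪⟫-disjoint p q p#q)) (trans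
        (cong (_+ ⟪ s ⟫) (⟪⟫-disjoint (p ∨ q) r pq#r))
        (⟪⟫-disjoint ((p ∨ q) ∨ r) s pqr#s))))
      (⟪⟫-mono {((p ∨ q) ∨ r) ∨ s} bound)
      where
      p q r s : Bool
      p = chain₄ x a b c
      q = chain₄ a x b c
      r = chain₄ a b x c
      s = chain₄ a b c x
      p#q : T p → T q → ⊥
      p#q P Q with chain₄-elim {x} {a} {b} {c} P | chain₄-elim {a} {x} {b} {c} Q
      ... | x<a , _ | a<x , _ = <-asym x<a a<x
      pq<b : T (p ∨ q) → toℕ x < toℕ b
      pq<b PQ with ∨-elim {p} PQ
      ... | inj₁ P with chain₄-elim {x} {a} {b} {c} P
      ...   | x<a , a<b , _ = <-trans x<a a<b
      pq<b PQ | inj₂ Q with chain₄-elim {a} {x} {b} {c} Q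
      ...   | _ , x<b , _ = x<b
      pq#r : T (p ∨ q) → T r → ⊥
      pq#r PQ R with chain₄-elim {a} {b} {x} {c} R
      ... | _ , b<x , _ = <-asym (pq<b PQ) b<x
      pqr#s : T ((p ∨ q) ∨ r) → T s → ⊥
      pqr#s PQR S with ∨-elim {p ∨ q} PQR | chain₄-elim {a} {b} {c} {x} S
      ... | inj₁ PQ | _ , b<c , c<x = <-asym (pq<b PQ) (<-trans b<c c<x)
      ... | inj₂ R  | _ , _   , c<x with chain₄-elim {a} {b} {x} {c} R
      ...   | _ , _ , x<c = <-asym x<c c<x
      join : toℕ a < toℕ b → toℕ b < toℕ c → T (chain₃ a b c)
      join a<b b<c = ∧-intro {a ≺ b} (gt {a} {b} a<b) (gt {b} {c} b<c)
      bound : T (((p ∨ q) ∨ r) ∨ s) → T (chain₃ a b c)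
      bound PQRS with ∨-elim {(p ∨ q) ∨ r} PQRS
      ... | inj₂ S with chain₄-elim {a} {b} {c} {x} S
      ...   | a<b , b<c , _ = join a<b b<c
      bound PQRS | inj₁ PQR with ∨-elim {p ∨ q} PQR
      ... | inj₂ R with chain₄-elim {a} {b} {x} {c} R
      ...   | a<b , b<x , x<c = join a<b (<-trans b<x x<c)
      bound PQRS | inj₁ PQR | inj₁ PQ with ∨-elim {p} PQ
      ... | inj₁ P with chain₄-elim {x} {a} {b} {c} P
      ...   | _ , a<b , b<c = join a<b b<c
      bound PQRS | inj₁ PQR | inj₁ PQ | inj₂ Q with chain₄-elim {a} {x} {b} {c} Q
      ...   | a<x , x<b , b<c = join (<-trans a<x x<b) b<c

  module _ {n : ℕ} (f : Tuple n ℤ) (0≤f : ∀ a b c d → 0ℤ ≤ f a b c d)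
           (swap₁₂ : ∀ a b c d → f b a c d ≡ f a b c d)
           (swap₂₃ : ∀ a b c d → f a c b d ≡ f a b c d)
           (swap₃₄ : ∀ a b c d → f a b d c ≡ f a b c d) where
    private
      f₂ f₃ f₄ : Tuple n ℤ
      f₂ a b c d = ⟪ a ≺ b ⟫ * f a b c d
      f₃ a b c d = ⟪ chain₃ a b c ⟫ * f a b c d
      f₄ a b c d = ⟪ chain₄ a b c d ⟫ * f a b c d

      scaled : ∀ {p q} a b c d → p ≤ q → p * f a b c d ≤ q * f a b c d
      scaled a b c d = *-monoʳ-≤-nonNeg (f a b c d) {{nonNegative (0≤f a b c d)}}

      step₂ : + 2 * ∑₄ f₂ ≤ ∑₄ f
      step₂ = ≤-trans (≤-reflexive (trans (double (∑₄ f₂)) (trans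
          (cong (λ z → ∑₄ f₂ + z) (sym (∑₄-swap₁₂ f₂)))
          (sym (∑₄-+ f₂ (λ a b c d → f₂ b a c d))))))
        (∑₄-mono λ a b c d → ≤-trans (≤-reflexive (trans
            (cong (λ z → f₂ a b c d + ⟪ b ≺ a ⟫ * z) (swap₁₂ a b c d))
            (sym (*-distribʳ-+ (f a b c d) ⟪ a ≺ b ⟫ ⟪ b ≺ a ⟫))))
          (≤-trans (scaled a b c d (insert₂ a b)) (≤-reflexive (*-identityˡ (f a b c d)))))
        where
        double : ∀ x → + 2 * x ≡ x + x
        double = solve-∀

      step₃ : + 3 * ∑₄ f₃ ≤ ∑₄ f₂
      step₃ = ≤-trans (≤-reflexive (trans (triple (∑₄ f₃)) (sym (trans
          (∑₄-+ (λ a b c d → f₃ c a b d + f₃ a c b d) f₃)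
          (cong (_+ ∑₄ f₃) (trans (∑₄-+ (λ a b c d → f₃ c a b d) (λ a b c d → f₃ a c b d))
            (cong₂ _+_ (trans (∑₄-swap₂₃ (λ a b c d → f₃ b a c d)) (∑₄-swap₁₂ f₃)) (∑₄-swap₂₃ f₃))))))))
        (∑₄-mono λ a b c d → ≤-trans (≤-reflexive (trans
            (cong₂ (λ y z → ⟪ chain₃ c a b ⟫ * y + ⟪ chain₃ a c b ⟫ * z + f₃ a b c d)
              (trans (swap₁₂ a c b d) (swap₂₃ a b c d)) (swap₂₃ a b c d))
            (collect ⟪ chain₃ c a b ⟫ ⟪ chain₃ a c b ⟫ ⟪ chain₃ a b c ⟫ (f a b c d))))
          (scaled a b c d (insert₃ a b c)))
        where
        triple : ∀ x → + 3 * x ≡ x + x + x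
        triple = solve-∀
        collect : ∀ p q r y → p * y + q * y + r * y ≡ (p + q + r) * y
        collect = solve-∀

      step₄ : + 4 * ∑₄ f₄ ≤ ∑₄ f₃
      step₄ = ≤-trans (≤-reflexive (trans (quadruple (∑₄ f₄)) (sym (trans
          (∑₄-+ (λ a b c d → f₄ d a b c + f₄ a d b c + f₄ a b d c) f₄)
          (cong (_+ ∑₄ f₄) (trans (∑₄-+ (λ a b c d → f₄ d a b c + f₄ a d b c) (λ a b c d → f₄ a b d c))
            (cong₂ _+_ (trans (∑₄-+ (λ a b c d → f₄ d a b c) (λ a b c d → f₄ a d b c))
              (cong₂ _+_
                (trans (∑₄-swap₃₄ (λ a b c d → f₄ c a b d)) (trans (∑₄-swap₂₃ (λ a b c d → f₄ b a c d)) (∑₄-swap₁₂ f₄)))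
                (trans (∑₄-swap₃₄ (λ a b c d → f₄ a c b d)) (∑₄-swap₂₃ f₄))))
              (∑₄-swap₃₄ f₄))))))))
        (∑₄-mono λ a b c d → ≤-trans (≤-reflexive (trans
            (cong (_+ f₄ a b c d) (cong₂ _+_ (cong₂ (λ x y → ⟪ chain₄ d a b c ⟫ * x + ⟪ chain₄ a d b c ⟫ * y)
                (trans (swap₁₂ a d b c) (trans (swap₂₃ a b d c) (swap₃₄ a b c d)))
                (trans (swap₂₃ a b d c) (swap₃₄ a b c d)))
              (cong (⟪ chain₄ a b d c ⟫ *_) (swap₃₄ a b c d))))
            (collect ⟪ chain₄ d a b c ⟫ ⟪ chain₄ a d b c ⟫ ⟪ chain₄ a b d c ⟫ ⟪ chain₄ a b c d ⟫ (f a b c d))))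
          (scaled a b c d (insert₄ a b c d)))
        where
        quadruple : ∀ x → + 4 * x ≡ x + x + x + x
        quadruple = solve-∀
        collect : ∀ p q r s y → p * y + q * y + r * y + s * y ≡ (p + q + r + s) * y
        collect = solve-∀

    -- The 24 orderings are reached as 2 · 3 · 4, inserting one more coordinate at a time, which
    -- avoids listing permutations. Quadruples with a repeated entry are lost, hence an inequality
    -- and the need for f ≥ 0.
    24*∑-increasing≤∑ : + 24 * ∑₄ (λ a b c d → ⟪ chain₄ a b c d ⟫ * f a b c d) ≤ ∑₄ f
    24*∑-increasing≤∑ = ≤-trans (≤-reflexive (split (∑₄ f₄)))
      (≤-trans (*-monoˡ-≤-nonNeg (+ 2) (≤-trans (*-monoˡ-≤-nonNeg (+ 3) step₄) step₃)) step₂)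
      where
      split : ∀ x → + 24 * x ≡ + 2 * (+ 3 * (+ 4 * x))
      split = solve-∀

-- Farkas' lemma by Fourier-Motzkin elimination

module LinearInequalities where
  open import Data.List using (List; []; _∷_; _++_; cartesianProductWith)
  open import Data.List.Membership.Propositional using (_∈_)
  open import Data.List.Membership.Propositional.Properties using (∈-cartesianProductWith⁺)
  open import Data.List.Relation.Unary.All as All using (All; []; _∷_)
  open import Data.List.Relation.Unary.All.Properties using (++⁻ˡ; ++⁻ʳ)
  open import Data.List.Relation.Unary.Any using (here; there)
  open import Data.Product using (Σ)
  open import Data.Rational
  open import Data.Rational.Properties
  open import Data.Rational.Solver using (module +-*-Solver)
  open import Data.Vec using (Vec; []; _∷_; zipWith; map; replicate)
  open import Relation.Binary.Definitions using (tri<; tri≈; tri>)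
  open +-*-Solver

  infixl 6 _⊞_
  infixl 7 _⊡_

  _⊞_ : ∀ {n} → Vec ℚ n → Vec ℚ n → Vec ℚ n
  _⊞_ = zipWith _+_

  _⊡_ : ∀ {n} → ℚ → Vec ℚ n → Vec ℚ n
  t ⊡ a = map (t *_) a

  dot : ∀ {n} → Vec ℚ n → Vec ℚ n → ℚ
  dot []      []      = 0ℚ
  dot (x ∷ a) (y ∷ w) = x * y + dot a w

  dot-⊞ : ∀ {n} (a b w : Vec ℚ n) → dot (a ⊞ b) w ≡ dot a w + dot b w
  dot-⊞ []      []      []      = refl
  dot-⊞ (x ∷ a) (y ∷ b) (z ∷ w) rewrite dot-⊞ a b w =
    solve 5 (λ x y z p q → (x :+ y) :* z :+ (p :+ q) := (x :* z :+ p) :+ (y :* z :+ q)) refl x y z (dot a w) (dot b w)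

  dot-⊡ : ∀ {n} t (a w : Vec ℚ n) → dot (t ⊡ a) w ≡ t * dot a w
  dot-⊡ t []      []      = sym (*-zeroʳ t)
  dot-⊡ t (x ∷ a) (y ∷ w) rewrite dot-⊡ t a w =
    solve 4 (λ t x y p → t :* x :* y :+ t :* p := t :* (x :* y :+ p)) refl t x y (dot a w)

  *-nonNeg : ∀ {p q} → 0ℚ ≤ p → 0ℚ ≤ q → 0ℚ ≤ p * q
  *-nonNeg {p} {q} 0≤p 0≤q = ≤-trans (≤-reflexive (sym (*-zeroʳ p))) (*-monoˡ-≤-nonNeg p {{nonNegative 0≤p}} 0≤q)

  p≤0⇒x*p≤0 : ∀ {x p} → 0ℚ ≤ x → p ≤ 0ℚ → x * p ≤ 0ℚ
  p≤0⇒x*p≤0 {x} 0≤x p≤0 = ≤-trans (*-monoˡ-≤-nonNeg x {{nonNegative 0≤x}} p≤0) (≤-reflexive (*-zeroʳ x))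

  inverse : ∀ {x} → 0ℚ < x → ∃ λ t → 0ℚ < t × x * t ≡ 1ℚ
  inverse {x} 0<x = 1/ x , positive⁻¹ (1/ x) {{1/pos⇒pos x}} , *-inverseʳ x
    where
    instance
      x-pos = positive 0<x
      x≢0 = pos⇒nonZero x

  -- The point is the maximum of `as` and of min(0 , `bs`); the 0 serves as a default when lists are
  -- empty.
  between : (as bs : List ℚ) → (∀ {a b} → a ∈ as → b ∈ bs → a ≤ b) →
            ∃ λ x → All (_≤ x) as × All (x ≤_) bs
  between [] [] _ = 0ℚ , [] , []
  between [] (b ∷ bs) _ with between [] bs (λ ())
  ... | x , _ , x≤bs = b ⊓ x , [] , p⊓q≤p b x ∷ All.map (≤-trans (p⊓q≤q b x)) x≤bs
  between (a ∷ as) bs as≤bs with between as bs (λ i j → as≤bs (there i) j)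
  ... | x , as≤x , x≤bs = a ⊔ x , p≤p⊔q a x ∷ All.map (λ le → ≤-trans le (p≤q⊔p a x)) as≤x
      , All.tabulate (λ j → ⊔-lub (as≤bs (here refl) j) (All.lookup x≤bs j))

  -- The pair (c , a) stands for the inequality c + a ∙ w ≤ 0; D is meant to hold of all consequences of a system.
  record Closed {n : ℕ} (D : ℚ → Vec ℚ n → Set) : Set where
    field
      add   : ∀ {c c′ a a′} → D c a → D c′ a′ → D (c + c′) (a ⊞ a′)
      scale : ∀ {t c a} → 0ℚ < t → D c a → D (t * c) (t ⊡ a)

  Member : ∀ {n} → (ℚ → Vec ℚ n → Set) → Set
  Member {n} D = Σ ℚ λ c → Σ (Vec ℚ n) λ a → D c a

  value : ∀ {n} {D : ℚ → Vec ℚ n → Set} → Vec ℚ n → Member D → ℚ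
  value w (c , a , _) = c + dot a w

  private
    module Elimination {n : ℕ} (D : ℚ → Vec ℚ (suc n) → Set) (closed : Closed D) where
      open Closed closed

      Upper Lower Neutral : Set
      Upper   = Member (λ c a → D c (1ℚ ∷ a))
      Lower   = Member (λ c a → D c (- 1ℚ ∷ a))
      Neutral = Member (λ c a → D c (0ℚ ∷ a))

      -- Each inequality is divided by the absolute value of its first coefficient, which becomes 1,
      -- -1 or 0: an upper bound for the first variable, a lower bound, or neither.
      record Split (system : List (Member D)) : Set where
        field
          uppers   : List Upper
          lowers   : List Lower
          neutrals : List Neutral
          solves   : ∀ y w → All (λ u → y + value w u ≤ 0ℚ) uppers → All (λ l → value w l ≤ y) lowers →
                     All (λ z → value w z ≤ 0ℚ) neutrals → All (λ m → value (y ∷ w) m ≤ 0ℚ) system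

      upper-solves : ∀ {x t} c (a : Vec ℚ n) y w → 0ℚ < x → x * t ≡ 1ℚ →
                     y + (t * c + dot (t ⊡ a) w) ≤ 0ℚ → c + (x * y + dot a w) ≤ 0ℚ
      upper-solves {x} {t} c a y w 0<x xt≡1 le = ≤-trans (≤-reflexive (sym (trans
          (cong (λ z → x * (y + (t * c + z))) (dot-⊡ t a w)) (trans
          (solve 5 (λ x t y c d → x :* (y :+ (t :* c :+ t :* d)) := x :* y :+ x :* t :* (c :+ d)) refl x t y c (dot a w))
          (trans (cong (λ z → x * y + z * (c + dot a w)) xt≡1)
          (solve 4 (λ x y c d → x :* y :+ con 1ℚ :* (c :+ d) := c :+ (x :* y :+ d)) refl x y c (dot a w)))))))
        (p≤0⇒x*p≤0 (<⇒≤ 0<x) le)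

      lower-solves : ∀ {x t} c (a : Vec ℚ n) y w → 0ℚ < - x → - x * t ≡ 1ℚ →
                     t * c + dot (t ⊡ a) w ≤ y → c + (x * y + dot a w) ≤ 0ℚ
      lower-solves {x} {t} c a y w 0<-x xt≡1 le = ≤-trans (≤-reflexive (sym (trans
          (cong (λ z → - x * ((t * c + z) - y)) (dot-⊡ t a w)) (trans
          (solve 5 (λ m t y c d → m :* ((t :* c :+ t :* d) :- y) := m :* t :* (c :+ d) :- m :* y) refl (- x) t y c (dot a w))
          (trans (cong (λ z → z * (c + dot a w) - - x * y) xt≡1)
          (solve 4 (λ x y c d → con 1ℚ :* (c :+ d) :- (:- x) :* y := c :+ (x :* y :+ d)) refl x y c (dot a w)))))))
        (p≤0⇒x*p≤0 (<⇒≤ 0<-x) (≤-trans (+-monoˡ-≤ (- y) le) (≤-reflexive (+-inverseʳ y))))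

      split : ∀ system → Split system
      split [] = record { uppers = [] ; lowers = [] ; neutrals = [] ; solves = λ _ _ _ _ _ → [] }
      split ((c , x ∷ a , d) ∷ system) with split system | <-cmp 0ℚ x
      ... | S | tri< 0<x _ _ = record
        { uppers = (t * c , t ⊡ a , subst (λ z → D (t * c) (z ∷ t ⊡ a)) (trans (*-comm t x) xt≡1) (scale 0<t d)) ∷ S.uppers
        ; lowers = S.lowers ; neutrals = S.neutrals
        ; solves = λ { y w (u ∷ us) ls zs → upper-solves c a y w 0<x xt≡1 u ∷ S.solves y w us ls zs } }
        where
        module S = Split S
        t = proj₁ (inverse 0<x)
        0<t = proj₁ (proj₂ (inverse 0<x))
        xt≡1 = proj₂ (proj₂ (inverse 0<x))
      ... | S | tri> _ _ x<0 = record
        { uppers = S.uppers ; neutrals = S.neutrals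
        ; lowers = (t * c , t ⊡ a , subst (λ z → D (t * c) (z ∷ t ⊡ a)) tx≡-1 (scale 0<t d)) ∷ S.lowers
        ; solves = λ { y w us (l ∷ ls) zs → lower-solves c a y w 0<-x xt≡1 l ∷ S.solves y w us ls zs } }
        where
        module S = Split S
        0<-x = neg-antimono-< x<0
        t = proj₁ (inverse 0<-x)
        0<t = proj₁ (proj₂ (inverse 0<-x))
        xt≡1 = proj₂ (proj₂ (inverse 0<-x))
        tx≡-1 : t * x ≡ - 1ℚ
        tx≡-1 = trans (solve 2 (λ t x → t :* x := :- (:- x :* t)) refl t x) (cong -_ xt≡1)
      ... | S | tri≈ _ refl _ = record
        { uppers = S.uppers ; lowers = S.lowers ; neutrals = (c , a , d) ∷ S.neutrals
        ; solves = λ { y w us ls (z ∷ zs) → ≤-trans (≤-reflexive (cong (c +_)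
            (trans (cong (_+ dot a w) (*-zeroˡ y)) (+-identityˡ (dot a w))))) z ∷ S.solves y w us ls zs } }
        where
        module S = Split S

      -- The first coefficient `1ℚ + - 1ℚ` computes to `0ℚ`, so `add` has the required type as it
      -- stands.
      cross : Upper → Lower → Neutral
      cross (c , a , d) (c′ , a′ , d′) = c + c′ , a ⊞ a′ , add d d′

      value-cross : ∀ w u l → value w (cross u l) ≡ value w u + value w l
      value-cross w (c , a , _) (c′ , a′ , _) = trans (cong (c + c′ +_) (dot-⊞ a a′ w))
        (solve 4 (λ c c′ p q → (c :+ c′) :+ (p :+ q) := (c :+ p) :+ (c′ :+ q)) refl c c′ (dot a w) (dot a′ w))

      tail-closed : Closed (λ c a → D c (0ℚ ∷ a))
      tail-closed = record
        { add   = add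
        ; scale = λ {t} {c} {a} 0<t d → subst (λ z → D (t * c) (z ∷ t ⊡ a)) (*-zeroʳ t) (scale 0<t d) }

  -- Multipliers are not tracked explicitly. Every inequality carries its proof of `D`, elimination
  -- uses only the closure of `D`, and so an inconsistent system ends in a proof of `D` for an
  -- absurd inequality c ≤ 0 with c > 0.
  farkas : ∀ n (D : ℚ → Vec ℚ n → Set) → Closed D → (system : List (Member D)) →
           (∃ λ w → All (λ m → value w m ≤ 0ℚ) system) ⊎ (∃ λ c → 0ℚ < c × D c (replicate n 0ℚ))
  farkas zero D closed [] = inj₁ ([] , [])
  farkas zero D closed ((c , [] , d) ∷ system) with farkas zero D closed system | c ≤? 0ℚ
  ... | inj₂ bad       | _       = inj₂ bad
  ... | inj₁ ([] , ok) | yes c≤0 = inj₁ ([] , ≤-trans (≤-reflexive (+-identityʳ c)) c≤0 ∷ ok)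
  ... | inj₁ _         | no c≰0  = inj₂ (c , ≰⇒> c≰0 , d)
  farkas (suc n) D closed system with farkas n (λ c a → D c (0ℚ ∷ a)) tail-closed reduced
    where
    open Elimination D closed
    open Split (split system)
    reduced = neutrals ++ cartesianProductWith cross uppers lowers
  ... | inj₂ bad      = inj₂ bad
  ... | inj₁ (w , ok) = inj₁ (y ∷ w , solves y w upper-ok lower-ok (++⁻ˡ neutrals ok))
    where
    open Elimination D closed
    open Split (split system)
    open import Data.List using () renaming (map to mapᴸ)
    open import Data.List.Membership.Propositional.Properties using (∈-map⁻)
    import Data.List.Relation.Unary.All.Properties as All

    crossed : ∀ {u l} → u ∈ uppers → l ∈ lowers → value w l ≤ - value w u
    crossed {u} {l} i j = ≤-trans (≤-reflexive (solve 2 (λ p q → q := (p :+ q) :- p) refl (value w u) (value w l)))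
      (≤-trans (+-monoˡ-≤ (- value w u) (≤-trans (≤-reflexive (sym (value-cross w u l)))
        (All.lookup (++⁻ʳ neutrals ok) (∈-cartesianProductWith⁺ cross i j)))) (≤-reflexive (+-identityˡ _)))

    compatible : ∀ {a b} → a ∈ mapᴸ (value w) lowers → b ∈ mapᴸ (λ u → - value w u) uppers → a ≤ b
    compatible i j with ∈-map⁻ (value w) i | ∈-map⁻ (λ u → - value w u) j
    ... | l , l∈ , refl | u , u∈ , refl = crossed u∈ l∈

    split-point = between (mapᴸ (value w) lowers) (mapᴸ (λ u → - value w u) uppers) compatible
    y = proj₁ split-point

    lower-ok : All (λ l → value w l ≤ y) lowers
    lower-ok = All.map⁻ (proj₁ (proj₂ split-point))

    upper-ok : All (λ u → y + value w u ≤ 0ℚ) uppers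
    upper-ok = All.map (λ {u} le → ≤-trans (+-monoˡ-≤ (value w u) le) (≤-reflexive (+-inverseˡ (value w u))))
      (All.map⁻ (proj₂ (proj₂ split-point)))

-- Duality of fractional matchings and fractional covers

module FractionalCover where
  open import Data.Bool.Properties using (T?; T-≡)
  import Data.Fin.Properties as Fin
  open import Data.List using (List; []; _∷_; _++_; filterᵇ; allFin) renaming (map to mapᴸ)
  open import Data.List.Membership.Propositional using (_∈_; lose)
  open import Data.List.Membership.Propositional.Properties
    using (∈-map⁺; ∈-++⁺ˡ; ∈-++⁺ʳ; ∈-allFin; ∈-concatMap⁺; ∈-filter⁺; ∈-filter⁻)
  open import Data.List.Relation.Unary.All as All using (All)
  open import Data.List.Relation.Unary.Any using (here; there)
  open import Data.Nat using (_≡ᵇ_)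
  import Data.Nat.Properties as ℕ
  open import Data.Product.Properties using (≡-dec)
  open import Data.Rational
  open import Data.Rational.Properties
  open import Data.Rational.Solver using (module +-*-Solver)
  open import Data.Sum using ([_,_]′)
  open import Data.Vec using (Vec; []; _∷_; lookup; replicate)
  open import Data.Vec.Properties using (lookup-zipWith; lookup-map; lookup-replicate)
  open import Function.Bundles using (Equivalence)
  open import Relation.Nullary using (does)
  open +-*-Solver
  open import Defs using (Quad; Graph4; increasing; edges; sumℚ; size; _∈ᵇ_; FracMatchingNumber≤)
  open LinearInequalities

  module _ {A : Set} where
    ∑ : (A → ℚ) → List A → ℚ
    ∑ φ qs = sumℚ (mapᴸ φ qs)

    ∑-+ : ∀ φ ψ qs → ∑ (λ q → φ q + ψ q) qs ≡ ∑ φ qs + ∑ ψ qs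
    ∑-+ φ ψ []       = refl
    ∑-+ φ ψ (q ∷ qs) = trans (cong (φ q + ψ q +_) (∑-+ φ ψ qs))
      (solve 4 (λ a b c d → (a :+ b) :+ (c :+ d) := (a :+ c) :+ (b :+ d)) refl (φ q) (ψ q) (∑ φ qs) (∑ ψ qs))

    ∑-* : ∀ t φ qs → ∑ (λ q → t * φ q) qs ≡ t * ∑ φ qs
    ∑-* t φ []       = sym (*-zeroʳ t)
    ∑-* t φ (q ∷ qs) = trans (cong (t * φ q +_) (∑-* t φ qs)) (sym (*-distribˡ-+ t (φ q) (∑ φ qs)))

    ∑-zero : ∀ {φ} qs → (∀ {q} → q ∈ qs → φ q ≡ 0ℚ) → ∑ φ qs ≡ 0ℚ
    ∑-zero []       _   = refl
    ∑-zero (q ∷ qs) φ≡0 = trans (cong₂ _+_ (φ≡0 (here refl)) (∑-zero qs λ i → φ≡0 (there i))) (+-identityˡ 0ℚ)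

    module _ {φ : A → ℚ} (0≤φ : ∀ q → 0ℚ ≤ φ q) where
      ∑-nonNeg : ∀ qs → 0ℚ ≤ ∑ φ qs
      ∑-nonNeg []       = ≤-refl
      ∑-nonNeg (q ∷ qs) = +-mono-≤ (0≤φ q) (∑-nonNeg qs)

      ∑-filter : ∀ p qs → ∑ φ (filterᵇ p qs) ≤ ∑ φ qs
      ∑-filter p []       = ≤-refl
      ∑-filter p (q ∷ qs) with p q
      ... | true  = +-monoʳ-≤ (φ q) (∑-filter p qs)
      ... | false = ≤-trans (≤-reflexive (sym (+-identityˡ _))) (+-mono-≤ (0≤φ q) (∑-filter p qs))

      ∑-member : ∀ {q qs} → q ∈ qs → φ q ≤ ∑ φ qs
      ∑-member {q} {_ ∷ qs} (here refl) =
        ≤-trans (≤-reflexive (sym (+-identityʳ _))) (+-monoʳ-≤ (φ q) (∑-nonNeg qs))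
      ∑-member {q} {r ∷ qs} (there i) =
        ≤-trans (≤-reflexive (sym (+-identityˡ _))) (+-mono-≤ (0≤φ r) (∑-member i))

  unit : ∀ {n} → Fin n → Vec ℚ n
  unit {suc n} zero    = 1ℚ ∷ replicate n 0ℚ
  unit         (suc v) = 0ℚ ∷ unit v

  dot-zero : ∀ {n} (w : Vec ℚ n) → dot (replicate n 0ℚ) w ≡ 0ℚ
  dot-zero []      = refl
  dot-zero (x ∷ w) = trans (cong₂ _+_ (*-zeroˡ x) (dot-zero w)) (+-identityˡ 0ℚ)

  dot-unit : ∀ {n} v (w : Vec ℚ n) → dot (unit v) w ≡ lookup w v
  dot-unit zero    (x ∷ w) = trans (cong₂ _+_ (*-identityˡ x) (dot-zero w)) (+-identityʳ x)
  dot-unit (suc v) (x ∷ w) = trans (cong₂ _+_ (*-zeroˡ x) (dot-unit v w)) (+-identityˡ _)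

  lookup-unit : ∀ {n} (v : Fin n) → lookup (unit v) v ≡ 1ℚ
  lookup-unit zero    = refl
  lookup-unit (suc v) = lookup-unit v

  unit-nonNeg : ∀ {n} (u v : Fin n) → 0ℚ ≤ lookup (unit u) v
  unit-nonNeg zero    zero    = nonNegative⁻¹ 1ℚ
  unit-nonNeg zero    (suc v) = ≤-reflexive (sym (lookup-replicate v 0ℚ))
  unit-nonNeg (suc u) zero    = ≤-refl
  unit-nonNeg (suc u) (suc v) = unit-nonNeg u v

  private
    T⇒≡ : ∀ {b} → T b → b ≡ true
    T⇒≡ = Equivalence.to T-≡
    ≡⇒T : ∀ {b} → b ≡ true → T b
    ≡⇒T = Equivalence.from T-≡

  ∈-edges : ∀ {n} (G : Graph4 n) q → increasing q ≡ true → G q ≡ true → q ∈ edges G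
  ∈-edges {n} G q@(a , b , c , d) inc Gq = ∈-filter⁺ (λ q → T? (G q))
    (∈-filter⁺ (λ q → T? (increasing q))
      (∈-concatMap⁺ _ (lose (∈-allFin a) (∈-concatMap⁺ _ (lose (∈-allFin b)
        (∈-concatMap⁺ _ (lose (∈-allFin c) (∈-map⁺ _ (∈-allFin d)))))))) (≡⇒T inc)) (≡⇒T Gq)

  vertices : ∀ {n} → Quad n → Vec ℚ n
  vertices (a , b , c , d) = unit a ⊞ unit b ⊞ unit c ⊞ unit d

  lookup-vertices : ∀ {n} (q : Quad n) v → let (a , b , c , d) = q in lookup (vertices q) v ≡
    lookup (unit a) v + lookup (unit b) v + lookup (unit c) v + lookup (unit d) v
  lookup-vertices (a , b , c , d) v =
    trans (lookup-zipWith _+_ v (unit a ⊞ unit b ⊞ unit c) (unit d)) (cong (_+ lookup (unit d) v)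
    (trans (lookup-zipWith _+_ v (unit a ⊞ unit b) (unit c)) (cong (_+ lookup (unit c) v)
    (lookup-zipWith _+_ v (unit a) (unit b)))))

  dot-vertices : ∀ {n} (q : Quad n) w → let (a , b , c , d) = q in dot (vertices q) w ≡
    lookup w a + lookup w b + lookup w c + lookup w d
  dot-vertices (a , b , c , d) w =
    trans (dot-⊞ (unit a ⊞ unit b ⊞ unit c) (unit d) w) (cong₂ _+_
    (trans (dot-⊞ (unit a ⊞ unit b) (unit c) w) (cong₂ _+_
    (trans (dot-⊞ (unit a) (unit b) w) (cong₂ _+_ (dot-unit a w) (dot-unit b w))) (dot-unit c w))) (dot-unit d w))

  vertices-nonNeg : ∀ {n} (q : Quad n) v → 0ℚ ≤ lookup (vertices q) v
  vertices-nonNeg q@(a , b , c , d) v = ≤-trans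
    (+-mono-≤ (+-mono-≤ (+-mono-≤ (unit-nonNeg a v) (unit-nonNeg b v)) (unit-nonNeg c v)) (unit-nonNeg d v))
    (≤-reflexive (sym (lookup-vertices q v)))

  private
    ∨-cases : ∀ {x y} → (x ∨ y) ≡ true → x ≡ true ⊎ y ≡ true
    ∨-cases {true}  _ = inj₁ refl
    ∨-cases {false} p = inj₂ p

    same : ∀ {n} {u v : Fin n} → (toℕ u ≡ᵇ toℕ v) ≡ true → u ≡ v
    same {_} {u} {v} p = Fin.toℕ-injective (ℕ.≡ᵇ⇒≡ (toℕ u) (toℕ v) (≡⇒T p))

  ∈ᵇ-vertices : ∀ {n} (q : Quad n) v → (v ∈ᵇ q) ≡ true → 1ℚ ≤ lookup (vertices q) v
  ∈ᵇ-vertices q@(a , b , c , d) v v∈q = ≤-trans bound (≤-reflexive (sym (lookup-vertices q v)))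
    where
    x y z t : ℚ
    x = lookup (unit a) v
    y = lookup (unit b) v
    z = lookup (unit c) v
    t = lookup (unit d) v
    one : ∀ {u} → (toℕ v ≡ᵇ toℕ u) ≡ true → 1ℚ ≤ lookup (unit u) v
    one p with same {u = v} p
    ... | refl = ≤-reflexive (sym (lookup-unit v))
    bound : 1ℚ ≤ x + y + z + t
    bound with ∨-cases {toℕ v ≡ᵇ toℕ a} v∈q
    ... | inj₁ p = +-mono-≤ (+-mono-≤ (+-mono-≤ (one p) (unit-nonNeg b v)) (unit-nonNeg c v)) (unit-nonNeg d v)
    ... | inj₂ r with ∨-cases {toℕ v ≡ᵇ toℕ b} r
    ...   | inj₁ p = +-mono-≤ (+-mono-≤ (+-mono-≤ (unit-nonNeg a v) (one p)) (unit-nonNeg c v)) (unit-nonNeg d v)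
    ...   | inj₂ r with ∨-cases {toℕ v ≡ᵇ toℕ c} r
    ...     | inj₁ p = +-mono-≤ (+-mono-≤ (+-mono-≤ (unit-nonNeg a v) (unit-nonNeg b v)) (one p)) (unit-nonNeg d v)
    ...     | inj₂ p = +-mono-≤ (+-mono-≤ (+-mono-≤ (unit-nonNeg a v) (unit-nonNeg b v)) (unit-nonNeg c v)) (one p)

  a∈ᵇq : ∀ {n} (q : Quad n) → (proj₁ q ∈ᵇ q) ≡ true
  a∈ᵇq (a , b , c , d) rewrite T⇒≡ (ℕ.≡⇒≡ᵇ (toℕ a) (toℕ a) refl) = refl

  _≟Q_ : ∀ {n} (q r : Quad n) → Dec (q ≡ r)
  _≟Q_ = ≡-dec Fin._≟_ (≡-dec Fin._≟_ (≡-dec Fin._≟_ Fin._≟_))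

  δ : ∀ {n} → Quad n → Quad n → ℚ
  δ q r = if does (q ≟Q r) then 1ℚ else 0ℚ

  δ-nonNeg : ∀ {n} (q r : Quad n) → 0ℚ ≤ δ q r
  δ-nonNeg q r with q ≟Q r
  ... | yes _ = nonNegative⁻¹ 1ℚ
  ... | no  _ = ≤-refl

  δ-diagonal : ∀ {n} (q : Quad n) → δ q q ≡ 1ℚ
  δ-diagonal q with q ≟Q q
  ... | yes _  = refl
  ... | no q≢q = ⊥-elim (q≢q refl)

  module _ {n : ℕ} (G : Graph4 n) where
    load : (Quad n → ℚ) → Fin n → ℚ
    load φ v = ∑ φ (filterᵇ (v ∈ᵇ_) (edges G))

    -- `size G (δ q)` is the multiplicity of q in the list of edges. Carrying it along as a factor
    -- of the covering inequality for q avoids a proof that the list has no repetitions; only its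
    -- positivity is needed at the end.
    load-δ : ∀ q v → load (δ q) v ≤ size G (δ q) * lookup (vertices q) v
    load-δ q v with v ∈ᵇ q in v∈q
    ... | true  = ≤-trans (∑-filter (δ-nonNeg q) (v ∈ᵇ_) (edges G))
      (≤-trans (≤-reflexive (sym (*-identityʳ (size G (δ q)))))
        (*-monoˡ-≤-nonNeg (size G (δ q)) {{nonNegative (∑-nonNeg (δ-nonNeg q) (edges G))}} (∈ᵇ-vertices q v v∈q)))
    ... | false = ≤-trans (≤-reflexive (∑-zero (filterᵇ (v ∈ᵇ_) (edges G)) outside))
      (*-nonNeg (∑-nonNeg (δ-nonNeg q) (edges G)) (vertices-nonNeg q v))
      where
      outside : ∀ {r} → r ∈ filterᵇ (v ∈ᵇ_) (edges G) → δ q r ≡ 0ℚ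
      outside {r} r∈ with q ≟Q r
      ... | no  _    = refl
      ... | yes refl with trans (sym v∈q) (T⇒≡ (proj₂ (∈-filter⁻ (λ q → T? (v ∈ᵇ q)) {xs = edges G} r∈)))
      ...   | ()

    module _ (s : ℚ) (0≤s : 0ℚ ≤ s) (ν≤s : FracMatchingNumber≤ G s) where
      -- The consequences of the covering system obtained with multipliers φ for the edges and κ for the total weight.
      Consequence : ℚ → Vec ℚ n → Set
      Consequence c a = ∃ λ φ → ∃ λ κ → (∀ q → 0ℚ ≤ φ q) × 0ℚ ≤ κ ×
        (∀ v → lookup a v ≤ κ - load φ v) × c ≤ size G φ - κ * s

      consequence-closed : Closed Consequence
      consequence-closed = record
        { add = λ { {c} {c′} {a} {a′} (φ , κ , 0≤φ , 0≤κ , la , lc) (φ′ , κ′ , 0≤φ′ , 0≤κ′ , la′ , lc′) →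
            (λ q → φ q + φ′ q) , κ + κ′ , (λ q → +-mono-≤ (0≤φ q) (0≤φ′ q)) , +-mono-≤ 0≤κ 0≤κ′ ,
            (λ v → ≤-trans (≤-reflexive (lookup-zipWith _+_ v a a′)) (≤-trans (+-mono-≤ (la v) (la′ v))
              (≤-reflexive (trans (solve 4 (λ k k′ l l′ → (k :- l) :+ (k′ :- l′) := (k :+ k′) :- (l :+ l′))
                  refl κ κ′ (load φ v) (load φ′ v))
                (cong (λ x → κ + κ′ - x) (sym (∑-+ φ φ′ (filterᵇ (v ∈ᵇ_) (edges G))))))))) ,
            ≤-trans (+-mono-≤ lc lc′) (≤-reflexive (trans
              (solve 5 (λ x x′ k k′ s → (x :- k :* s) :+ (x′ :- k′ :* s) := (x :+ x′) :- (k :+ k′) :* s)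
                refl (size G φ) (size G φ′) κ κ′ s)
              (cong (λ x → x - (κ + κ′) * s) (sym (∑-+ φ φ′ (edges G)))))) }
        ; scale = λ { {t} {c} {a} 0<t (φ , κ , 0≤φ , 0≤κ , la , lc) →
            let 0≤t = <⇒≤ 0<t in
            (λ q → t * φ q) , t * κ , (λ q → *-nonNeg 0≤t (0≤φ q)) , *-nonNeg 0≤t 0≤κ ,
            (λ v → ≤-trans (≤-reflexive (lookup-map v (t *_) a))
              (≤-trans (*-monoˡ-≤-nonNeg t {{nonNegative 0≤t}} (la v)) (≤-reflexive (trans
                (solve 3 (λ t k l → t :* (k :- l) := t :* k :- t :* l) refl t κ (load φ v))
                (cong (λ x → t * κ - x) (sym (∑-* t φ (filterᵇ (v ∈ᵇ_) (edges G))))))))) ,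
            ≤-trans (*-monoˡ-≤-nonNeg t {{nonNegative 0≤t}} lc) (≤-reflexive (trans
              (solve 4 (λ t x k s → t :* (x :- k :* s) := t :* x :- t :* k :* s) refl t (size G φ) κ s)
              (cong (λ x → x - t * κ * s) (sym (∑-* t φ (edges G)))))) }
        }

      -- Here φ loads every vertex by at most κ and has size at least κ s + c, so φ/κ would be too
      -- large a fractional matching. As κ may be 0, the division is by κ + η with η = c/(s + 1),
      -- small enough that η s < c still gives a contradiction.
      consistent : ∀ {c} → 0ℚ < c → Consequence c (replicate n 0ℚ) → ⊥
      consistent {c} 0<c (φ , κ , 0≤φ , 0≤κ , la , lc) = <-irrefl refl (<-≤-trans η*[s+1]<c c≤)
        where
        0<s+1 : 0ℚ < s + 1ℚ
        0<s+1 = +-mono-≤-< 0≤s (positive⁻¹ 1ℚ)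
        i = proj₁ (inverse 0<s+1)
        0<i = proj₁ (proj₂ (inverse 0<s+1))
        i-eq = proj₂ (proj₂ (inverse 0<s+1))
        η = c * i
        0<η : 0ℚ < η
        0<η = ≤-<-trans (≤-reflexive (sym (*-zeroʳ c))) (*-monoʳ-<-pos c {{positive 0<c}} 0<i)
        0<κ+η : 0ℚ < κ + η
        0<κ+η = +-mono-≤-< 0≤κ 0<η
        t = proj₁ (inverse 0<κ+η)
        0<t = proj₁ (proj₂ (inverse 0<κ+η))
        t-eq = proj₂ (proj₂ (inverse 0<κ+η))
        0≤t = <⇒≤ 0<t
        ψ : Quad n → ℚ
        ψ q = t * φ q
        0≤ψ : ∀ q → 0ℚ ≤ ψ q
        0≤ψ q = *-nonNeg 0≤t (0≤φ q)
        load≤κ : ∀ v → load φ v ≤ κ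
        load≤κ v = ≤-trans (≤-reflexive (solve 2 (λ k l → l := k :- (k :- l)) refl κ (load φ v)))
          (≤-trans (+-monoʳ-≤ κ (neg-antimono-≤ (≤-trans (≤-reflexive (sym (lookup-replicate v 0ℚ))) (la v))))
            (≤-reflexive (+-identityʳ κ)))
        load-ψ : ∀ v → load ψ v ≤ 1ℚ
        load-ψ v = ≤-trans (≤-reflexive (∑-* t φ (filterᵇ (v ∈ᵇ_) (edges G))))
          (≤-trans (*-monoˡ-≤-nonNeg t {{nonNegative 0≤t}} (≤-trans (load≤κ v)
              (≤-trans (≤-reflexive (sym (+-identityʳ κ))) (+-monoʳ-≤ κ (<⇒≤ 0<η)))))
            (≤-reflexive (trans (*-comm t (κ + η)) t-eq)))
        -- The value of a single edge is at most the load at its first vertex.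
        ψ≤1 : ∀ q → q ∈ edges G → ψ q ≤ 1ℚ
        ψ≤1 q q∈ = ≤-trans (∑-member 0≤ψ (∈-filter⁺ (λ r → T? (proj₁ q ∈ᵇ r)) q∈ (≡⇒T (a∈ᵇq q)))) (load-ψ (proj₁ q))
        size-ψ : size G ψ ≤ s
        size-ψ = ν≤s ψ ((λ q q∈ → 0≤ψ q , ψ≤1 q q∈) , load-ψ)
        size-φ : size G φ ≤ (κ + η) * s
        size-φ = ≤-trans (≤-reflexive (trans (sym (*-identityˡ (size G φ))) (trans (cong (_* size G φ) (sym t-eq))
            (trans (*-assoc (κ + η) t (size G φ)) (cong ((κ + η) *_) (sym (∑-* t φ (edges G))))))))
          (*-monoˡ-≤-nonNeg (κ + η) {{nonNegative (<⇒≤ 0<κ+η)}} size-ψ)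
        c≤ : c ≤ η * s
        c≤ = ≤-trans lc (≤-trans (+-monoˡ-≤ (- (κ * s)) size-φ)
          (≤-reflexive (solve 3 (λ k e s → (k :+ e) :* s :- k :* s := e :* s) refl κ η s)))
        η*[s+1]<c : η * s < c
        η*[s+1]<c = <-≤-trans (≤-<-trans (≤-reflexive (sym (+-identityʳ (η * s)))) (+-monoʳ-< (η * s) 0<η))
          (≤-reflexive (trans (solve 3 (λ c i s → c :* i :* s :+ c :* i := c :* ((s :+ con 1ℚ) :* i)) refl c i s)
            (trans (cong (c *_) i-eq) (*-identityʳ c))))

      private
        none : Quad n → ℚ
        none _ = 0ℚ

        ∑-none : ∀ qs → ∑ none qs ≡ 0ℚ
        ∑-none qs = ∑-zero qs λ _ → refl

        nonNegativity : Fin n → Member Consequence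
        nonNegativity v = 0ℚ , - 1ℚ ⊡ unit v , none , 0ℚ , (λ _ → ≤-refl) , ≤-refl
          , (λ u → ≤-trans (≤-reflexive (trans (lookup-map u (- 1ℚ *_) (unit v))
                (solve 1 (λ x → con (- 1ℚ) :* x := :- x) refl (lookup (unit v) u))))
              (≤-trans (neg-antimono-≤ (unit-nonNeg v u)) (≤-reflexive
                (cong (λ x → 0ℚ - x) (sym (∑-none (filterᵇ (u ∈ᵇ_) (edges G))))))))
          , ≤-reflexive (sym (trans (cong₂ _-_ (∑-none (edges G)) (*-zeroˡ s)) refl))

        total : Member Consequence
        total = - s , replicate n 1ℚ , none , 1ℚ , (λ _ → ≤-refl) , nonNegative⁻¹ 1ℚ
          , (λ u → ≤-reflexive (trans (lookup-replicate u 1ℚ) (cong (λ x → 1ℚ - x) (sym (∑-none (filterᵇ (u ∈ᵇ_) (edges G)))))))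
          , ≤-reflexive (sym (trans (cong₂ _-_ (∑-none (edges G)) (*-identityˡ s)) (+-identityˡ (- s))))

        covering : Quad n → Member Consequence
        covering q = k , - k ⊡ vertices q , δ q , 0ℚ , δ-nonNeg q , ≤-refl
          , (λ v → ≤-trans (≤-reflexive (trans (lookup-map v (- k *_) (vertices q))
                (solve 2 (λ k x → :- k :* x := con 0ℚ :- k :* x) refl k (lookup (vertices q) v))))
              (+-monoʳ-≤ 0ℚ (neg-antimono-≤ (load-δ q v))))
          , ≤-reflexive (sym (trans (cong (λ x → k - x) (*-zeroˡ s)) (+-identityʳ k)))
          where
          k = size G (δ q)

        system : List (Member Consequence)
        system = mapᴸ nonNegativity (allFin n) ++ total ∷ mapᴸ covering (edges G)

        negated : ∀ {x y} → y ≡ - 1ℚ * x → 0ℚ + y ≤ 0ℚ → 0ℚ ≤ x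
        negated {x} refl le = ≤-trans (neg-antimono-≤ le)
          (≤-reflexive (solve 1 (λ x → :- (con 0ℚ :+ con (- 1ℚ) :* x) := x) refl x))

        shifted : ∀ {x} → - s + x ≤ 0ℚ → x ≤ s
        shifted {x} le = ≤-trans (≤-reflexive (solve 2 (λ s x → x := s :+ (:- s :+ x)) refl s x))
          (≤-trans (+-monoʳ-≤ s le) (≤-reflexive (+-identityʳ s)))

        normalised : ∀ {k x y} → 0ℚ < k → y ≡ - k * x → k + y ≤ 0ℚ → 1ℚ ≤ x
        normalised {k} {x} 0<k refl le = *-cancelˡ-≤-pos k {{positive 0<k}} (≤-trans
          (≤-reflexive (solve 2 (λ k x → k :* con 1ℚ := (k :+ :- k :* x) :+ k :* x) refl k x))
          (≤-trans (+-monoˡ-≤ (k * x) le) (≤-reflexive (+-identityˡ (k * x)))))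

      Cover : Vec ℚ n → Set
      Cover w = (∀ v → 0ℚ ≤ lookup w v) × dot (replicate n 1ℚ) w ≤ s ×
        (∀ a b c d → increasing (a , b , c , d) ≡ true → G (a , b , c , d) ≡ true →
          1ℚ ≤ lookup w a + lookup w b + lookup w c + lookup w d)

      private
        solution-covers : ∀ w → All (λ m → value w m ≤ 0ℚ) system → Cover w
        solution-covers w ok = 0≤w , Σw≤s , covers
          where
          satisfied : ∀ {m} → m ∈ system → value w m ≤ 0ℚ
          satisfied = All.lookup ok

          0≤w : ∀ v → 0ℚ ≤ lookup w v
          0≤w v = negated (trans (dot-⊡ (- 1ℚ) (unit v) w) (cong (- 1ℚ *_) (dot-unit v w)))
            (satisfied (∈-++⁺ˡ (∈-map⁺ nonNegativity (∈-allFin v))))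
          Σw≤s : dot (replicate n 1ℚ) w ≤ s
          Σw≤s = shifted (satisfied (∈-++⁺ʳ (mapᴸ nonNegativity (allFin n)) (here refl)))
          covers : ∀ a b c d → increasing (a , b , c , d) ≡ true → G (a , b , c , d) ≡ true →
            1ℚ ≤ lookup w a + lookup w b + lookup w c + lookup w d
          covers a b c d inc Gq = normalised 0<k
            (trans (dot-⊡ (- k) (vertices q) w) (cong (- k *_) (dot-vertices q w)))
            (satisfied (∈-++⁺ʳ (mapᴸ nonNegativity (allFin n)) (there (∈-map⁺ covering q∈))))
            where
            q : Quad n
            q = a , b , c , d
            q∈ : q ∈ edges G
            q∈ = ∈-edges G q inc Gq
            k : ℚ
            k = size G (δ q)
            0<k : 0ℚ < k
            0<k = <-≤-trans (positive⁻¹ 1ℚ) (≤-trans (≤-reflexive (sym (δ-diagonal q))) (∑-member (δ-nonNeg q) q∈))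

      fractional-cover : ∃ Cover
      fractional-cover = [ (λ (w , ok) → w , solution-covers w ok)
                                  , (λ (c , 0<c , bad) → ⊥-elim (consistent 0<c bad)) ]′
                         (farkas n Consequence consequence-closed system)

-- Integers among the rationals, and common denominators

module RationalEmbedding where
  open import Data.Integer as ℤ using (ℤ; +_)
  import Data.Integer.Properties as ℤ
  open import Data.Integer.Tactic.RingSolver using (solve-∀)
  open import Data.Nat as ℕ using (ℕ; zero; suc; z≤n)
  import Data.Nat.Properties as ℕ
  open import Data.Rational
  open import Data.Rational.Properties
  open import Data.Rational.Unnormalised as ℚᵘ using (mkℚᵘ; *≡*; *≤*)
  import Data.Rational.Unnormalised.Properties as ℚᵘ
  open import Data.Vec using (Vec; []; _∷_; lookup; map)
  open import Data.Vec.Properties using (lookup-map)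

  toℚ : ℤ → ℚ
  toℚ i = i / 1

  private
    -- `i / 1` is normalised by a gcd, which does not compute for a variable i. The laws below are
    -- therefore checked on unnormalised fractions, by cross-multiplication.
    toℚᵘ-toℚ : ∀ i → toℚᵘ (toℚ i) ℚᵘ.≃ mkℚᵘ i 0
    toℚᵘ-toℚ i = toℚᵘ-fromℚᵘ (mkℚᵘ i 0)

  toℚ-+ : ∀ i j → toℚ (i ℤ.+ j) ≡ toℚ i + toℚ j
  toℚ-+ i j = toℚᵘ-injective (ℚᵘ.≃-trans (toℚᵘ-toℚ (i ℤ.+ j)) (ℚᵘ.≃-trans (*≡* (lemma i j))
    (ℚᵘ.≃-sym (ℚᵘ.≃-trans (toℚᵘ-homo-+ (toℚ i) (toℚ j)) (ℚᵘ.+-cong (toℚᵘ-toℚ i) (toℚᵘ-toℚ j))))))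
    where
    lemma : ∀ i j → (i ℤ.+ j) ℤ.* + 1 ≡ (i ℤ.* + 1 ℤ.+ j ℤ.* + 1) ℤ.* + 1
    lemma = solve-∀

  toℚ-* : ∀ i j → toℚ (i ℤ.* j) ≡ toℚ i * toℚ j
  toℚ-* i j = toℚᵘ-injective (ℚᵘ.≃-trans (toℚᵘ-toℚ (i ℤ.* j)) (ℚᵘ.≃-trans (*≡* refl)
    (ℚᵘ.≃-sym (ℚᵘ.≃-trans (toℚᵘ-homo-* (toℚ i) (toℚ j)) (ℚᵘ.*-cong (toℚᵘ-toℚ i) (toℚᵘ-toℚ j))))))

  toℚ-neg : ∀ i → toℚ (ℤ.- i) ≡ - toℚ i
  toℚ-neg i = toℚᵘ-injective (ℚᵘ.≃-trans (toℚᵘ-toℚ (ℤ.- i)) (ℚᵘ.≃-trans (*≡* refl)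
    (ℚᵘ.≃-sym (ℚᵘ.≃-trans (toℚᵘ-homo‿- (toℚ i)) (ℚᵘ.-‿cong (toℚᵘ-toℚ i))))))

  toℚ-mono : ∀ {i j} → i ℤ.≤ j → toℚ i ≤ toℚ j
  toℚ-mono {i} {j} i≤j = toℚᵘ-cancel-≤ (ℚᵘ.≤-trans (ℚᵘ.≤-reflexive (toℚᵘ-toℚ i))
    (ℚᵘ.≤-trans (*≤* (ℤ.*-monoʳ-≤-nonNeg (+ 1) i≤j)) (ℚᵘ.≤-reflexive (ℚᵘ.≃-sym (toℚᵘ-toℚ j)))))

  toℚ-cancel : ∀ {i j} → toℚ i ≤ toℚ j → i ℤ.≤ j
  toℚ-cancel {i} {j} le = ℤ.*-cancelʳ-≤-pos i j (+ 1) (ℚᵘ.drop-*≤* (ℚᵘ.≤-trans (ℚᵘ.≤-reflexive (ℚᵘ.≃-sym (toℚᵘ-toℚ i)))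
    (ℚᵘ.≤-trans (toℚᵘ-mono-≤ le) (ℚᵘ.≤-reflexive (toℚᵘ-toℚ j)))))

  *-denominator : ∀ p → p * toℚ (↧ p) ≡ toℚ (↥ p)
  *-denominator p@(mkℚ n d-1 _) = toℚᵘ-injective (ℚᵘ.≃-trans (toℚᵘ-homo-* p (toℚ (↧ p)))
    (ℚᵘ.≃-trans (ℚᵘ.*-cong {toℚᵘ p} (ℚᵘ.≃-refl {toℚᵘ p}) (toℚᵘ-toℚ (↧ p)))
      (ℚᵘ.≃-trans (*≡* (lemma n (+ suc d-1))) (ℚᵘ.≃-sym (toℚᵘ-toℚ n)))))
    where
    lemma : ∀ n d → n ℤ.* d ℤ.* + 1 ≡ n ℤ.* (d ℤ.* + 1)
    lemma = solve-∀

  numerator-nonNeg : ∀ p → 0ℚ ≤ p → ∃ λ k → ↥ p ≡ + k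
  numerator-nonNeg (mkℚ (+ k) _ _) _ = k , refl
  numerator-nonNeg p@(mkℚ (ℤ.-[1+ _ ]) _ _) 0≤p with drop-*≤* 0≤p
  ... | ()

  -- The product of all denominators serves as D. Weight 1 becomes D, which plays the part of h in
  -- the homogenised slack inequality.
  clear-denominators : ∀ {n} (w : Vec ℚ n) → (∀ v → 0ℚ ≤ lookup w v) →
    ∃ λ D → ∃ λ W → 0 ℕ.< D × (∀ v → toℚ (+ lookup W v) ≡ lookup w v * toℚ (+ D))
  clear-denominators [] _ = 1 , [] , ℕ.s≤s z≤n , λ ()
  clear-denominators (x ∷ w) 0≤w with clear-denominators w (λ v → 0≤w (suc v)) | numerator-nonNeg x (0≤w zero)
  ... | D , W , 0<D , eq | k , ↥x≡k = D ℕ.* ↧ₙ x , k ℕ.* D ∷ map (ℕ._* ↧ₙ x) W , ℕ.*-mono-< 0<D (ℕ.s≤s z≤n) , cleared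
    where
    cleared : ∀ v → toℚ (+ lookup (k ℕ.* D ∷ map (ℕ._* ↧ₙ x) W) v) ≡ lookup (x ∷ w) v * toℚ (+ (D ℕ.* ↧ₙ x))
    cleared zero = trans (cong toℚ (ℤ.pos-* k D)) (trans (toℚ-* (+ k) (+ D))
      (trans (cong (_* toℚ (+ D)) (trans (cong toℚ (sym ↥x≡k)) (sym (*-denominator x))))
      (trans (*-assoc x (toℚ (↧ x)) (toℚ (+ D))) (cong (x *_) (trans (sym (toℚ-* (↧ x) (+ D)))
        (cong toℚ (trans (ℤ.*-comm (↧ x) (+ D)) (sym (ℤ.pos-* D (↧ₙ x))))))))))
    cleared (suc v) = trans (cong (λ m → toℚ (+ m)) (lookup-map v (ℕ._* ↧ₙ x) W))
      (trans (cong toℚ (ℤ.pos-* (lookup W v) (↧ₙ x))) (trans (toℚ-* (+ lookup W v) (↧ x))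
      (trans (cong (_* toℚ (↧ x)) (eq v)) (trans (*-assoc (lookup w v) (toℚ (+ D)) (toℚ (↧ x)))
        (cong (lookup w v *_) (trans (sym (toℚ-* (+ D) (↧ x))) (cong toℚ (sym (ℤ.pos-* D (↧ₙ x))))))))))

-- Sorting by adjacent transpositions

module Sorting where
  open import Data.Nat hiding (_⊔_)
  open import Data.Nat.Properties
  open import Data.Vec using (Vec; []; _∷_; lookup; sum)
  open import Data.Vec.Membership.Propositional.Properties using (∈-lookup)
  open import Data.Vec.Relation.Unary.All as All using (All; []; _∷_)
  open import Relation.Binary.Construct.Closure.ReflexiveTransitive using (Star; ε; _◅_; _◅◅_; gmap)

  infix 4 _⇝_ _⇝*_

  -- Sorting is recorded step by step because stability is applied to one transposition at a time:
  -- the larger weight moves to the smaller of two neighbouring vertices.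
  data _⇝_ : ∀ {n} → Vec ℕ n → Vec ℕ n → Set where
    here  : ∀ {n x y} {w : Vec ℕ n} → x ≤ y → (x ∷ y ∷ w) ⇝ (y ∷ x ∷ w)
    there : ∀ {n x} {w w′ : Vec ℕ n} → w ⇝ w′ → (x ∷ w) ⇝ (x ∷ w′)

  _⇝*_ : ∀ {n} → Vec ℕ n → Vec ℕ n → Set
  _⇝*_ = Star _⇝_

  data Decreasing : ∀ {n} → Vec ℕ n → Set where
    []  : Decreasing []
    _∷_ : ∀ {n x} {w : Vec ℕ n} → All (_≤ x) w → Decreasing w → Decreasing (x ∷ w)

  ⇝-All : ∀ {n} {w w′ : Vec ℕ n} {P : ℕ → Set} → w ⇝ w′ → All P w → All P w′
  ⇝-All (here _)  (p ∷ q ∷ ps) = q ∷ p ∷ ps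
  ⇝-All (there s) (p ∷ ps)     = p ∷ ⇝-All s ps

  ⇝*-All : ∀ {n} {w w′ : Vec ℕ n} {P : ℕ → Set} → w ⇝* w′ → All P w → All P w′
  ⇝*-All ε        ps = ps
  ⇝*-All (s ◅ ss) ps = ⇝*-All ss (⇝-All s ps)

  ⇝-sum : ∀ {n} {w w′ : Vec ℕ n} → w ⇝ w′ → sum w′ ≡ sum w
  ⇝-sum (here {x = x} {y} {w} _) = trans (sym (+-assoc y x (sum w))) (trans (cong (_+ sum w) (+-comm y x)) (+-assoc x y (sum w)))
  ⇝-sum (there {x = x} s) = cong (x +_) (⇝-sum s)

  insert : ∀ {n} x {w : Vec ℕ n} → Decreasing w → ∃ λ w′ → (x ∷ w) ⇝* w′ × Decreasing w′
  insert x [] = x ∷ [] , ε , [] ∷ []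
  insert x {y ∷ w} (w≤y ∷ dec) with ≤-total x y
  ... | inj₂ y≤x = x ∷ y ∷ w , ε , (y≤x ∷ All.map (λ z≤y → ≤-trans z≤y y≤x) w≤y) ∷ w≤y ∷ dec
  ... | inj₁ x≤y with insert x dec
  ...   | w′ , steps , dec′ = y ∷ w′ , here x≤y ◅ gmap (y ∷_) there steps , ⇝*-All steps (x≤y ∷ w≤y) ∷ dec′

  sort : ∀ {n} (w : Vec ℕ n) → ∃ λ w′ → w ⇝* w′ × Decreasing w′
  sort []      = [] , ε , []
  sort (x ∷ w) with sort w
  ... | w₁ , steps₁ , dec₁ with insert x dec₁
  ...   | w₂ , steps₂ , dec₂ = w₂ , gmap (x ∷_) there steps₁ ◅◅ steps₂ , dec₂

  decreasing-lookup : ∀ {n} {w : Vec ℕ n} → Decreasing w → ∀ u v → toℕ u ≤ toℕ v → lookup w v ≤ lookup w u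
  decreasing-lookup (_ ∷ _)   zero    zero    _         = ≤-refl
  decreasing-lookup (le ∷ _)  zero    (suc v) _         = All.lookup le (∈-lookup v _)
  decreasing-lookup (_ ∷ dec) (suc u) (suc v) (s≤s u≤v) = decreasing-lookup dec u v u≤v

  record Transposed {n : ℕ} (w w′ : Vec ℕ n) : Set where
    field
      lo hi : Fin n
      next  : toℕ hi ≡ suc (toℕ lo)
      at-lo : lookup w′ lo ≡ lookup w hi
      at-hi : lookup w′ hi ≡ lookup w lo
      rise  : lookup w lo ≤ lookup w hi
      other : ∀ i → i ≢ lo → i ≢ hi → lookup w′ i ≡ lookup w i

  transposed : ∀ {n} {w w′ : Vec ℕ n} → w ⇝ w′ → Transposed w w′
  transposed (here x≤y) = record
    { lo = zero ; hi = suc zero ; next = refl ; at-lo = refl ; at-hi = refl ; rise = x≤y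
    ; other = λ { zero p _ → ⊥-elim (p refl) ; (suc zero) _ q → ⊥-elim (q refl) ; (suc (suc i)) _ _ → refl } }
  transposed (there s) = record
    { lo = suc lo ; hi = suc hi ; next = cong suc next ; at-lo = at-lo ; at-hi = at-hi ; rise = rise
    ; other = λ { zero _ _ → refl ; (suc i) p q → other i (λ e → p (cong suc e)) (λ e → q (cong suc e)) } }
    where open Transposed (transposed s)

-- Decreasing integral covers of stable graphs

module IntegralCover where
  open import Data.Bool.Properties using (T-≡)
  import Data.Fin.Properties as Fin
  open import Data.Integer using (+_; +≤+)
  import Data.Integer.Properties as ℤ
  open import Data.Nat as ℕ using (ℕ; suc; _+_; _*_; _≤_; _<_; _⊓_; z≤n; s≤s⁻¹)
  open import Data.Nat.Properties
  open import Algebra.Properties.CommutativeSemigroup +-commutativeSemigroup using (xy∙z≈xz∙y)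
  open import Data.Rational using (ℚ; 1ℚ)
  import Data.Rational as ℚ
  import Data.Rational.Properties as ℚ
  open import Data.Vec using (Vec; []; _∷_; lookup; sum; map; replicate)
  open import Data.Vec.Properties using (lookup-map)
  open import Data.Vec.Relation.Unary.All as All using (All; []; _∷_)
  open import Function.Bundles using (Equivalence)
  open import Relation.Binary.Construct.Closure.ReflexiveTransitive using (ε; _◅_)
  open import Defs using (Graph4; Stable; FracMatchingNumber≤; ℕ→ℚ; increasing)
  open LinearInequalities using (dot)
  open FractionalCover using (fractional-cover; Cover)
  open RationalEmbedding
  open Sorting

  is-increasing : ∀ {n} {a b c d : Fin n} → toℕ a < toℕ b → toℕ b < toℕ c → toℕ c < toℕ d →
                  increasing (a , b , c , d) ≡ true
  is-increasing a<b b<c c<d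
    rewrite Equivalence.to T-≡ (<⇒<ᵇ a<b) | Equivalence.to T-≡ (<⇒<ᵇ b<c) | Equivalence.to T-≡ (<⇒<ᵇ c<d) = refl

  module _ {n : ℕ} (G : Graph4 n) where
    Covers : ℕ → Vec ℕ n → Set
    Covers D w = ∀ a b c d → toℕ a < toℕ b → toℕ b < toℕ c → toℕ c < toℕ d → G (a , b , c , d) ≡ true →
      D ≤ lookup w a + lookup w b + lookup w c + lookup w d

    private
      +-mono₄ : ∀ {a b c d a′ b′ c′ d′} → a ≤ a′ → b ≤ b′ → c ≤ c′ → d ≤ d′ → a + b + c + d ≤ a′ + b′ + c′ + d′
      +-mono₄ p q r s = +-mono-≤ (+-mono-≤ (+-mono-≤ p q) r) s

      below : ∀ {i j : Fin n} → toℕ i < toℕ j → i ≢ j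
      below i<j refl = <-irrefl refl i<j

      above : ∀ {i j : Fin n} → toℕ j < toℕ i → i ≢ j
      above j<i refl = <-irrefl refl j<i

    module _ (stable : Stable G) {D : ℕ} {w w′ : Vec ℕ n} (step : w ⇝ w′) (cover : Covers D w) where
      open Transposed (transposed step)

      private
        lo<hi : toℕ lo < toℕ hi
        lo<hi = ≤-reflexive (sym next)

        grows : ∀ {i} → i ≢ hi → lookup w i ≤ lookup w′ i
        grows {i} i≢hi with i Fin.≟ lo
        ... | yes refl = ≤-trans rise (≤-reflexive (sym at-lo))
        ... | no i≢lo  = ≤-reflexive (sym (other i i≢lo i≢hi))

        shift : Fin n → Fin n
        shift i with i Fin.≟ hi
        ... | yes _ = lo
        ... | no  _ = i

        lookup-shift : ∀ {i} → i ≢ lo → lookup w′ i ≡ lookup w (shift i)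
        lookup-shift {i} i≢lo with i Fin.≟ hi
        ... | yes refl = at-hi
        ... | no i≢hi  = other i i≢lo i≢hi

        shift-≤ : ∀ i → toℕ (shift i) ≤ toℕ i
        shift-≤ i with i Fin.≟ hi
        ... | yes refl = <⇒≤ lo<hi
        ... | no _     = ≤-refl

        shift-< : ∀ {i j} → i ≢ lo → toℕ i < toℕ j → toℕ (shift i) < toℕ (shift j)
        shift-< {i} {j} i≢lo i<j with i Fin.≟ hi | j Fin.≟ hi
        ... | yes refl | yes refl = ⊥-elim (<-irrefl refl i<j)
        ... | yes refl | no  _    = <-trans lo<hi i<j
        ... | no  _    | yes refl = ≤∧≢⇒< (s≤s⁻¹ (≤-trans i<j (≤-reflexive next))) (λ e → i≢lo (Fin.toℕ-injective e))
        ... | no  _    | no  _    = i<j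

        hi-absent : ∀ {a b c d} → a ≢ hi → b ≢ hi → c ≢ hi → d ≢ hi →
          D ≤ lookup w a + lookup w b + lookup w c + lookup w d →
          D ≤ lookup w′ a + lookup w′ b + lookup w′ c + lookup w′ d
        hi-absent p q r s le = ≤-trans le (+-mono₄ (grows p) (grows q) (grows r) (grows s))

        lo-absent : ∀ {a b c d} → a ≢ lo → b ≢ lo → c ≢ lo → d ≢ lo →
          toℕ a < toℕ b → toℕ b < toℕ c → toℕ c < toℕ d → G (a , b , c , d) ≡ true →
          D ≤ lookup w′ a + lookup w′ b + lookup w′ c + lookup w′ d
        lo-absent {a} {b} {c} {d} p q r s a<b b<c c<d g =
          ≤-trans (cover (shift a) (shift b) (shift c) (shift d) a<b′ b<c′ c<d′
              (stable a b c d _ _ _ _ (is-increasing {a = a} {b} {c} {d} a<b b<c c<d)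
                (is-increasing {a = shift a} {shift b} {shift c} {shift d} a<b′ b<c′ c<d′) g
                (shift-≤ a) (shift-≤ b) (shift-≤ c) (shift-≤ d)))
            (≤-reflexive (sym (cong₂ _+_ (cong₂ _+_ (cong₂ _+_ (lookup-shift p) (lookup-shift q)) (lookup-shift r)) (lookup-shift s))))
          where
          a<b′ = shift-< p a<b
          b<c′ = shift-< q b<c
          c<d′ = shift-< r c<d

        -- As lo and hi are neighbours, only the element just before hi in an increasing edge can be
        -- lo. This keeps the case distinction in `⇝-covers` short.
        gap-free : ∀ (i : Fin n) → toℕ lo < toℕ i → toℕ i < toℕ hi → ⊥
        gap-free _ lo<i i<hi = <⇒≱ lo<i (s≤s⁻¹ (≤-trans i<hi (≤-reflexive next)))

      -- An edge without hi does not lose weight, since lo has gained. An edge with both lo and hi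
      -- keeps its total. An edge with hi but not lo has the new weight that the edge with lo in
      -- place of hi had before, and that set is an edge by stability.
      ⇝-covers : Covers D w′
      ⇝-covers a b c d a<b b<c c<d g with a Fin.≟ hi | b Fin.≟ hi | c Fin.≟ hi | d Fin.≟ hi
      ... | no p | no q | no r | no s = hi-absent p q r s (cover a b c d a<b b<c c<d g)
      ... | yes refl | _ | _ | _ = lo-absent (above lo<hi) (above (<-trans lo<hi a<b))
              (above (<-trans lo<hi (<-trans a<b b<c))) (above (<-trans lo<hi (<-trans a<b (<-trans b<c c<d)))) a<b b<c c<d g
      ... | no _ | yes refl | _ | _ with a Fin.≟ lo
      ...   | no a≢lo  = lo-absent a≢lo (above lo<hi) (above (<-trans lo<hi b<c)) (above (<-trans lo<hi (<-trans b<c c<d))) a<b b<c c<d g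
      ...   | yes refl = ≤-trans (cover a b c d a<b b<c c<d g) (≤-reflexive (sym (cong₂ _+_ (cong₂ _+_
                (trans (cong₂ _+_ at-lo at-hi) (+-comm (lookup w hi) (lookup w lo)))
                (other c (above (<-trans a<b b<c)) (above b<c)))
                (other d (above (<-trans a<b (<-trans b<c c<d))) (above (<-trans b<c c<d))))))
      ⇝-covers a b c d a<b b<c c<d g | no a≢hi | no _ | yes refl | _ with b Fin.≟ lo
      ...   | no b≢lo  = lo-absent (λ { refl → gap-free b a<b b<c }) b≢lo (above lo<hi) (above (<-trans lo<hi c<d)) a<b b<c c<d g
      ...   | yes refl = ≤-trans (cover a b c d a<b b<c c<d g) (≤-reflexive (sym (cong₂ _+_
                (trans (cong₂ _+_ (cong₂ _+_ (other a (below a<b) a≢hi) at-lo) at-hi)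
                  (xy∙z≈xz∙y (lookup w a) (lookup w hi) (lookup w lo)))
                (other d (above (<-trans b<c c<d)) (above c<d)))))
      ⇝-covers a b c d a<b b<c c<d g | no a≢hi | no b≢hi | no _ | yes refl with c Fin.≟ lo
      ...   | no c≢lo  = lo-absent (λ { refl → gap-free b a<b (<-trans b<c c<d) }) (λ { refl → gap-free c b<c c<d }) c≢lo (above lo<hi)
                a<b b<c c<d g
      ...   | yes refl = ≤-trans (cover a b c d a<b b<c c<d g) (≤-reflexive (sym
                (trans (cong₂ _+_ (cong₂ _+_ (cong₂ _+_ (other a (below (<-trans a<b b<c)) a≢hi) (other b (below b<c) b≢hi)) at-lo) at-hi)
                  (xy∙z≈xz∙y (lookup w a + lookup w b) (lookup w hi) (lookup w lo)))))

    ⇝*-covers : Stable G → ∀ {D} {w w′ : Vec ℕ n} → w ⇝* w′ → Covers D w → Covers D w′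
    ⇝*-covers stable ε        cover = cover
    ⇝*-covers stable (s ◅ ss) cover = ⇝*-covers stable ss (⇝-covers stable s cover)

    -- A weight of at least D still covers its edges alone after truncation; otherwise nothing on
    -- the edge changes. This provides the bound by 1 that the slack inequality needs and duality
    -- does not give.
    truncate-covers : ∀ {D w} → Covers D w → Covers D (map (_⊓ D) w)
    truncate-covers {D} {w} cover a b c d a<b b<c c<d g
      rewrite lookup-map a (_⊓ D) w | lookup-map b (_⊓ D) w | lookup-map c (_⊓ D) w | lookup-map d (_⊓ D) w
      = truncated {lookup w a} {lookup w b} {lookup w c} {lookup w d} (cover a b c d a<b b<c c<d g)
      where
      truncated : ∀ {x y z u} → D ≤ x + y + z + u → D ≤ x ⊓ D + y ⊓ D + z ⊓ D + u ⊓ D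
      truncated {x} {y} {z} {u} le with ≤-total x D | ≤-total y D | ≤-total z D | ≤-total u D
      ... | inj₂ D≤x | _ | _ | _ rewrite m≥n⇒m⊓n≡n D≤x =
        ≤-trans (m≤m+n D (y ⊓ D)) (≤-trans (m≤m+n _ (z ⊓ D)) (m≤m+n _ (u ⊓ D)))
      ... | _ | inj₂ D≤y | _ | _ rewrite m≥n⇒m⊓n≡n D≤y =
        ≤-trans (m≤n+m D (x ⊓ D)) (≤-trans (m≤m+n _ (z ⊓ D)) (m≤m+n _ (u ⊓ D)))
      ... | _ | _ | inj₂ D≤z | _ rewrite m≥n⇒m⊓n≡n D≤z = ≤-trans (m≤n+m D (x ⊓ D + y ⊓ D)) (m≤m+n _ (u ⊓ D))
      ... | _ | _ | _ | inj₂ D≤u rewrite m≥n⇒m⊓n≡n D≤u = m≤n+m D (x ⊓ D + y ⊓ D + z ⊓ D)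
      ... | inj₁ p | inj₁ q | inj₁ r | inj₁ s
        rewrite m≤n⇒m⊓n≡m p | m≤n⇒m⊓n≡m q | m≤n⇒m⊓n≡m r | m≤n⇒m⊓n≡m s = le

  sum-truncate : ∀ {n} D (w : Vec ℕ n) → sum (map (_⊓ D) w) ≤ sum w
  sum-truncate D []      = z≤n
  sum-truncate D (x ∷ w) = +-mono-≤ (m⊓n≤m x D) (sum-truncate D w)

  all-truncated : ∀ {n} D (w : Vec ℕ n) → All (_≤ D) (map (_⊓ D) w)
  all-truncated D []      = []
  all-truncated D (x ∷ w) = m⊓n≤n x D ∷ all-truncated D w

  ⇝*-sum : ∀ {n} {w w′ : Vec ℕ n} → w ⇝* w′ → sum w′ ≡ sum w
  ⇝*-sum ε        = refl
  ⇝*-sum (s ◅ ss) = trans (⇝*-sum ss) (⇝-sum s)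

  dot-ones : ∀ {n} (w : Vec ℚ n) (W : Vec ℕ n) t → (∀ v → toℚ (+ lookup W v) ≡ lookup w v ℚ.* t) →
             toℚ (+ sum W) ≡ dot (replicate n 1ℚ) w ℚ.* t
  dot-ones []      []      t eq = sym (ℚ.*-zeroˡ t)
  dot-ones (x ∷ w) (k ∷ W) t eq = trans (toℚ-+ (+ k) (+ sum W))
    (trans (cong₂ ℚ._+_ (trans (eq zero) (cong (ℚ._* t) (sym (ℚ.*-identityˡ x)))) (dot-ones w W t (λ v → eq (suc v))))
      (sym (ℚ.*-distribʳ-+ t (1ℚ ℚ.* x) (dot (replicate _ 1ℚ) w))))

  record DecreasingCover {n : ℕ} (G : Graph4 n) (s : ℕ) : Set where
    field
      denominator : ℕ
      weights     : Vec ℕ n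
      0<denominator : 0 < denominator
      bounded     : All (_≤ denominator) weights
      decreasing  : Decreasing weights
      total       : sum weights ≤ s * denominator
      covers      : Covers G denominator weights

  decreasing-cover : ∀ {n} (G : Graph4 n) s → Stable G → FracMatchingNumber≤ G (ℕ→ℚ s) → DecreasingCover G s
  decreasing-cover {n} G s stable ν≤s = from-cover (fractional-cover G (ℕ→ℚ s) (toℚ-mono {+ 0} {+ s} (+≤+ z≤n)) ν≤s)
    where
    from-integral : ∀ D (W : Vec ℕ n) → 0 < D → sum W ≤ s * D → Covers G D W → DecreasingCover G s
    from-integral D W 0<D ΣW≤ cover with sort (map (_⊓ D) W)
    ... | w , steps , dec = record
      { denominator = D ; weights = w ; 0<denominator = 0<D ; decreasing = dec
      ; bounded = ⇝*-All steps (all-truncated D W)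
      ; total   = ≤-trans (≤-reflexive (⇝*-sum steps)) (≤-trans (sum-truncate D W) ΣW≤)
      ; covers  = ⇝*-covers G stable steps (truncate-covers G {D} {W} cover)
      }

    from-cover : ∃ (Cover G (ℕ→ℚ s) (toℚ-mono {+ 0} {+ s} (+≤+ z≤n)) ν≤s) → DecreasingCover G s
    from-cover (w , 0≤w , Σw≤s , cov) = from-cleared (clear-denominators w 0≤w)
      where
      from-cleared : (∃ λ D → ∃ λ W → 0 < D × (∀ v → toℚ (+ lookup W v) ≡ lookup w v ℚ.* toℚ (+ D))) → DecreasingCover G s
      from-cleared (D , W , 0<D , eq) = from-integral D W 0<D ΣW≤sD covered
        where
        instance
          0≤D : ℚ.NonNegative (toℚ (+ D))
          0≤D = ℚ.nonNegative (toℚ-mono {+ 0} {+ D} (+≤+ z≤n))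

        ΣW≤sD : sum W ≤ s * D
        ΣW≤sD = ℤ.drop‿+≤+ (toℚ-cancel (ℚ.≤-trans (ℚ.≤-reflexive (dot-ones w W (toℚ (+ D)) eq))
          (ℚ.≤-trans (ℚ.*-monoʳ-≤-nonNeg (toℚ (+ D)) Σw≤s)
            (ℚ.≤-reflexive (sym (trans (cong toℚ (ℤ.pos-* s D)) (toℚ-* (+ s) (+ D))))))))

        covered : Covers G D W
        covered a b c d a<b b<c c<d g = ℤ.drop‿+≤+ (toℚ-cancel (ℚ.≤-trans (ℚ.≤-reflexive (sym (ℚ.*-identityˡ (toℚ (+ D)))))
          (ℚ.≤-trans (ℚ.*-monoʳ-≤-nonNeg (toℚ (+ D)) (cov a b c d (is-increasing {a = a} {b} {c} {d} a<b b<c c<d) g))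
            (ℚ.≤-reflexive (sym sums)))))
          where
          t = toℚ (+ D)
          x = lookup w a
          y = lookup w b
          z = lookup w c
          u = lookup w d
          sums : toℚ (+ (lookup W a + lookup W b + lookup W c + lookup W d)) ≡ (x ℚ.+ y ℚ.+ z ℚ.+ u) ℚ.* t
          sums = trans (toℚ-+ (+ (lookup W a + lookup W b + lookup W c)) (+ lookup W d)) (trans (cong₂ ℚ._+_
            (trans (toℚ-+ (+ (lookup W a + lookup W b)) (+ lookup W c)) (trans (cong₂ ℚ._+_
            (trans (toℚ-+ (+ lookup W a) (+ lookup W b)) (trans (cong₂ ℚ._+_ (eq a) (eq b)) (sym (ℚ.*-distribʳ-+ t x y))))
            (eq c)) (sym (ℚ.*-distribʳ-+ t (x ℚ.+ y) z)))) (eq d)) (sym (ℚ.*-distribʳ-+ t (x ℚ.+ y ℚ.+ z) u)))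

-- Edge numbers as sums over quadruples

module EdgeCounts where
  open import Data.Bool.Properties using (T-≡)
  import Data.Fin.Properties as Fin
  open import Data.Integer hiding (suc; _⊔_; _≤ᵇ_)
  open import Data.Integer.Properties
  open import Data.Integer.Tactic.RingSolver using (solve-∀)
  open import Data.List using (List; []; _∷_; _++_; length; filterᵇ; concatMap; allFin; tabulate; map)
  import Data.List.Properties as List
  open import Data.Nat as ℕ using (ℕ; zero; suc; z≤n; _⊔_; _≤ᵇ_; _<ᵇ_)
  import Data.Nat.Properties as ℕ
  open import Data.Vec using (Vec; lookup)
  import Data.Vec as Vec
  import Data.Vec.Relation.Unary.All as Vecᴬ
  open import Data.Vec.Membership.Propositional.Properties using (∈-lookup)
  open import Function.Bundles using (Equivalence)
  open import Algebra.Properties.CommutativeSemigroup ℕ.+-commutativeSemigroup using (xy∙z≈xz∙y)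
  open import Defs using (Quad; Graph4; allQuads; increasing; e; H₁; missing)
  open Polynomials using (*-nonNeg)
  open TupleSums
  open IncreasingTuples
  open WeightedCertificate
  open Sorting
  open IntegralCover

  module _ {A : Set} (p : A → Bool) where
    count : List A → ℤ
    count xs = + length (filterᵇ p xs)

    count-∷ : ∀ x xs → count (x ∷ xs) ≡ ⟪ p x ⟫ + count xs
    count-∷ x xs with p x
    ... | true  = refl
    ... | false = sym (+-identityˡ (count xs))

    count-++ : ∀ xs ys → count (xs ++ ys) ≡ count xs + count ys
    count-++ []       ys = sym (+-identityˡ (count ys))
    count-++ (x ∷ xs) ys = trans (count-∷ x (xs ++ ys)) (trans (cong (λ z → ⟪ p x ⟫ + z) (count-++ xs ys))
      (trans (sym (+-assoc ⟪ p x ⟫ (count xs) (count ys))) (cong (_+ count ys) (sym (count-∷ x xs)))))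

    count-concatMap : ∀ {n} {B : Set} (f : B → List A) (g : Fin n → B) →
                      count (concatMap f (tabulate g)) ≡ sum (λ i → count (f (g i)))
    count-concatMap {zero}  f g = refl
    count-concatMap {suc n} f g = trans (count-++ (f (g zero)) (concatMap f (tabulate λ i → g (suc i))))
      (cong (λ z → count (f (g zero)) + z) (count-concatMap f (λ i → g (suc i))))

    count-map : ∀ {n} {B : Set} (f : B → A) (g : Fin n → B) →
                count (map f (tabulate g)) ≡ sum (λ i → ⟪ p (f (g i)) ⟫)
    count-map {zero}  f g = refl
    count-map {suc n} f g = trans (count-∷ (f (g zero)) (map f (tabulate λ i → g (suc i))))
      (cong (λ z → ⟪ p (f (g zero)) ⟫ + z) (count-map f (λ i → g (suc i))))

  filter-filter : ∀ {A : Set} (p q : A → Bool) xs → filterᵇ p (filterᵇ q xs) ≡ filterᵇ (λ x → q x ∧ p x) xs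
  filter-filter p q [] = refl
  filter-filter p q (x ∷ xs) with q x
  ... | false = filter-filter p q xs
  ... | true with p x
  ...   | true  = cong (x ∷_) (filter-filter p q xs)
  ...   | false = filter-filter p q xs

  -- Lengths of filtered lists become sums of indicators over all ordered quadruples, where
  -- permuting coordinates is available.
  count-quads : ∀ {n} (p : Quad n → Bool) →
    + length (filterᵇ p (allQuads n)) ≡ ∑₄ (λ a b c d → ⟪ increasing (a , b , c , d) ∧ p (a , b , c , d) ⟫)
  count-quads {n} p = trans (cong (λ xs → + length xs) (filter-filter p increasing
      (concatMap (λ a → concatMap (λ b → concatMap (λ c → map (λ d → (a , b , c , d)) (allFin n)) (allFin n)) (allFin n)) (allFin n))))
    (trans (count-concatMap r (λ a → concatMap (λ b → concatMap (λ c → map (λ d → (a , b , c , d)) (allFin n)) (allFin n)) (allFin n)) (λ i → i))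
    (sum-cong-≗ λ a → trans (count-concatMap r (λ b → concatMap (λ c → map (λ d → (a , b , c , d)) (allFin n)) (allFin n)) (λ i → i))
    (sum-cong-≗ λ b → trans (count-concatMap r (λ c → map (λ d → (a , b , c , d)) (allFin n)) (λ i → i))
    (sum-cong-≗ λ c → count-map r (λ d → (a , b , c , d)) (λ i → i)))))
    where
    r : Quad n → Bool
    r q = increasing q ∧ p q

  sum-complement : ∀ {n} (f : Fin n → ℤ) → sum (λ v → 1ℤ - f v) ≡ + n - sum f
  sum-complement {zero}  f = refl
  sum-complement {suc n} f = trans (cong (λ z → (1ℤ - f zero) + z) (sum-complement (λ i → f (suc i))))
    (regroup (f zero) (+ n) (sum λ i → f (suc i)))
    where
    regroup : ∀ x m y → (1ℤ - x) + (m - y) ≡ (1ℤ + m) - (x + y)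
    regroup = solve-∀

  ∑₄-constant : ∀ n → ∑₄ {n} (λ _ _ _ _ → 1ℤ) ≡ + n * + n * + n * + n
  ∑₄-constant n = trans (∑₄-product {n} (λ _ → 1ℤ)) (cong (λ x → x * x * x * x) (trans (sum-constant n 1ℤ) (*-identityʳ (+ n))))

  ∑₄-complement : ∀ {n} (f : Tuple n ℤ) → ∑₄ (λ a b c d → 1ℤ - f a b c d) ≡ + n * + n * + n * + n - ∑₄ f
  ∑₄-complement {n} f = trans (∑₄-+ {n} (λ _ _ _ _ → 1ℤ) (λ a b c d → - f a b c d))
    (cong₂ _+_ (∑₄-constant n) (trans (∑₄-cong λ a b c d → sym (-1*i≡-i (f a b c d)))
      (trans (∑₄-* -1ℤ f) (-1*i≡-i (∑₄ f)))))

  isLight-01 : ∀ h a b c d → 0ℤ ≤ isLight h a b c d × isLight h a b c d ≤ 1ℤ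
  isLight-01 h a b c d with h ≤ᵇ a ℕ.+ b ℕ.+ c ℕ.+ d
  ... | true  = ≤-refl , +≤+ z≤n
  ... | false = +≤+ z≤n , ≤-refl

  isLight-sum : ∀ h {a b c d a′ b′ c′ d′} → a ℕ.+ b ℕ.+ c ℕ.+ d ≡ a′ ℕ.+ b′ ℕ.+ c′ ℕ.+ d′ →
                isLight h a b c d ≡ isLight h a′ b′ c′ d′
  isLight-sum h eq = cong (λ s → if h ≤ᵇ s then 0ℤ else 1ℤ) eq

  T-⟪⟫ : ∀ {b} → T b → ⟪ b ⟫ ≡ 1ℤ
  T-⟪⟫ {true} _ = refl

  ⟪⟫-if : ∀ b {x} → 0ℤ ≤ x → (T b → 1ℤ ≤ x) → ⟪ b ⟫ ≤ x
  ⟪⟫-if true  _   le = le _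
  ⟪⟫-if false 0≤x _  = 0≤x

  ⟪⟫-∧ : ∀ p q → ⟪ p ∧ q ⟫ ≡ ⟪ p ⟫ * ⟪ q ⟫
  ⟪⟫-∧ true  q = sym (*-identityˡ ⟪ q ⟫)
  ⟪⟫-∧ false q = sym (*-zeroˡ ⟪ q ⟫)

  module _ {n : ℕ} (s : ℕ) (s≤n : s ℕ.≤ n) where
    private
      outside : Fin n → ℤ
      outside v = 1ℤ - ⟪ toℕ v <ᵇ s ⟫

      outside-01 : ∀ v → 0ℤ ≤ outside v × outside v ≤ 1ℤ
      outside-01 v with toℕ v <ᵇ s
      ... | true  = ≤-refl , +≤+ z≤n
      ... | false = +≤+ z≤n , ≤-refl

    sum-inside : sum {n} (λ v → ⟪ toℕ v <ᵇ s ⟫) ≡ + s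
    sum-inside = go s≤n
      where
      go : ∀ {n s} → s ℕ.≤ n → sum {n} (λ v → ⟪ toℕ v <ᵇ s ⟫) ≡ + s
      go {n}     {zero}  _       = sum-zero {n} λ _ → refl
      go {suc n} {suc s} (ℕ.s≤s le) = cong (λ z → 1ℤ + z) (go {n} {s} le)

    private
      sum-outside : sum outside ≡ + n - + s
      sum-outside = trans (sum-complement {n} (λ v → ⟪ toℕ v <ᵇ s ⟫)) (cong (λ x → + n - x) sum-inside)

      *-01 : ∀ {x y} → 0ℤ ≤ x × x ≤ 1ℤ → 0ℤ ≤ y × y ≤ 1ℤ → 0ℤ ≤ x * y × x * y ≤ 1ℤ
      *-01 {x} {y} (0≤x , x≤1) (0≤y , y≤1) = *-nonNeg 0≤x 0≤y ,
        ≤-trans (*-monoˡ-≤-nonNeg x {{nonNegative 0≤x}} y≤1) (≤-trans (≤-reflexive (*-identityʳ x)) x≤1)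

      meets : Tuple n ℤ
      meets a b c d = 1ℤ - outside a * outside b * outside c * outside d

      swap₁₂ : ∀ x y z u → 1ℤ - y * x * z * u ≡ 1ℤ - x * y * z * u
      swap₁₂ = solve-∀
      swap₂₃ : ∀ x y z u → 1ℤ - x * z * y * u ≡ 1ℤ - x * y * z * u
      swap₂₃ = solve-∀
      swap₃₄ : ∀ x y z u → 1ℤ - x * y * u * z ≡ 1ℤ - x * y * z * u
      swap₃₄ = solve-∀

    -- The test of the smallest element is replaced by a symmetric one, that not all four elements
    -- lie outside [s]. This makes the comparison with all ordered quadruples applicable.
    H₁-count : + 24 * ∑₄ (λ a b c d → ⟪ increasing (a , b , c , d) ∧ H₁ n s (a , b , c , d) ⟫) ≤
               + n * + n * + n * + n - (+ n - + s) * (+ n - + s) * (+ n - + s) * (+ n - + s)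
    H₁-count = ≤-trans (*-monoˡ-≤-nonNeg (+ 24) (∑₄-mono pointwise))
      (≤-trans (24*∑-increasing≤∑ meets nonneg
          (λ a b c d → swap₁₂ (outside a) (outside b) (outside c) (outside d))
          (λ a b c d → swap₂₃ (outside a) (outside b) (outside c) (outside d))
          (λ a b c d → swap₃₄ (outside a) (outside b) (outside c) (outside d)))
        (≤-reflexive (trans (∑₄-complement (λ a b c d → outside a * outside b * outside c * outside d))
          (cong (λ x → + n * + n * + n * + n - x) (trans (∑₄-product outside) (cong (λ x → x * x * x * x) sum-outside))))))
      where
      nonneg : ∀ a b c d → 0ℤ ≤ meets a b c d
      nonneg a b c d = i≤j⇒0≤j-i (proj₂ (*-01 (*-01 (*-01 (outside-01 a) (outside-01 b)) (outside-01 c)) (outside-01 d)))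
      pointwise : ∀ a b c d → ⟪ increasing (a , b , c , d) ∧ (toℕ a <ᵇ s) ⟫ ≤ ⟪ chain₄ a b c d ⟫ * meets a b c d
      pointwise a b c d = ≤-trans (≤-reflexive (⟪⟫-∧ (increasing (a , b , c , d)) (toℕ a <ᵇ s)))
        (*-monoˡ-≤-nonNeg ⟪ chain₄ a b c d ⟫ {{nonNegative (⟪⟫-nonNeg (chain₄ a b c d))}}
          (⟪⟫-if (toℕ a <ᵇ s) (nonneg a b c d) λ a<s → ≤-reflexive (sym (absorb
            (trans (cong (λ x → 1ℤ - x) (T-⟪⟫ a<s)) refl) (outside b) (outside c) (outside d)))))
        where
        absorb : ∀ {x} → x ≡ 0ℤ → ∀ y z u → 1ℤ - x * y * z * u ≡ 1ℤ
        absorb refl = zero-product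
          where
          zero-product : ∀ y z u → 1ℤ - 0ℤ * y * z * u ≡ 1ℤ
          zero-product = solve-∀

  module _ {n : ℕ} (G : Graph4 n) (s : ℕ) where
    escaping : Tuple n Bool
    escaping a b c d = increasing (a , b , c , d) ∧ (G (a , b , c , d) ∧ not (toℕ a <ᵇ s))

    -- For sets, |H ∖ G| + |G| = |H| + |G ∖ H|. Since G has almost as many edges as H₁, closeness
    -- reduces to bounding the edges of G that escape from H₁.
    missing-count : + missing G (H₁ n s) + + e G ≡
      ∑₄ (λ a b c d → ⟪ increasing (a , b , c , d) ∧ H₁ n s (a , b , c , d) ⟫) + ∑₄ (λ a b c d → ⟪ escaping a b c d ⟫)
    missing-count = trans (cong₂ _+_ (count-quads (λ q → H₁ n s q ∧ not (G q))) (count-quads G))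
      (trans (sym (∑₄-+ (λ a b c d → ⟪ increasing (a , b , c , d) ∧ ((toℕ a <ᵇ s) ∧ not (G (a , b , c , d))) ⟫)
                        (λ a b c d → ⟪ increasing (a , b , c , d) ∧ G (a , b , c , d) ⟫)))
        (trans (∑₄-cong λ a b c d → exchange (increasing (a , b , c , d)) (toℕ a <ᵇ s) (G (a , b , c , d)))
          (∑₄-+ (λ a b c d → ⟪ increasing (a , b , c , d) ∧ (toℕ a <ᵇ s) ⟫) (λ a b c d → ⟪ escaping a b c d ⟫))))
      where
      exchange : ∀ i h g → ⟪ i ∧ (h ∧ not g) ⟫ + ⟪ i ∧ g ⟫ ≡ ⟪ i ∧ h ⟫ + ⟪ i ∧ (g ∧ not h) ⟫
      exchange false _     _     = refl
      exchange true  false false = refl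
      exchange true  false true  = refl
      exchange true  true  false = refl
      exchange true  true  true  = refl

    module _ (cover : DecreasingCover G s) where
      open DecreasingCover cover renaming (denominator to D)

      w : Fin n → ℕ
      w = lookup weights

      w≤D : ∀ v → w v ℕ.≤ D
      w≤D v = Vecᴬ.lookup bounded (∈-lookup v weights)

      lights : ℤ
      lights = ∑₄ λ a b c d → isLight D (w a) (w b) (w c) (w d)

      private
        edge-heavy : ∀ a b c d → T (increasing (a , b , c , d) ∧ G (a , b , c , d)) → D ℕ.≤ w a ℕ.+ w b ℕ.+ w c ℕ.+ w d
        edge-heavy a b c d p with ∧-elim {increasing (a , b , c , d)} p
        ... | inc , g with chain₄-elim {a = a} {b} {c} {d} inc
        ...   | a<b , b<c , c<d = covers a b c d a<b b<c c<d (Equivalence.to T-≡ g)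

        heavy : Tuple n ℤ
        heavy a b c d = 1ℤ - isLight D (w a) (w b) (w c) (w d)

      -- Every edge is heavy by `covers`, and heaviness is symmetric. Read the other way, many edges
      -- mean few light quadruples.
      edge-count : + 24 * + e G ≤ + n * + n * + n * + n - lights
      edge-count = ≤-trans (*-monoˡ-≤-nonNeg (+ 24) (≤-trans (≤-reflexive (count-quads G)) (∑₄-mono pointwise)))
        (≤-trans (24*∑-increasing≤∑ heavy nonneg
            (λ a b c d → cong (λ x → 1ℤ - x) (isLight-sum D {w b} {w a} {w c} {w d} {w a} {w b} {w c} {w d}
              (cong (λ x → x ℕ.+ w c ℕ.+ w d) (ℕ.+-comm (w b) (w a)))))
            (λ a b c d → cong (λ x → 1ℤ - x) (isLight-sum D {w a} {w c} {w b} {w d} {w a} {w b} {w c} {w d}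
              (cong (ℕ._+ w d) (xy∙z≈xz∙y (w a) (w c) (w b)))))
            (λ a b c d → cong (λ x → 1ℤ - x) (isLight-sum D {w a} {w b} {w d} {w c} {w a} {w b} {w c} {w d}
              (xy∙z≈xz∙y (w a ℕ.+ w b) (w d) (w c)))))
          (≤-reflexive (∑₄-complement (λ a b c d → isLight D (w a) (w b) (w c) (w d)))))
        where
        nonneg : ∀ a b c d → 0ℤ ≤ heavy a b c d
        nonneg a b c d = i≤j⇒0≤j-i (proj₂ (isLight-01 D (w a) (w b) (w c) (w d)))
        pointwise : ∀ a b c d → ⟪ increasing (a , b , c , d) ∧ G (a , b , c , d) ⟫ ≤ ⟪ chain₄ a b c d ⟫ * heavy a b c d
        pointwise a b c d = ⟪⟫-if (increasing (a , b , c , d) ∧ G (a , b , c , d))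
          (*-nonNeg (⟪⟫-nonNeg (chain₄ a b c d)) (nonneg a b c d)) λ p → ≤-reflexive (sym
            (trans (cong₂ (λ x y → x * (1ℤ - y)) (T-⟪⟫ (proj₁ (∧-elim {increasing (a , b , c , d)} p)))
              (isLight-full D (w a) (w b) (w c) (w d) (edge-heavy a b c d p))) refl))

      -- With precision 1/(m + 1): a vertex is close to full when its weight exceeds (m/(m + 1))D.
      module _ (m : ℕ) where
        slim : Fin n → Bool
        slim v = suc m ℕ.* w v ≤ᵇ m ℕ.* D

        slim-escapes fat-escapes : ℤ
        slim-escapes = ∑₄ λ a b c d → ⟪ escaping a b c d ∧ slim a ⟫
        fat-escapes  = ∑₄ λ a b c d → ⟪ escaping a b c d ∧ not (slim a) ⟫

        escapes-split : ∑₄ (λ a b c d → ⟪ escaping a b c d ⟫) ≡ slim-escapes + fat-escapes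
        escapes-split = trans (∑₄-cong λ a b c d → cases (escaping a b c d) (slim a))
          (∑₄-+ (λ a b c d → ⟪ escaping a b c d ∧ slim a ⟫) (λ a b c d → ⟪ escaping a b c d ∧ not (slim a) ⟫))
          where
          cases : ∀ p q → ⟪ p ⟫ ≡ ⟪ p ∧ q ⟫ + ⟪ p ∧ not q ⟫
          cases false _     = refl
          cases true  false = refl
          cases true  true  = refl

-- Edges that avoid [s]

module Escapes where
  open import Data.Bool.Properties using (T?)
  import Data.Fin.Properties as Fin
  open import Data.Integer hiding (suc; _⊔_; _≤ᵇ_)
  open import Data.Integer.Properties
  open import Data.Integer.Tactic.RingSolver using (solve-∀)
  open import Data.Nat as ℕ using (ℕ; zero; suc; z≤n; _⊔_; _≤ᵇ_; _<ᵇ_)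
  import Data.Nat.Properties as ℕ
  open import Data.Vec using (Vec; []; _∷_; lookup)
  import Data.Vec as Vec
  open import Defs using (Graph4; increasing)
  open Polynomials using (*-nonNeg; *-pos)
  open TupleSums
  open IncreasingTuples
  open WeightedCertificate
  open Sorting
  open IntegralCover
  open EdgeCounts

  sum-lookup : ∀ {n} (W : Vec ℕ n) → sum (λ v → + lookup W v) ≡ + Vec.sum W
  sum-lookup []      = refl
  sum-lookup (x ∷ W) = cong (λ z → + x + z) (sum-lookup W)

  private
    T-not : ∀ {b} → T (not b) → ¬ T b
    T-not {false} _ ()

    not-T : ∀ {b} → ¬ T b → T (not b)
    not-T {false} _ = _
    not-T {true}  f = ⊥-elim (f _)

    scaled-deficit : ∀ c k x D → 0ℤ ≤ c → 0ℤ ≤ D → D ≤ k * x → c * (D * D * D * D) ≤ k * (c * (x * (D * D * D)))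
    scaled-deficit c k x D 0≤c 0≤D le = ≤-trans (≤-reflexive (left c D)) (≤-trans
      (*-monoˡ-≤-nonNeg (c * (D * D * D)) {{nonNegative (*-nonNeg 0≤c (*-nonNeg (*-nonNeg 0≤D 0≤D) 0≤D))}} le)
      (≤-reflexive (right c k x D)))
      where
      left : ∀ c D → c * (D * D * D * D) ≡ c * (D * D * D) * D
      left = solve-∀
      right : ∀ c k x D → c * (D * D * D) * (k * x) ≡ k * (c * (x * (D * D * D)))
      right = solve-∀

    fourth-power-mono : ∀ {x y} → 0ℤ ≤ x → x ≤ y → x * x * x * x ≤ y * y * y * y
    fourth-power-mono {x} {y} 0≤x x≤y = times (times (times x≤y (0≤x) ) (sq 0≤x)) (*-nonNeg (sq 0≤x) 0≤x)
      where
      0≤y : 0ℤ ≤ y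
      0≤y = ≤-trans 0≤x x≤y
      sq : ∀ {z} → 0ℤ ≤ z → 0ℤ ≤ z * z
      sq p = *-nonNeg p p
      times : ∀ {u v} → u ≤ v → 0ℤ ≤ u → u * x ≤ v * y
      times {u} {v} u≤v 0≤u = ≤-trans (*-monoʳ-≤-nonNeg x {{nonNegative 0≤x}} u≤v)
        (*-monoˡ-≤-nonNeg v {{nonNegative (≤-trans 0≤u u≤v)}} x≤y)

  module _ {n : ℕ} (G : Graph4 n) (s : ℕ) (s≤n : s ℕ.≤ n) (light : 249 ℕ.* s ℕ.≤ 50 ℕ.* n)
           (cover : DecreasingCover G s) (m : ℕ) where
    open DecreasingCover cover renaming (denominator to D)

    private
      W : Fin n → ℕ
      W = w G s cover
      L : ℤ
      L = lights G s cover
      0≤D : 0ℤ ≤ + D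
      0≤D = +≤+ z≤n
      Y : Fin n → Bool
      Y = slim G s cover m

      -- Weights decrease, so the first vertex is the heaviest of its edge. If it is slim, the
      -- maximum stays below D by at least D/(m + 1), and the slack is bounded below accordingly.
      bonus-≥ : ∀ a b c d → T (escaping G s a b c d) → T (Y a) →
                + 48 * (+ D * + D * + D * + D) ≤ + suc m * bonus D (W a) (W b) (W c) (W d)
      bonus-≥ a b c d esc slim-a with ∧-elim {increasing (a , b , c , d)} esc
      ... | inc , rest with chain₄-elim {a = a} {b} {c} {d} inc | ∧-elim {G (a , b , c , d)} rest
      ... | a<b , b<c , c<d | g , _ = ≤-trans
          (scaled-deficit (+ 48) (+ suc m) (+ D - + W a) (+ D) (+≤+ z≤n) 0≤D deficit)
          (≤-reflexive (cong (λ x → + suc m * x) (sym value)))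
        where
        b≤a = decreasing-lookup decreasing a b (ℕ.<⇒≤ a<b)
        c≤a = decreasing-lookup decreasing a c (ℕ.<⇒≤ (ℕ.<-trans a<b b<c))
        d≤a = decreasing-lookup decreasing a d (ℕ.<⇒≤ (ℕ.<-trans a<b (ℕ.<-trans b<c c<d)))
        max≡ : W a ⊔ W b ⊔ W c ⊔ W d ≡ W a
        max≡ = trans (cong (λ x → x ⊔ W c ⊔ W d) (ℕ.m≥n⇒m⊔n≡m b≤a))
          (trans (cong (_⊔ W d) (ℕ.m≥n⇒m⊔n≡m c≤a)) (ℕ.m≥n⇒m⊔n≡m d≤a))
        full : (D ≤ᵇ W a ℕ.+ W b ℕ.+ W c ℕ.+ W d) ≡ true
        full = T-true (ℕ.≤⇒≤ᵇ (covers a b c d a<b b<c c<d (T-true g)))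
          where
          T-true : ∀ {b} → T b → b ≡ true
          T-true {true} _ = refl
        value : bonus D (W a) (W b) (W c) (W d) ≡ + 48 * ((+ D - + W a) * (+ D * + D * + D))
        value = cong₂ (λ e x → (if e then + 48 else 0ℤ) * ((+ D - + x) * (+ D * + D * + D))) full max≡
        deficit : + D ≤ + suc m * (+ D - + W a)
        deficit = ≤-trans (≤-reflexive (expand (+ m) (+ D)))
          (≤-trans (+-monoʳ-≤ ((1ℤ + + m) * + D) (neg-mono-≤ (≤-trans (≤-reflexive (sym (pos-* (suc m) (W a))))
            (≤-trans (+≤+ (ℕ.≤ᵇ⇒≤ (suc m ℕ.* W a) (m ℕ.* D) slim-a)) (≤-reflexive (pos-* m D))))))
            (≤-reflexive (collect (+ m) (+ D) (+ W a))))
          where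
          expand : ∀ m D → D ≡ (1ℤ + m) * D - m * D
          expand = solve-∀
          collect : ∀ m D x → (1ℤ + m) * D - (1ℤ + m) * x ≡ (1ℤ + m) * (D - x)
          collect = solve-∀

      slim≤bonus : + 48 * (+ D * + D * + D * + D) * slim-escapes G s cover m ≤
                   + suc m * ∑₄ (λ a b c d → bonus D (W a) (W b) (W c) (W d))
      slim≤bonus = ≤-trans (≤-reflexive (sym (∑₄-* (+ 48 * (+ D * + D * + D * + D)) (λ a b c d → ⟪ escaping G s a b c d ∧ Y a ⟫))))
        (≤-trans (∑₄-mono λ a b c d → gate (+ 48 * (+ D * + D * + D * + D)) (escaping G s a b c d ∧ Y a)
            (*-nonNeg {+ suc m} (+≤+ z≤n) (bonus-nonNeg D (W a) (W b) (W c) (W d)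
              (w≤D G s cover a) (w≤D G s cover b) (w≤D G s cover c) (w≤D G s cover d)))
            (λ p → bonus-≥ a b c d (proj₁ (∧-elim {escaping G s a b c d} p)) (proj₂ (∧-elim {escaping G s a b c d} p))))
          (≤-reflexive (∑₄-* (+ suc m) (λ a b c d → bonus D (W a) (W b) (W c) (W d)))))
        where
        gate : ∀ x b {y} → 0ℤ ≤ y → (T b → x ≤ y) → x * ⟪ b ⟫ ≤ y
        gate x true  _   le = ≤-trans (≤-reflexive (*-identityʳ x)) (le _)
        gate x false 0≤y _  = ≤-trans (≤-reflexive (*-zeroʳ x)) 0≤y

      T≤sD : sum (λ v → + W v) ≤ + s * + D
      T≤sD = ≤-trans (≤-reflexive (sum-lookup weights)) (≤-trans (+≤+ total) (≤-reflexive (pos-* s D)))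

      light′ : + 249 * sum (λ v → + W v) ≤ + 50 * (+ n * + D)
      light′ = ≤-trans (*-monoˡ-≤-nonNeg (+ 249) T≤sD) (≤-trans (≤-reflexive (sym (*-assoc (+ 249) (+ s) (+ D))))
        (≤-trans (*-monoʳ-≤-nonNeg (+ D) {{nonNegative 0≤D}} (≤-trans (≤-reflexive (sym (pos-* 249 s)))
            (≤-trans (+≤+ light) (≤-reflexive (pos-* 50 n)))))
          (≤-reflexive (*-assoc (+ 50) (+ n) (+ D)))))

      r : ℤ
      r = + n - + s

      0≤r : 0ℤ ≤ r
      0≤r = i≤j⇒0≤j-i {+ s} {+ n} (+≤+ s≤n)

      0<D⁴ : ∀ {c} → 0ℤ < c → 0ℤ < c * (+ D * + D * + D * + D)
      0<D⁴ 0<c = *-pos 0<c (*-pos (*-pos (*-pos 0<D 0<D) 0<D) 0<D)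
        where
        0<D : 0ℤ < + D
        0<D = +<+ 0<denominator

      -- Used with c = 48 and k = 83, whose product is 3984: the factor c h⁴ cancels and k remains.
      combine : ∀ c k M h x Q N → 0ℤ < c * (h * h * h * h) → 0ℤ ≤ M → 0ℤ ≤ c * k → 0ℤ ≤ r * h → r * h ≤ Q →
        ∀ {y} → c * (h * h * h * h) * x ≤ M * y → y ≤ c * k * (h * h * h * h * N - Q * Q * Q * Q) →
        x ≤ k * M * (N - r * r * r * r)
      combine c k M h x Q N pos 0≤M 0≤ck 0≤rh rh≤Q {y} le₁ le₂ =
        *-cancelˡ-≤-pos x (k * M * (N - r * r * r * r)) (c * (h * h * h * h)) {{positive pos}}
          (≤-trans le₁ (≤-trans (*-monoˡ-≤-nonNeg M {{nonNegative 0≤M}} (≤-trans le₂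
              (*-monoˡ-≤-nonNeg (c * k) {{nonNegative 0≤ck}}
                (+-monoʳ-≤ (h * h * h * h * N) (neg-mono-≤ (fourth-power-mono 0≤rh rh≤Q))))))
            (≤-reflexive (regroup c k M h N r))))
        where
        regroup : ∀ c k M h N r → M * (c * k * (h * h * h * h * N - r * h * (r * h) * (r * h) * (r * h))) ≡
                  c * (h * h * h * h) * (k * M * (N - r * r * r * r))
        regroup = solve-∀

    slim-bound : slim-escapes G s cover m ≤ + 83 * + suc m * (L - (+ n - + s) * (+ n - + s) * (+ n - + s) * (+ n - + s))
    slim-bound = combine (+ 48) (+ 83) (+ suc m) (+ D) (slim-escapes G s cover m) (+ n * + D - sum (λ v → + W v)) L
      (0<D⁴ {+ 48} (+<+ (ℕ.s≤s z≤n))) (+≤+ z≤n) (+≤+ z≤n) (*-nonNeg 0≤r 0≤D) r*D≤Q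
      {∑₄ (λ a b c d → bonus D (W a) (W b) (W c) (W d))}
      slim≤bonus (∑-bonus≤ D W (w≤D G s cover) 0<denominator light′)
      where
      r*D≤Q : r * + D ≤ + n * + D - sum (λ v → + W v)
      r*D≤Q = ≤-trans (≤-reflexive (distrib (+ n) (+ s) (+ D))) (+-monoʳ-≤ (+ n * + D) (neg-mono-≤ T≤sD))
        where
        distrib : ∀ n s D → (n - s) * D ≡ n * D - s * D
        distrib = solve-∀

    private
      fat : Fin n → Bool
      fat v = not (toℕ v <ᵇ s) ∧ not (Y v)

      t : Fin n → ℤ
      t v = ⟪ fat v ⟫

      fat-weight : ∀ v → ¬ T (Y v) → m ℕ.* D ℕ.≤ suc m ℕ.* W v
      fat-weight v ¬slim = ℕ.<⇒≤ (ℕ.≰⇒> λ le → ¬slim (ℕ.≤⇒≤ᵇ le))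

      -- If a vertex outside [s] is not slim, then no vertex of [s] is, by monotonicity. With t such
      -- vertices outside, s + t vertices weigh at least mD/(m + 1) each and at most sD together, so
      -- m t ≤ s.
      fat-count : + m * sum t ≤ + n
      fat-count with Fin.any? (λ v → T? (fat v))
      ... | no none = ≤-trans (≤-reflexive (trans (cong (+ m *_) (sum-zero {n} λ v → ¬T-⟪⟫ (fat v) λ p → none (v , p))) (*-zeroʳ (+ m))))
                        (+≤+ z≤n)
        where
        ¬T-⟪⟫ : ∀ b → ¬ T b → ⟪ b ⟫ ≡ 0ℤ
        ¬T-⟪⟫ false _ = refl
        ¬T-⟪⟫ true  f = ⊥-elim (f _)
      ... | yes (a , fat-a) = ≤-trans bound (+≤+ s≤n)
        where
        s≤a : s ℕ.≤ toℕ a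
        s≤a = ℕ.≮⇒≥ λ a<s → T-not (proj₁ (∧-elim {not (toℕ a <ᵇ s)} fat-a)) (ℕ.<⇒<ᵇ a<s)

        ¬slim-a : ¬ T (Y a)
        ¬slim-a = T-not (proj₂ (∧-elim {not (toℕ a <ᵇ s)} fat-a))

        ¬slim-below : ∀ u → toℕ u ℕ.< s → ¬ T (Y u)
        ¬slim-below u u<s slim-u = ¬slim-a (ℕ.≤⇒≤ᵇ (ℕ.≤-trans
          (ℕ.*-monoʳ-≤ (suc m) (decreasing-lookup decreasing u a (ℕ.<⇒≤ (ℕ.<-≤-trans u<s s≤a))))
          (ℕ.≤ᵇ⇒≤ (suc m ℕ.* W u) (m ℕ.* D) slim-u)))

        α : ℤ
        α = sum λ v → ⟪ not (Y v) ⟫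

        s+∑t≤α : + s + sum t ≤ α
        s+∑t≤α = ≤-trans (≤-reflexive (trans (cong (_+ sum t) (sym (sum-inside {n} s s≤n)))
            (sym (∑-distrib-+ {n} (λ v → ⟪ toℕ v <ᵇ s ⟫) t))))
          (sum-mono {n} λ v → pointwise v (toℕ v <ᵇ s) refl)
          where
          pointwise : ∀ v b → (toℕ v <ᵇ s) ≡ b → ⟪ b ⟫ + ⟪ not b ∧ not (Y v) ⟫ ≤ ⟪ not (Y v) ⟫
          pointwise v true  eq = ≤-reflexive (sym (T-⟪⟫ (not-T (¬slim-below v (ℕ.<ᵇ⇒< (toℕ v) s (subst T (sym eq) _))))))
          pointwise v false eq = ≤-reflexive (+-identityˡ ⟪ not (Y v) ⟫)

        weighty : + m * + D * α ≤ + suc m * (+ s * + D)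
        weighty = ≤-trans (≤-reflexive (*-distribˡ-sum {n} (+ m * + D) (λ v → ⟪ not (Y v) ⟫)))
          (≤-trans (sum-mono {n} λ v → pointwise v)
            (≤-trans (≤-reflexive (sym (*-distribˡ-sum {n} (+ suc m) (λ v → + W v))))
              (*-monoˡ-≤-nonNeg (+ suc m) T≤sD)))
          where
          pointwise : ∀ v → + m * + D * ⟪ not (Y v) ⟫ ≤ + suc m * + W v
          pointwise v with Y v in eq
          ... | true  = ≤-trans (≤-reflexive (*-zeroʳ (+ m * + D))) (*-nonNeg {+ suc m} {+ W v} (+≤+ z≤n) (+≤+ z≤n))
          ... | false = ≤-trans (≤-reflexive (trans (*-identityʳ (+ m * + D)) (sym (pos-* m D))))
            (≤-trans (+≤+ (fat-weight v (λ p → subst T eq p))) (≤-reflexive (pos-* (suc m) (W v))))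

        bound : + m * sum t ≤ + s
        bound = *-cancelˡ-≤-pos (+ m * sum t) (+ s) (+ D) {{positive (+<+ 0<denominator)}}
          (≤-trans (≤-reflexive (expand (+ m) (+ D) (+ s) (sum t)))
            (≤-trans (+-monoˡ-≤ (- (+ m * + D * + s))
                (≤-trans (*-monoˡ-≤-nonNeg (+ m * + D) {{nonNegative (*-nonNeg {+ m} (+≤+ z≤n) 0≤D)}} s+∑t≤α) weighty))
              (≤-reflexive (collect (+ m) (+ D) (+ s)))))
          where
          expand : ∀ m D s t → D * (m * t) ≡ m * D * (s + t) - m * D * s
          expand = solve-∀
          collect : ∀ m D s → (1ℤ + m) * (s * D) - m * D * s ≡ D * s
          collect = solve-∀

      ∑₄-first : ∑₄ (λ a b c d → t a) ≡ + n * (+ n * (+ n * sum t))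
      ∑₄-first =
        trans (sum-cong-≗ {n} λ a → trans (sum-cong-≗ {n} λ b → trans (sum-cong-≗ {n} λ c → sum-constant n (t a))
          (sum-constant n (+ n * t a))) (sum-constant n (+ n * (+ n * t a))))
        (trans (sym (*-distribˡ-sum {n} (+ n) (λ a → + n * (+ n * t a)))) (cong (+ n *_)
        (trans (sym (*-distribˡ-sum {n} (+ n) (λ a → + n * t a))) (cong (+ n *_) (sym (*-distribˡ-sum {n} (+ n) t))))))

    -- The first vertex of such an edge is one of the vertices counted by `fat-count`; the other
    -- three are bounded trivially by n³.
    fat-bound : + m * fat-escapes G s cover m ≤ + n * + n * + n * + n
    fat-bound = ≤-trans (*-monoˡ-≤-nonNeg (+ m) (≤-trans (∑₄-mono λ a b c d →
        ⟪⟫-mono {escaping G s a b c d ∧ not (Y a)} {fat a} (weaken a b c d)) (≤-reflexive ∑₄-first)))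
      (≤-trans (≤-reflexive (move (+ m) (+ n) (sum t)))
        (≤-trans (*-monoˡ-≤-nonNeg (+ n * + n * + n) {{nonNegative (*-nonNeg (*-nonNeg {+ n} {+ n} (+≤+ z≤n) (+≤+ z≤n)) (+≤+ z≤n))}} fat-count)
          ≤-refl))
      where
      move : ∀ m n t → m * (n * (n * (n * t))) ≡ n * n * n * (m * t)
      move = solve-∀
      weaken : ∀ a b c d → T (escaping G s a b c d ∧ not (Y a)) → T (fat a)
      weaken a b c d p with ∧-elim {escaping G s a b c d} p
      ... | esc , ¬slim with ∧-elim {G (a , b , c , d)} (proj₂ (∧-elim {increasing (a , b , c , d)} esc))
      ...   | _ , out = ∧-intro {not (toℕ a <ᵇ s)} out ¬slim

-- Binomial estimates and the combination of all bounds

module Arithmetic where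
  open import Data.Integer hiding (suc)
  open import Data.Integer.Properties
  open import Data.Integer.Tactic.RingSolver using (solve-∀)
  open import Data.Nat as ℕ using (ℕ; zero; suc; z≤n)
  open import Data.Nat.Combinatorics using (_C_; nC1≡n; nCk+nC[k+1]≡[n+1]C[k+1])
  import Data.Nat.Properties as ℕ
  open Polynomials using (*-nonNeg; *-pos; 0≤+)

  private
    ≤-by : ∀ {x y} z → 0ℤ ≤ z → y ≡ x + z → x ≤ y
    ≤-by {x} z 0≤z refl = ≤-trans (≤-reflexive (sym (+-identityʳ x))) (+-monoʳ-≤ x 0≤z)

  -- Pascal's rule lets each falling factorial follow from the previous one. Over the integers the
  -- factors are not truncated at 0, so the identities hold for small n as well.
  2*C₂ : ∀ n → + 2 * + (n C 2) ≡ + n * (+ n - 1ℤ)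
  2*C₂ zero    = refl
  2*C₂ (suc n) = trans (cong (λ x → + 2 * + x) (sym (nCk+nC[k+1]≡[n+1]C[k+1] n 1)))
    (trans (*-distribˡ-+ (+ 2) (+ (n C 1)) (+ (n C 2)))
    (trans (cong₂ (λ x y → + 2 * + x + y) (nC1≡n n) (2*C₂ n)) (step (+ n))))
    where
    step : ∀ n → + 2 * n + n * (n - 1ℤ) ≡ (1ℤ + n) * ((1ℤ + n) - 1ℤ)
    step = solve-∀

  6*C₃ : ∀ n → + 6 * + (n C 3) ≡ + n * (+ n - 1ℤ) * (+ n - + 2)
  6*C₃ zero    = refl
  6*C₃ (suc n) = trans (cong (λ x → + 6 * + x) (sym (nCk+nC[k+1]≡[n+1]C[k+1] n 2)))
    (trans (split (+ (n C 2)) (+ (n C 3)))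
    (trans (cong₂ (λ x y → + 3 * x + y) (2*C₂ n) (6*C₃ n)) (step (+ n))))
    where
    split : ∀ x y → + 6 * (x + y) ≡ + 3 * (+ 2 * x) + + 6 * y
    split = solve-∀
    step : ∀ n → + 3 * (n * (n - 1ℤ)) + n * (n - 1ℤ) * (n - + 2) ≡ (1ℤ + n) * ((1ℤ + n) - 1ℤ) * ((1ℤ + n) - + 2)
    step = solve-∀

  24*C₄ : ∀ n → + 24 * + (n C 4) ≡ + n * (+ n - 1ℤ) * (+ n - + 2) * (+ n - + 3)
  24*C₄ zero    = refl
  24*C₄ (suc n) = trans (cong (λ x → + 24 * + x) (sym (nCk+nC[k+1]≡[n+1]C[k+1] n 3)))
    (trans (split (+ (n C 3)) (+ (n C 4)))
    (trans (cong₂ (λ x y → + 4 * x + y) (6*C₃ n) (24*C₄ n)) (step (+ n))))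
    where
    split : ∀ x y → + 24 * (x + y) ≡ + 4 * (+ 6 * x) + + 24 * y
    split = solve-∀
    step : ∀ n → + 4 * (n * (n - 1ℤ) * (n - + 2)) + n * (n - 1ℤ) * (n - + 2) * (n - + 3)
           ≡ (1ℤ + n) * ((1ℤ + n) - 1ℤ) * ((1ℤ + n) - + 2) * ((1ℤ + n) - + 3)
    step = solve-∀

  24*C₄-upper : ∀ n → + 24 * + (n C 4) ≤ + n * + n * + n * + n
  24*C₄-upper n = ≤-trans (≤-reflexive (24*C₄ n)) (≤-by
    (+ 6 * (+ n * ((+ n - 1ℤ) * (+ n - 1ℤ))) + + n * + n)
    (+-mono-≤ {0ℤ} (*-nonNeg {+ 6} 0≤+ (*-nonNeg {+ n} 0≤+ (square (+ n - 1ℤ)))) (*-nonNeg {+ n} {+ n} 0≤+ 0≤+))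
    (identity (+ n)))
    where
    square : ∀ i → 0ℤ ≤ i * i
    square (+ k)      = *-nonNeg {+ k} {+ k} 0≤+ 0≤+
    square (-[1+ k ]) = 0≤+
    identity : ∀ n → n * n * n * n ≡ n * (n - 1ℤ) * (n - + 2) * (n - + 3) + (+ 6 * (n * ((n - 1ℤ) * (n - 1ℤ))) + n * n)
    identity = solve-∀

  24*C₄-lower : ∀ n → + n * + n * + n * + n - + 6 * (+ n * + n * + n) ≤ + 24 * + (n C 4)
  24*C₄-lower n = ≤-trans (≤-by (+ 5 * (+ n * + n) + + 6 * (+ 2 * + (n C 2)))
      (+-mono-≤ {0ℤ} (*-nonNeg {+ 5} 0≤+ (*-nonNeg {+ n} {+ n} 0≤+ 0≤+)) (*-nonNeg {+ 6} 0≤+ (*-nonNeg {+ 2} {+ (n C 2)} 0≤+ 0≤+)))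
      (trans (identity (+ n)) (cong (λ x → + n * + n * + n * + n - + 6 * (+ n * + n * + n) + (+ 5 * (+ n * + n) + + 6 * x)) (sym (2*C₂ n)))))
    (≤-reflexive (sym (24*C₄ n)))
    where
    identity : ∀ n → n * (n - 1ℤ) * (n - + 2) * (n - + 3) ≡
               (n * n * n * n - + 6 * (n * n * n)) + (+ 5 * (n * n) + + 6 * (n * (n - 1ℤ)))
    identity = solve-∀

  -- With ε = N/E this is an integer square root of 1/ε. The search descends from E, where the upper
  -- bound is clear.
  square-root : ∀ E N → 0 ℕ.< N → N ℕ.< E → ∃ λ m → suc m ℕ.* suc m ℕ.* N ℕ.< E × E ℕ.≤ suc (suc m) ℕ.* suc (suc m) ℕ.* N
  square-root E N 0<N N<E = search E (ℕ.≤-trans (ℕ.m≤m*n E (suc E)) (ℕ.≤-trans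
      (ℕ.*-mono-≤ (ℕ.≤-trans (ℕ.n≤1+n E) (ℕ.n≤1+n (suc E))) (ℕ.n≤1+n (suc E))) (ℕ.m≤m*n _ N {{ℕ.>-nonZero 0<N}})))
    where
    search : ∀ k → E ℕ.≤ suc (suc k) ℕ.* suc (suc k) ℕ.* N →
             ∃ λ m → suc m ℕ.* suc m ℕ.* N ℕ.< E × E ℕ.≤ suc (suc m) ℕ.* suc (suc m) ℕ.* N
    search zero    le = zero , ℕ.≤-<-trans (ℕ.≤-reflexive (ℕ.*-identityˡ N)) N<E , le
    search (suc k) le with E ℕ.≤? suc (suc k) ℕ.* suc (suc k) ℕ.* N
    ... | yes le′ = search k le′
    ... | no  ≰   = suc k , ℕ.≰⇒> ≰ , le

  module _ {E N P R n³ M m e Y h g₁ g₂ L : ℤ}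
           (0≤E : 0ℤ ≤ E) (0≤N : 0ℤ ≤ N) (0≤P : 0ℤ ≤ P) (1≤M : 1ℤ ≤ M) (0≤m : 0ℤ ≤ m) (0≤g₂ : 0ℤ ≤ g₂)
           (edges : E * (P - + 6 * n³ - R) ≤ + 24 * (E * e) + + 24 * (N * P))
           (large : + 6 * (E * n³) ≤ N * P)
           (h≤ : + 24 * h ≤ P - R) (Y+e : Y + e ≡ h + (g₁ + g₂))
           (g₁≤ : g₁ ≤ + 83 * M * (L - R)) (g₂≤ : m * g₂ ≤ P) (e≤ : + 24 * e ≤ P - L)
           (E≤ : E ≤ M * M * N) (M≤ : M ≤ + 2 * m) where
    private
      0≤M : 0ℤ ≤ M
      0≤M = ≤-trans (+≤+ z≤n) 1≤M

      scale : ∀ {k x y} → 0ℤ ≤ k → x ≤ y → k * x ≤ k * y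
      scale {k} 0≤k = *-monoˡ-≤-nonNeg k {{nonNegative 0≤k}}

      -- N P is E times ε n⁴. The hypothesis on the number of edges costs 24 of these; the 25th
      -- absorbs the cubic term.
      gain : E * (P - R) ≤ + 24 * (E * e) + + 25 * (N * P)
      gain = ≤-trans (≤-reflexive (split E P R n³)) (≤-trans (+-mono-≤ edges large) (≤-reflexive (merge E e N P)))
        where
        split : ∀ E P R q → E * (P - R) ≡ E * (P - + 6 * q - R) + + 6 * (E * q)
        split = solve-∀
        merge : ∀ E e N P → + 24 * (E * e) + + 24 * (N * P) + N * P ≡ + 24 * (E * e) + + 25 * (N * P)
        merge = solve-∀

      lights : E * (L - R) ≤ + 25 * (N * P)
      lights = ≤-trans (scale 0≤E L-R≤) (≤-trans (≤-reflexive (expand E P R e))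
          (≤-trans (+-monoˡ-≤ (- (+ 24 * (E * e))) gain) (≤-reflexive (cancel (+ 24 * (E * e)) (+ 25 * (N * P))))))
        where
        L-R≤ : L - R ≤ P - R - + 24 * e
        L-R≤ = ≤-trans (≤-reflexive (rewrite₁ L R e)) (≤-trans (+-monoˡ-≤ (L - R - + 24 * e) e≤) (≤-reflexive (rewrite₂ P L R e)))
          where
          rewrite₁ : ∀ L R e → L - R ≡ + 24 * e + (L - R - + 24 * e)
          rewrite₁ = solve-∀
          rewrite₂ : ∀ P L R e → P - L + (L - R - + 24 * e) ≡ P - R - + 24 * e
          rewrite₂ = solve-∀
        expand : ∀ E P R e → E * (P - R - + 24 * e) ≡ E * (P - R) + - (+ 24 * (E * e))
        expand = solve-∀
        cancel : ∀ x y → x + y + - x ≡ y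
        cancel = solve-∀

      -- 2075 = 83 · 25: the slack constant times the excess of light quadruples. The bound grows
      -- with M, while the one for `fat` would shrink like 1/m; E ≤ M² N brings both to the common
      -- scale M N P.
      slim : E * g₁ ≤ + 2075 * (M * (N * P))
      slim = ≤-trans (scale 0≤E g₁≤) (≤-trans (≤-reflexive (regroup E M (L - R)))
          (≤-trans (scale (*-nonNeg {+ 83} (+≤+ z≤n) 0≤M) lights) (≤-reflexive (merge M (N * P)))))
        where
        regroup : ∀ E M x → E * (+ 83 * M * x) ≡ + 83 * M * (E * x)
        regroup = solve-∀
        merge : ∀ M x → + 83 * M * (+ 25 * x) ≡ + 2075 * (M * x)
        merge = solve-∀

      fat : E * g₂ ≤ + 2 * (M * (N * P))
      fat = ≤-trans (*-monoʳ-≤-nonNeg g₂ {{nonNegative 0≤g₂}} E≤) (≤-trans (≤-reflexive (regroup M N g₂))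
          (≤-trans (scale 0≤MN (≤-trans (*-monoʳ-≤-nonNeg g₂ {{nonNegative 0≤g₂}} M≤)
              (≤-trans (≤-reflexive (*-assoc (+ 2) m g₂)) (scale {+ 2} (+≤+ z≤n) g₂≤))))
            (≤-reflexive (merge M N P))))
        where
        0≤MN : 0ℤ ≤ M * N
        0≤MN = *-nonNeg 0≤M 0≤N
        regroup : ∀ M N g → M * M * N * g ≡ M * N * (M * g)
        regroup = solve-∀
        merge : ∀ M N P → M * N * (+ 2 * P) ≡ + 2 * (M * (N * P))
        merge = solve-∀

      NP≤MNP : N * P ≤ M * (N * P)
      NP≤MNP = ≤-trans (≤-reflexive (sym (*-identityˡ (N * P)))) (*-monoʳ-≤-nonNeg (N * P) {{nonNegative (*-nonNeg 0≤N 0≤P)}} 1≤M)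

    -- 2079 consists of 2075 for the slim escapes, 2 for the fat ones, and 25/24 rounded up to 2 for
    -- the edges that G may lack compared with H₁.
    missing-bound : E * Y ≤ + 2079 * (M * (N * P))
    missing-bound = *-cancelˡ-≤-pos (E * Y) (+ 2079 * (M * (N * P))) (+ 24) (≤-trans (≤-reflexive expand)
        (≤-trans (+-mono-≤ (+-mono-≤ (+-monoˡ-≤ (- (+ 24 * (E * e))) (≤-trans (scale 0≤E h≤) gain))
                                      (scale {+ 24} (+≤+ z≤n) slim)) (scale {+ 24} (+≤+ z≤n) fat))
          (≤-trans (≤-reflexive (collect (+ 24 * (E * e)) (N * P) (M * (N * P))))
            (≤-trans (+-monoˡ-≤ (+ 49848 * (M * (N * P))) (scale {+ 25} (+≤+ z≤n) NP≤MNP))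
              (≤-by (+ 23 * (M * (N * P))) (*-nonNeg {+ 23} (+≤+ z≤n) (*-nonNeg 0≤M (*-nonNeg 0≤N 0≤P)))
                (final (M * (N * P))))))))
      where
      expand : + 24 * (E * Y) ≡ E * (+ 24 * h) + - (+ 24 * (E * e)) + + 24 * (E * g₁) + + 24 * (E * g₂)
      expand = trans (cong (λ y → + 24 * (E * y)) (solved Y+e)) (distribute E h e g₁ g₂)
        where
        solved : ∀ {y e z} → y + e ≡ z → y ≡ z - e
        solved {y} {e} refl = cancel y e
          where
          cancel : ∀ y e → y ≡ y + e - e
          cancel = solve-∀
        distribute : ∀ E h e g₁ g₂ → + 24 * (E * (h + (g₁ + g₂) - e)) ≡
                     E * (+ 24 * h) + - (+ 24 * (E * e)) + + 24 * (E * g₁) + + 24 * (E * g₂)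
        distribute = solve-∀
      collect : ∀ x y z → x + + 25 * y + - x + + 24 * (+ 2075 * z) + + 24 * (+ 2 * z) ≡ + 25 * y + + 49848 * z
      collect = solve-∀
      final : ∀ z → + 24 * (+ 2079 * z) ≡ + 25 * z + + 49848 * z + + 23 * z
      final = solve-∀

  private
    *-mono-nonNeg : ∀ {a b c d} → 0ℤ ≤ a → 0ℤ ≤ d → a ≤ b → c ≤ d → a * c ≤ b * d
    *-mono-nonNeg {a} {b} {c} {d} 0≤a 0≤d a≤b c≤d = ≤-trans (*-monoˡ-≤-nonNeg a {{nonNegative 0≤a}} c≤d)
      (*-monoʳ-≤-nonNeg d {{nonNegative 0≤d}} a≤b)

    square-mono : ∀ {x y} → 0ℤ ≤ x → x ≤ y → x * x ≤ y * y
    square-mono 0≤x x≤y = *-mono-nonNeg 0≤x (≤-trans 0≤x x≤y) x≤y x≤y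

  -- The square root of ε enters through M² N ≤ 4 E, where ε = N / E.
  fourth-power-bound : ∀ {E N P M Y K t} → 0ℤ < E → 0ℤ < N → 0ℤ < P → 0ℤ ≤ M → 0ℤ ≤ Y → 0ℤ ≤ K →
    E * Y ≤ K * (M * (N * P)) → M * M * N ≤ + 4 * E → + 16 * (K * K * K * K) * N < t * E →
    E * (Y * Y * Y * Y) < t * N * (P * P * P * P)
  fourth-power-bound {E} {N} {P} {M} {Y} {K} {t} 0<E 0<N 0<P 0≤M 0≤Y 0≤K EY≤ M²N≤ small =
    *-cancelˡ-<-nonNeg E {{nonNegative 0≤E}} (≤-<-trans (*-cancelˡ-≤-pos _ _ (E * E) {{positive (*-pos 0<E 0<E)}} chain) strict)
    where
    0≤E = <⇒≤ 0<E
    0≤N = <⇒≤ 0<N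
    0≤P = <⇒≤ 0<P
    0≤K²NP² : 0ℤ ≤ K * K * (K * K) * (N * N) * (P * P * (P * P))
    0≤K²NP² = *-nonNeg (*-nonNeg (*-nonNeg (*-nonNeg 0≤K 0≤K) (*-nonNeg 0≤K 0≤K)) (*-nonNeg 0≤N 0≤N))
      (*-nonNeg (*-nonNeg 0≤P 0≤P) (*-nonNeg 0≤P 0≤P))
    -- (E Y)⁴ ≤ K⁴ N² P⁴ (M² N)², and (M² N)² ≤ 16 E² leaves a factor E² to cancel: M enters only
    -- through M² N, so no root has to be taken.
    chain : E * E * (E * (E * (Y * Y * Y * Y))) ≤ E * E * (+ 16 * (K * K * K * K) * N * (N * (P * P * P * P)))
    chain = ≤-trans (≤-reflexive (lhs E Y)) (≤-trans
        (square-mono (*-nonNeg (*-nonNeg 0≤E 0≤Y) (*-nonNeg 0≤E 0≤Y)) (square-mono (*-nonNeg 0≤E 0≤Y) EY≤))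
        (≤-trans (≤-reflexive (middle K M N P)) (≤-trans
          (*-monoˡ-≤-nonNeg (K * K * (K * K) * (N * N) * (P * P * (P * P))) {{nonNegative 0≤K²NP²}}
            (square-mono (*-nonNeg (*-nonNeg 0≤M 0≤M) 0≤N) M²N≤))
          (≤-reflexive (rhs E K N P)))))
      where
      lhs : ∀ E Y → E * E * (E * (E * (Y * Y * Y * Y))) ≡ E * Y * (E * Y) * (E * Y * (E * Y))
      lhs = solve-∀
      middle : ∀ K M N P → K * (M * (N * P)) * (K * (M * (N * P))) * (K * (M * (N * P)) * (K * (M * (N * P)))) ≡
               K * K * (K * K) * (N * N) * (P * P * (P * P)) * (M * M * N * (M * M * N))
      middle = solve-∀
      rhs : ∀ E K N P → K * K * (K * K) * (N * N) * (P * P * (P * P)) * (+ 4 * E * (+ 4 * E)) ≡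
            E * E * (+ 16 * (K * K * K * K) * N * (N * (P * P * P * P)))
      rhs = solve-∀
    strict : + 16 * (K * K * K * K) * N * (N * (P * P * P * P)) < E * (t * N * (P * P * P * P))
    strict = <-≤-trans (*-monoʳ-<-pos (N * (P * P * P * P)) {{positive (*-pos 0<N (*-pos (*-pos (*-pos 0<P 0<P) 0<P) 0<P))}} small)
      (≤-reflexive (regroup t E N (P * P * P * P)))
      where
      regroup : ∀ t E N p → t * E * (N * p) ≡ E * (t * N * p)
      regroup = solve-∀

-- The stability theorem in integers, with ε = N/E

module IntegralStability where
  open import Data.Integer hiding (suc)
  open import Data.Integer.Properties
  open import Data.Integer.Tactic.RingSolver using (solve-∀)
  open import Data.Nat as ℕ using (ℕ; zero; suc; z≤n; _∸_)
  open import Data.Nat.Combinatorics using (_C_)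
  import Data.Nat.Properties as ℕ
  open import Defs using (Graph4; Stable; FracMatchingNumber≤; ℕ→ℚ; e; H₁; missing; increasing)
  open Polynomials using (*-nonNeg; *-pos; 0≤+)
  open TupleSums
  open IncreasingTuples
  open IntegralCover
  open EdgeCounts
  open Escapes
  open Arithmetic

  private
    pos-∸ : ∀ {n s} → s ℕ.≤ n → + (n ∸ s) ≡ + n - + s
    pos-∸ {n} {s} s≤n = trans (cancel (+ (n ∸ s)) (+ s)) (cong (λ x → + x - + s) (ℕ.m∸n+n≡m s≤n))
      where
      cancel : ∀ x s → x ≡ x + s - s
      cancel = solve-∀

    edge-hypothesis : ∀ {E N P n³ R C₁ C₂ e} → 0ℤ ≤ E → P - + 6 * n³ ≤ + 24 * C₁ → + 24 * C₂ ≤ R →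
      E * (C₁ - C₂) - N * P ≤ E * e → E * (P - + 6 * n³ - R) ≤ + 24 * (E * e) + + 24 * (N * P)
    edge-hypothesis {E} {N} {P} {n³} {R} {C₁} {C₂} {e} 0≤E lower upper hyp =
      ≤-trans (*-monoˡ-≤-nonNeg E {{nonNegative 0≤E}} (+-mono-≤ lower (neg-mono-≤ upper)))
        (≤-trans (≤-reflexive (expand E C₁ C₂ (N * P)))
          (≤-trans (+-monoˡ-≤ (+ 24 * (N * P)) (*-monoˡ-≤-nonNeg (+ 24) hyp)) ≤-refl))
      where
      expand : ∀ E c d x → E * (+ 24 * c - + 24 * d) ≡ + 24 * (E * (c - d) - x) + + 24 * x
      expand = solve-∀

    -- This is what n must be large for: 24 times the binomial coefficient falls short of n⁴ by up
    -- to 6n³, which is at most ε n⁴ once 6E ≤ n.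
    large-order : ∀ {E N n} → 0ℤ ≤ n → 1ℤ ≤ N → + 6 * E ≤ n → + 6 * (E * (n * n * n)) ≤ N * (n * n * n * n)
    large-order {E} {N} {n} 0≤n 1≤N 6E≤n = ≤-trans (≤-reflexive (left E (n * n * n)))
      (≤-trans (*-monoʳ-≤-nonNeg (n * n * n) {{nonNegative (*-nonNeg (*-nonNeg 0≤n 0≤n) 0≤n)}} 6E≤n)
        (≤-trans (≤-reflexive (right n))
          (*-monoʳ-≤-nonNeg (n * n * n * n) {{nonNegative (*-nonNeg (*-nonNeg (*-nonNeg 0≤n 0≤n) 0≤n) 0≤n)}} 1≤N)))
      where
      left : ∀ E x → + 6 * (E * x) ≡ + 6 * E * x
      left = solve-∀
      right : ∀ n → n * (n * n * n) ≡ 1ℤ * (n * n * n * n)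
      right = solve-∀

    small-ratio : ∀ {k t c N E} → 0ℤ < t → 0ℤ ≤ N → k ≤ t * c → c * N < E → k * N < t * E
    small-ratio {k} {t} {c} {N} {E} 0<t 0≤N k≤tc cN<E = ≤-<-trans
      (≤-trans (*-monoʳ-≤-nonNeg N {{nonNegative 0≤N}} k≤tc) (≤-reflexive (*-assoc t c N)))
      (*-monoˡ-<-pos t {{positive 0<t}} cN<E)

  module _ {n s : ℕ} (G : Graph4 n) (stable : Stable G) (ν≤s : FracMatchingNumber≤ G (ℕ→ℚ s))
           (light : 249 ℕ.* s ℕ.≤ 50 ℕ.* n) {E N : ℕ} (0<N : 0 ℕ.< N) (N<E : N ℕ.< E) (6E≤n : 6 ℕ.* E ℕ.≤ n)
           (edges : + E * (+ (n C 4) - + ((n ∸ s) C 4)) - + N * (+ n * + n * + n * + n) ≤ + E * + e G) where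
    private
      s≤n : s ℕ.≤ n
      s≤n = ℕ.*-cancelˡ-≤ 50 (ℕ.≤-trans (ℕ.*-monoˡ-≤ s (ℕ.≤ᵇ⇒≤ 50 249 _)) light)

      cover : DecreasingCover G s
      cover = decreasing-cover G s stable ν≤s

      root = square-root E N 0<N N<E
      m : ℕ
      m = suc (proj₁ root)

      P R Y : ℤ
      P = + n * + n * + n * + n
      R = (+ n - + s) * (+ n - + s) * (+ n - + s) * (+ n - + s)
      Y = + missing G (H₁ n s)

      0<E : 0 ℕ.< E
      0<E = ℕ.<-trans 0<N N<E

      E≤M²N : + E ≤ + suc m * + suc m * + N
      E≤M²N = ≤-trans (+≤+ (proj₂ (proj₂ root))) (≤-reflexive (trans (pos-* (suc m ℕ.* suc m) N)
        (cong (_* + N) (pos-* (suc m) (suc m)))))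

      m²N<E : + m * + m * + N < + E
      m²N<E = ≤-<-trans (≤-reflexive (sym (trans (pos-* (m ℕ.* m) N) (cong (_* + N) (pos-* m m))))) (+<+ (proj₁ (proj₂ root)))

      M≤2m : + suc m ≤ + 2 * + m
      M≤2m = ≤-trans (+≤+ (ℕ.+-monoˡ-≤ m (ℕ.s≤s (z≤n {proj₁ root})))) (≤-reflexive (double (+ m)))
        where
        double : ∀ x → x + x ≡ + 2 * x
        double = solve-∀

      M²N≤4E : + suc m * + suc m * + N ≤ + 4 * + E
      M²N≤4E = ≤-trans (*-monoʳ-≤-nonNeg (+ N) {{nonNegative (0≤+ {N})}} (≤-trans
          (*-monoˡ-≤-nonNeg (+ suc m) M≤2m) (*-monoʳ-≤-nonNeg (+ 2 * + m) {{nonNegative (*-nonNeg {+ 2} {+ m} 0≤+ 0≤+)}} M≤2m)))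
        (≤-trans (≤-reflexive (regroup (+ m) (+ N))) (*-monoˡ-≤-nonNeg (+ 4) (<⇒≤ m²N<E)))
        where
        regroup : ∀ m N → + 2 * m * (+ 2 * m) * N ≡ + 4 * (m * m * N)
        regroup = solve-∀

      C₂≤R : + 24 * + ((n ∸ s) C 4) ≤ R
      C₂≤R = ≤-trans (24*C₄-upper (n ∸ s)) (≤-reflexive (cong (λ x → x * x * x * x) (pos-∸ s≤n)))

      EY≤ : + E * Y ≤ + 2079 * (+ suc m * (+ N * P))
      EY≤ = missing-bound {+ E} {+ N} {P} {R} {+ n * + n * + n} {+ suc m} {+ m} {+ e G} {Y}
        {∑₄ λ a b c d → ⟪ increasing (a , b , c , d) ∧ H₁ n s (a , b , c , d) ⟫}
        {slim-escapes G s cover m} {fat-escapes G s cover m} {lights G s cover}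
        0≤+ 0≤+ (*-nonNeg (*-nonNeg (*-nonNeg {+ n} {+ n} 0≤+ 0≤+) 0≤+) 0≤+) (+≤+ (ℕ.s≤s z≤n)) 0≤+
        (∑₄-nonNeg λ a b c d → ⟪⟫-nonNeg (escaping G s a b c d ∧ not (slim G s cover m a)))
        (edge-hypothesis {+ E} {+ N} {P} {+ n * + n * + n} {R} {+ (n C 4)} {+ ((n ∸ s) C 4)} {+ e G}
          0≤+ (24*C₄-lower n) C₂≤R edges)
        (large-order {+ E} {+ N} {+ n} 0≤+ (+≤+ 0<N) (≤-trans (≤-reflexive (sym (pos-* 6 E))) (+≤+ 6E≤n)))
        (H₁-count s s≤n)
        (trans (missing-count G s) (cong (λ x → ∑₄ (λ a b c d → ⟪ increasing (a , b , c , d) ∧ H₁ n s (a , b , c , d) ⟫) + x)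
          (escapes-split G s cover m)))
        (slim-bound G s s≤n light cover m) (fat-bound G s s≤n light cover m) (edge-count G s cover) E≤M²N M≤2m

    missing-fourth-power : ∀ {t c} → 0ℤ < t → + 16 * (+ 2079 * + 2079 * + 2079 * + 2079) ≤ t * c → c * + N < + E →
      + E * (Y * Y * Y * Y) < t * + N * (P * P * P * P)
    missing-fourth-power {t} {c} 0<t bound cN<E = fourth-power-bound {+ E} {+ N} {P} {+ suc m} {Y} {+ 2079} {t}
      (+<+ 0<E) (+<+ 0<N) (*-pos (*-pos (*-pos 0<n 0<n) 0<n) 0<n) 0≤+ 0≤+ 0≤+ EY≤ M²N≤4E
      (small-ratio {+ 16 * (+ 2079 * + 2079 * + 2079 * + 2079)} {t} {c} {+ N} {+ E} 0<t 0≤+ bound cN<E)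
      where
      0<n : 0ℤ < + n
      0<n = +<+ (ℕ.<-≤-trans (ℕ.<-≤-trans 0<E (ℕ.m≤n*m E 6)) 6E≤n)

-- Passage to rational ε

open import Defs
open import Data.Nat using (ℕ; _∸_; _^_) renaming (_≤_ to _≤ℕ_)
open import Data.Nat.Combinatorics using (_C_)
open import Data.Integer using (+_)
open import Data.Rational using (ℚ; _/_; _+_; _*_; _-_; _≤_; _<_; 0ℚ)
open import Data.Product using (Σ; _×_)

private
  module Conversion where
    open import Data.Integer as ℤ using (ℤ; +≤+; +<+; 0ℤ)
    import Data.Integer.Properties as ℤ
    open import Data.Integer.Tactic.RingSolver using (solve-∀)
    open import Data.Nat as ℕ using (zero; suc; z≤n)
    import Data.Nat.Properties as ℕ
    open import Data.Rational using (↧ₙ_; nonNegative; -_; positive)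
    open import Data.Rational.Properties
    open RationalEmbedding
    open IntegralStability

    -- The estimates give at most 2 · 2079 √ε n⁴ missing edges. This is below 100 ε^{1/4} n⁴ when 16
    -- · 2079⁴ ε < 100⁴, and 16 · 2079⁴ ≤ 100⁴ · 10⁷.
    ε₀ : ℚ
    ε₀ = + 1 / 10000000

    toℚ-- : ∀ i j → toℚ (i ℤ.- j) ≡ toℚ i - toℚ j
    toℚ-- i j = trans (toℚ-+ i (ℤ.- j)) (cong (λ x → toℚ i + x) (toℚ-neg j))

    toℚ-cancel-< : ∀ {i j} → toℚ i < toℚ j → i ℤ.< j
    toℚ-cancel-< i<j = ℤ.≰⇒> λ j≤i → <-irrefl refl (<-≤-trans i<j (toℚ-mono j≤i))

    toℚ-mono-< : ∀ {i j} → i ℤ.< j → toℚ i < toℚ j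
    toℚ-mono-< i<j = ≰⇒> λ j≤i → ℤ.<⇒≱ i<j (toℚ-cancel j≤i)

    toℚ-nonNeg : ∀ n → 0ℚ ≤ toℚ (+ n)
    toℚ-nonNeg n = toℚ-mono {+ 0} {+ n} (+≤+ z≤n)

    pos-^4 : ∀ x → + (x ^ 4) ≡ + x ℤ.* + x ℤ.* + x ℤ.* + x
    pos-^4 x = trans (cong +_ (regroup x)) (trans (ℤ.pos-* (x ℕ.* x ℕ.* x) x)
      (cong (ℤ._* + x) (trans (ℤ.pos-* (x ℕ.* x) x) (cong (ℤ._* + x) (ℤ.pos-* x x)))))
      where
      regroup : ∀ x → x ^ 4 ≡ x ℕ.* x ℕ.* x ℕ.* x
      regroup x = trans (cong (λ y → x ℕ.* (x ℕ.* (x ℕ.* y))) (ℕ.*-identityʳ x))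
        (trans (sym (ℕ.*-assoc x x (x ℕ.* x))) (sym (ℕ.*-assoc (x ℕ.* x) x x)))

    -- 249/50 = 4.98 ≤ 5 - `δ` is decided by evaluation. The result says that the mean weight s/n is
    -- at most x = 50/249.
    light-order : ∀ n s → (ℕ→ℚ 5 - δ) * ℕ→ℚ s ≤ ℕ→ℚ n - ℕ→ℚ 3 → 249 ℕ.* s ≤ℕ 50 ℕ.* n
    light-order n s hyp = ℤ.drop‿+≤+ (toℚ-cancel (≤-trans (≤-reflexive (trans (cong toℚ (ℤ.pos-* 249 s)) (toℚ-* (+ 249) (+ s))))
      (≤-trans (≤-reflexive (*-assoc (toℚ (+ 50)) (+ 249 / 50) (toℚ (+ s))))
        (≤-trans (*-monoˡ-≤-nonNeg (toℚ (+ 50)) (≤-trans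
            (*-monoʳ-≤-nonNeg (toℚ (+ s)) {{nonNegative (toℚ-nonNeg s)}} (≤ᵇ⇒≤ {+ 249 / 50} {ℕ→ℚ 5 - δ} _))
            (≤-trans hyp (≤-trans (+-monoʳ-≤ (toℚ (+ n)) (neg-antimono-≤ (toℚ-nonNeg 3))) (≤-reflexive (+-identityʳ (toℚ (+ n))))))))
          (≤-reflexive (sym (trans (cong toℚ (ℤ.pos-* 50 n)) (toℚ-* (+ 50) (+ n)))))))))

    module _ (ε : ℚ) (0<ε : 0ℚ < ε) (ε<ε₀ : ε < ε₀) where
      -- ε = N/E in lowest terms. Multiplication by E turns each inequality that involves ε into one
      -- between integers.
      E N : ℕ
      E = ↧ₙ ε
      N = proj₁ (numerator-nonNeg ε (<⇒≤ 0<ε))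

      Eε≡N : toℚ (+ E) * ε ≡ toℚ (+ N)
      Eε≡N = trans (*-comm (toℚ (+ E)) ε) (trans (*-denominator ε) (cong toℚ (proj₂ (numerator-nonNeg ε (<⇒≤ 0<ε)))))

      0<E : 0ℚ < toℚ (+ E)
      0<E = toℚ-mono-< {+ 0} {+ E} (+<+ (ℕ.s≤s z≤n))

      0<N : 0 ℕ.< N
      0<N = ℤ.drop‿+<+ (toℚ-cancel-< {+ 0} {+ N} (≤-<-trans (≤-reflexive (sym (*-zeroʳ (toℚ (+ E)))))
        (<-≤-trans (*-monoʳ-<-pos (toℚ (+ E)) {{positive 0<E}} 0<ε) (≤-reflexive Eε≡N))))

      10⁷N<E : + 10000000 ℤ.* + N ℤ.< + E
      10⁷N<E = toℚ-cancel-< (≤-<-trans (≤-reflexive (trans (toℚ-* (+ 10000000) (+ N)) (cong (toℚ (+ 10000000) *_) (sym Eε≡N))))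
        (<-≤-trans (*-monoʳ-<-pos (toℚ (+ 10000000)) (*-monoʳ-<-pos (toℚ (+ E)) {{positive 0<E}} ε<ε₀))
          (≤-reflexive (trans (cong (toℚ (+ 10000000) *_) (*-comm (toℚ (+ E)) ε₀))
            (trans (sym (*-assoc (toℚ (+ 10000000)) ε₀ (toℚ (+ E)))) (*-identityˡ (toℚ (+ E))))))))

      N<E : N ℕ.< E
      N<E = ℤ.drop‿+<+ (ℤ.≤-<-trans (ℤ.≤-trans (ℤ.≤-reflexive (sym (ℤ.*-identityˡ (+ N))))
        (ℤ.*-monoʳ-≤-nonNeg (+ N) {+ 1} {+ 10000000} (+≤+ (ℕ.s≤s z≤n)))) 10⁷N<E)

      module _ {n s : ℕ} (G : Graph4 n) where
        edge-bound : (ℕ→ℚ (n C 4) - ℕ→ℚ ((n ∸ s) C 4)) - ε * ℕ→ℚ (n ^ 4) ≤ ℕ→ℚ (e G) →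
          + E ℤ.* (+ (n C 4) ℤ.- + ((n ∸ s) C 4)) ℤ.- + N ℤ.* (+ n ℤ.* + n ℤ.* + n ℤ.* + n) ℤ.≤ + E ℤ.* + e G
        edge-bound hyp = toℚ-cancel (≤-trans (≤-reflexive converted)
          (≤-trans (*-monoˡ-≤-nonNeg (toℚ (+ E)) {{nonNegative (<⇒≤ 0<E)}} hyp)
            (≤-reflexive (sym (toℚ-* (+ E) (+ e G))))))
          where
          c₁ c₂ p : ℤ
          c₁ = + (n C 4)
          c₂ = + ((n ∸ s) C 4)
          p = + n ℤ.* + n ℤ.* + n ℤ.* + n
          converted : toℚ (+ E ℤ.* (c₁ ℤ.- c₂) ℤ.- + N ℤ.* p) ≡ toℚ (+ E) * ((toℚ c₁ - toℚ c₂) - ε * ℕ→ℚ (n ^ 4))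
          converted = trans (toℚ-- (+ E ℤ.* (c₁ ℤ.- c₂)) (+ N ℤ.* p)) (trans (cong₂ _-_
              (trans (toℚ-* (+ E) (c₁ ℤ.- c₂)) (cong (toℚ (+ E) *_) (toℚ-- c₁ c₂)))
              (trans (toℚ-* (+ N) p) (trans (cong₂ _*_ (sym Eε≡N) (cong toℚ (sym (pos-^4 n))))
                (*-assoc (toℚ (+ E)) ε (ℕ→ℚ (n ^ 4))))))
            (sym (trans (*-distribˡ-+ (toℚ (+ E)) (toℚ c₁ - toℚ c₂) (- (ε * ℕ→ℚ (n ^ 4))))
              (cong (λ x → toℚ (+ E) * (toℚ c₁ - toℚ c₂) + x) (sym (neg-distribʳ-* (toℚ (+ E)) (ε * ℕ→ℚ (n ^ 4))))))))

        close : ∀ t x q → + E ℤ.* + (x ^ 4) ℤ.< + t ℤ.* + N ℤ.* + q → ℕ→ℚ (x ^ 4) < (ℕ→ℚ t * ε) * ℕ→ℚ q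
        close t x q lt = *-cancelˡ-<-nonNeg (toℚ (+ E)) {{nonNegative (<⇒≤ 0<E)}}
          (≤-<-trans (≤-reflexive (sym (toℚ-* (+ E) (+ (x ^ 4))))) (<-≤-trans (toℚ-mono-< lt) (≤-reflexive
            (trans (toℚ-* (+ t ℤ.* + N) (+ q)) (trans (cong (_* toℚ (+ q)) (trans (toℚ-* (+ t) (+ N))
              (trans (cong (toℚ (+ t) *_) (sym Eε≡N)) (rotate (toℚ (+ t)) (toℚ (+ E)) ε))))
              (*-assoc (toℚ (+ E)) (toℚ (+ t) * ε) (toℚ (+ q))))))))
          where
          rotate : ∀ a b c → a * (b * c) ≡ b * (a * c)
          rotate a b c = trans (sym (*-assoc a b c)) (trans (cong (_* c) (*-comm a b)) (*-assoc b a c))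

        conclusion : Stable G → FracMatchingNumber≤ G (ℕ→ℚ s) → 249 ℕ.* s ≤ℕ 50 ℕ.* n → 6 ℕ.* E ≤ℕ n →
          (ℕ→ℚ (n C 4) - ℕ→ℚ ((n ∸ s) C 4)) - ε * ℕ→ℚ (n ^ 4) ≤ ℕ→ℚ (e G) → Close100Root4 ε G (H₁ n s)
        conclusion stable ν≤s light 6E≤n hyp = close (100 ^ 4) (missing G (H₁ n s)) (n ^ 16) (rephrase (+ (100 ^ 4))
          (missing-fourth-power {n} {s} G stable ν≤s light 0<N N<E 6E≤n (edge-bound hyp) {+ (100 ^ 4)} {+ 10000000}
            (+<+ (ℕ.s≤s z≤n)) (ℤ.≤ᵇ⇒≤ _) 10⁷N<E))
          where
          y p : ℤ
          y = + missing G (H₁ n s)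
          p = + n ℤ.* + n ℤ.* + n ℤ.* + n
          n^16 : + (n ^ 16) ≡ p ℤ.* p ℤ.* p ℤ.* p
          n^16 = trans (cong +_ (sym (ℕ.^-*-assoc n 4 4))) (trans (pos-^4 (n ^ 4)) (cong (λ x → x ℤ.* x ℤ.* x ℤ.* x) (pos-^4 n)))
          rephrase : ∀ t → + E ℤ.* (y ℤ.* y ℤ.* y ℤ.* y) ℤ.< t ℤ.* + N ℤ.* (p ℤ.* p ℤ.* p ℤ.* p) →
            + E ℤ.* + (missing G (H₁ n s) ^ 4) ℤ.< t ℤ.* + N ℤ.* + (n ^ 16)
          rephrase t = subst₂ (λ a b → + E ℤ.* a ℤ.< t ℤ.* + N ℤ.* b) (sym (pos-^4 (missing G (H₁ n s)))) (sym n^16)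

theorem2p1 : ∀ (c : ℚ) → 0ℚ < c → c < (+ 1) / 5 →
    Σ ℚ (λ ε₀ → (0ℚ < ε₀) × (∀ (ε : ℚ) → 0ℚ < ε → ε < ε₀ →
    Σ ℕ (λ n₀ → ∀ (n s : ℕ) → n₀ ≤ℕ n →
    c * ℕ→ℚ n ≤ ℕ→ℚ s → (ℕ→ℚ 5 - δ) * ℕ→ℚ s ≤ ℕ→ℚ n - ℕ→ℚ 3 →
    ∀ (G : Graph4 n) → Stable G → FracMatchingNumber≤ G (ℕ→ℚ s) →
    (ℕ→ℚ (n C 4) - ℕ→ℚ ((n ∸ s) C 4)) - ε * ℕ→ℚ (n ^ 4) ≤ ℕ→ℚ (e G) →
    Close100Root4 ε G (H₁ n s))))
-- The threshold for n is six times the denominator of ε, as `large-order` requires.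
theorem2p1 _ _ _ = ε₀ , positive⁻¹ ε₀ , λ ε 0<ε ε<ε₀ → 6 Data.Nat.* E ε 0<ε ε<ε₀ ,
    λ n s 6E≤n _ sparse G stable ν≤s dense →
      conclusion ε 0<ε ε<ε₀ {n} {s} G stable ν≤s (light-order n s sparse) 6E≤n dense
  where
  open Conversion
  open import Data.Rational.Properties using (positive⁻¹)
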